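{- There exists $c>0$ such that for every $\varepsilon \in (0,1)$ there exists $n_0\in\mathbb{N}$ such that every tournament $G$ on $n \ge n_0$ vertices with $\delta^0(G) \ge (1/2 - c)n$ contains a $D$-tiling covering all but at most $\varepsilon n$ vertices.
   Context: A tournament is a loopless directed graph with exactly one of $uv$, $vu$ for each pair of distinct vertices. $\delta^0(G)$ is the minimum of all in- and out-degrees of vertices of $G$. $D = D_{1,1,2}$ is the tournament on vertices $a,b,c_1,c_2$ with edges $ab, bc_1, bc_2, c_1a, c_2a, c_1c_2$. A $D$-tiling is a collection of vertex-disjoint copies of $D$ in $G$. -}

module Defs where

open import Data.Nat using (ℕ; zero; suc; _+_)
open import Data.Fin using (Fin; zero; suc)
open import Data.Bool using (Bool; true; false; if_then_else_)
open import Data.Product using (_×_)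
open import Data.Sum using (_⊎_)
open import Relation.Binary.PropositionalEquality using (_≡_)
open import Relation.Nullary using (¬_)

count : {n : ℕ} → (Fin n → Bool) → ℕ
count {zero}  p = 0
count {suc n} p = (if p zero then 1 else 0) + count (λ i → p (suc i))

record Tournament (n : ℕ) : Set where
  field
    adj      : Fin n → Fin n → Bool
    loopless : ∀ v → adj v v ≡ false
    total    : ∀ u v → ¬ (u ≡ v) → (adj u v ≡ true) ⊎ (adj v u ≡ true)
    antisym  : ∀ u v → adj u v ≡ true → adj v u ≡ false

  Edge : Fin n → Fin n → Set
  Edge u v = adj u v ≡ true

  outdeg : Fin n → ℕ
  outdeg v = count (λ u → adj v u)

  indeg : Fin n → ℕ
  indeg v = count (λ u → adj u v)

open Tournament public

-- Vertices of D = D_{1,1,2}: a, b, c₁, c₂ encoded as 0,1,2,3 in Fin 4.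
vA vB vC₁ vC₂ : Fin 4
vA  = zero
vB  = suc zero
vC₁ = suc (suc zero)
vC₂ = suc (suc (suc zero))

-- f : Fin 4 → Fin n is a copy of D in G: injective and carries the edges
-- ab, bc₁, bc₂, c₁a, c₂a, c₁c₂ of D to edges of G (in a tournament this
-- already makes the copy induced).
IsCopyOfD : {n : ℕ} → Tournament n → (Fin 4 → Fin n) → Set
IsCopyOfD G f =
  (∀ i j → f i ≡ f j → i ≡ j) ×
  Edge G (f vA) (f vB) × Edge G (f vB) (f vC₁) × Edge G (f vB) (f vC₂) ×
  Edge G (f vC₁) (f vA) × Edge G (f vC₂) (f vA) × Edge G (f vC₁) (f vC₂)

record DTiling {n : ℕ} (G : Tournament n) (k : ℕ) : Set where
  field
    φ        : Fin k → Fin 4 → Fin n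
    copies   : ∀ i → IsCopyOfD G (φ i)
    disjoint : ∀ i i′ j j′ → φ i j ≡ φ i′ j′ → i ≡ i′

open import Data.Rational using (ℚ; _/_)
open import Data.Integer using (+_)

ℕ→ℚ : ℕ → ℚ
ℕ→ℚ m = + m / 1

{-# OPTIONS --safe #-}
module Submission where

-- Take a tiling with as many copies of D as possible and suppose that many vertices are uncovered.  The uncovered
-- part contains a long transitive sequence, cut into blocks L_1 ⇒ L_2 ⇒ ….  A vertex with many out-neighbours in
-- one block and many in-neighbours in a later one forms a copy of D with three vertices of L ("good").  For a
-- suitable block every other vertex, up to few exceptions, dominates nearly all of it ("minus") or is dominated by
-- nearly all of it ("plus"), and an edge from plus to minus forms a copy of D with two vertices of the block.  So
-- good vertices and such back edges are resources for new copies of D, and by maximality no t tiles contain t + 1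
-- disjoint resources, up to vertices outside all tiles.
--
-- Call a vertex rich if using it as a resource, after re-tiling boundedly many other tiles, gains one copy, and
-- exposed if it can be set free without loss, for instance because another vertex of its tile is rich.  A vertex
-- with many back edges to exposed vertices is rich, and no tile has two rich vertices.  If linearly many vertices
-- are exposed, then so few back edges meet them that the exposed minus (plus) vertices get their in-(out-)degree n/2
-- mostly from their own side; adding the two sides contradicts 3 · rich ≤ exposed unless new rich vertices keep
-- appearing, which cannot go on.  Hence few vertices are exposed, so for almost all pairs of tiles the back edges
-- between them form a star.  That leaves fewer back edges than the in-degrees of the minus vertices require.

-- `D` is a cyclic triangle with one vertex doubled, which is why two vertices of a block complete a
-- back edge. The final count looks tight at first: a star between two tiles has at most 4 edges, so
-- k tiles carry up to 4k² ≤ n²/4 over ordered pairs of tiles, and n²/4 is also what the degrees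
-- force. The gain comes from tile types (all minus, all plus, neither): tiles of equal type carry
-- at most 3 edges, and at least a third of all pairs agree, which leaves 11/48 < 12/48. All errors
-- are multiples of a unit `g` of about n/H, so a large constant H = 1/c absorbs them. Richness is
-- iterated for about 2H² rounds only, because rounds that each add n/H² rich vertices must then
-- exhaust n. Every exchange thus involves boundedly many resources, and the block sizes depend on H
-- alone. The uncovered set ends up bounded by a constant; ε enters only through `n₀`.

module Combinatorics where

  open import Data.Nat using (ℕ; zero; suc; _+_; _*_; _∸_; _^_; _≤_; _<_; _≥_; z≤n; s≤s; s≤s⁻¹; _≤?_; NonZero; >-nonZero)
  open import Data.Nat.Properties
  open import Data.Nat.DivMod using (_/_; _%_; m≡m%n+[m/n]*n; m%n<n)
  open import Data.Nat.Tactic.RingSolver using (solve-∀)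
  open import Data.Fin using (Fin; zero; suc; inject≤; combine) renaming (_<_ to _<F_)
  import Data.Fin.Properties as Fin
  open import Data.Bool using (Bool; true; false; if_then_else_; _∧_; _∨_; not)
  import Data.Bool.Properties as Bool
  open import Data.List using (List; []; _∷_; _++_; length; map; filter; lookup; allFin)
  open import Data.List.Properties using (length-++; length-map; length-tabulate)
  open import Data.List.Membership.Propositional using (_∈_; _∉_)
  open import Data.List.Membership.Propositional.Properties using (∈-lookup; ∈-filter⁻; ∈-filter⁺; ∈-++⁺ˡ; ∈-++⁺ʳ; ∈-++⁻)
  open import Data.List.Relation.Unary.Any using (here; there; index)
  open import Data.List.Relation.Unary.Any.Properties using (lookup-index)
  open import Data.List.Relation.Unary.All as All using (All; []; _∷_)
  import Data.List.Relation.Unary.All.Properties as All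
  open import Data.List.Relation.Unary.AllPairs as AllPairs using (AllPairs; []; _∷_)
  import Data.List.Relation.Unary.AllPairs.Properties as AllPairs
  open import Data.List.Relation.Unary.Unique.Propositional using (Unique)
  import Data.List.Relation.Unary.Unique.Propositional.Properties as Unique
  open import Data.Product using (_×_; ∃; _,_; proj₁; proj₂)
  open import Data.Sum using (_⊎_; inj₁; inj₂; [_,_]′; map₂)
  import Data.Sum.Properties as Sum
  open import Data.Empty using (⊥; ⊥-elim)
  open import Function using (_∘_)
  open import Relation.Binary.Definitions using (Tri; tri<; tri≈; tri>)
  open import Relation.Nullary using (¬_; Dec; yes; no)
  open import Relation.Nullary.Decidable using (⌊_⌋; _×-dec_; _⊎-dec_; _→-dec_; ¬?; map′)
  open import Relation.Binary.PropositionalEquality using (_≡_; _≢_; refl; sym; trans; cong; cong₂; subst; subst₂)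
  open import Algebra.Properties.Semiring.Sum +-*-semiring
    using (sum; sum-cong-≗; ∑-distrib-+; ∑-comm; *-distribˡ-sum; *-distribʳ-sum)
  open import Defs

  -- Sums over finite types

  𝟙 : Bool → ℕ
  𝟙 b = if b then 1 else 0

  count-sum : ∀ {n} (p : Fin n → Bool) → count p ≡ sum (λ i → 𝟙 (p i))
  count-sum {zero} p = refl
  count-sum {suc n} p = cong (𝟙 (p zero) +_) (count-sum (p ∘ suc))

  sum-mono : ∀ {n} {f g : Fin n → ℕ} → (∀ i → f i ≤ g i) → sum f ≤ sum g
  sum-mono {zero} h = z≤n
  sum-mono {suc n} h = +-mono-≤ (h zero) (sum-mono (h ∘ suc))

  sum-const : ∀ n c → sum {n} (λ _ → c) ≡ n * c
  sum-const zero c = refl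
  sum-const (suc n) c = cong (c +_) (sum-const n c)

  term≤sum : ∀ {n} (f : Fin n → ℕ) i → f i ≤ sum f
  term≤sum {suc n} f zero = m≤m+n _ _
  term≤sum {suc n} f (suc i) = ≤-trans (term≤sum (f ∘ suc) i) (m≤n+m _ _)

  sum-0 : ∀ {n} {f : Fin n → ℕ} → (∀ i → f i ≡ 0) → sum f ≡ 0
  sum-0 {n} h = trans (sum-cong-≗ h) (trans (sum-const n 0) (*-zeroʳ n))

  sum-single : ∀ {n} {f : Fin n → ℕ} i → (∀ j → j ≢ i → f j ≡ 0) → sum f ≡ f i
  sum-single {suc n} {f} zero h =
    trans (cong (f zero +_) (sum-0 (λ i → h (suc i) λ ()))) (+-identityʳ _)
  sum-single {suc n} {f} (suc i) h
    rewrite h zero (λ ()) = sum-single i (λ j j≢i → h (suc j) (j≢i ∘ Fin.suc-injective))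

  sum-Fin⁻ : ∀ {n} {f : Fin n → ℕ} → 0 < sum f → ∃ λ i → 0 < f i
  sum-Fin⁻ {suc n} {f} h with f zero in eq
  ... | suc _ = zero , subst (0 <_) (sym eq) (s≤s z≤n)
  ... | zero with sum-Fin⁻ {f = f ∘ suc} h
  ...   | i , p = suc i , p

  sum-<⇒∃ : ∀ {n} {f g : Fin n → ℕ} → sum f < sum g → ∃ λ i → f i < g i
  sum-<⇒∃ {n} {f} {g} h with Fin.any? (λ i → f i <? g i)
  ... | yes p = p
  ... | no ¬p = ⊥-elim (<⇒≱ h (sum-mono (λ i → ≮⇒≥ (λ lt → ¬p (i , lt)))))

  card : ∀ {n} → (Fin n → Bool) → ℕ
  card p = sum (λ i → 𝟙 (p i))

  𝟙≤1 : ∀ b → 𝟙 b ≤ 1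
  𝟙≤1 true = ≤-refl
  𝟙≤1 false = z≤n

  card≤n : ∀ {n} (p : Fin n → Bool) → card p ≤ n
  card≤n {n} p = subst (card p ≤_) (trans (sum-const n 1) (*-identityʳ n)) (sum-mono (𝟙≤1 ∘ p))

  sum-bound : ∀ {n} {f : Fin n → ℕ} c → (∀ i → f i ≤ c) → sum f ≤ n * c
  sum-bound {n} {f} c h = subst (sum f ≤_) (sum-const n c) (sum-mono h)

  card-<⇒∃ : ∀ {n} {p q : Fin n → Bool} → card q < card p → ∃ λ i → p i ≡ true × q i ≡ false
  card-<⇒∃ {_} {p} {q} h with sum-<⇒∃ {f = 𝟙 ∘ q} {g = 𝟙 ∘ p} h
  ... | i , lt with p i in pe | q i in qe
  ...   | true  | false = i , pe , qe
  ...   | true  | true  = ⊥-elim (<-irrefl refl lt)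
  ...   | false | true = ⊥-elim (<⇒≱ lt z≤n)
  ...   | false | false = ⊥-elim (<-irrefl refl lt)

  _==_ : ∀ {n} → Fin n → Fin n → Bool
  i == j = ⌊ i Fin.≟ j ⌋

  ==-refl : ∀ {n} (i : Fin n) → (i == i) ≡ true
  ==-refl i with i Fin.≟ i
  ... | yes _ = refl
  ... | no ¬p = ⊥-elim (¬p refl)

  ==⇒≡ : ∀ {n} {i j : Fin n} → (i == j) ≡ true → i ≡ j
  ==⇒≡ {_} {i} {j} h with i Fin.≟ j
  ... | yes p = p
  ... | no ¬p = ⊥-elim (case-false h) where
    case-false : false ≡ true → ⊥
    case-false ()

  ==-≢ : ∀ {n} {i j : Fin n} → i ≢ j → (i == j) ≡ false
  ==-≢ {_} {i} {j} h with i Fin.≟ j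
  ... | yes p = ⊥-elim (h p)
  ... | no _ = refl

  -- Preimage counts turn a sum over an indexed family into a weighted sum over vertices.
  -- Injectivity makes the weights at most 1, covering makes them at least 1.
  fibre : ∀ {m n} → (Fin m → Fin n) → Fin n → ℕ
  fibre f v = card (λ a → f a == v)

  fibre-≤1 : ∀ {m n} (f : Fin m → Fin n) → (∀ i j → f i ≡ f j → i ≡ j) → ∀ v → fibre f v ≤ 1
  fibre-≤1 f inj v with Fin.any? (λ a → f a Fin.≟ v)
  ... | no ¬p = ≤-trans (≤-reflexive (sum-0 (λ a → cong 𝟙 (==-≢ (λ e → ¬p (a , e)))))) z≤n
  ... | yes (a , refl) =
    ≤-trans (≤-reflexive (sum-single a λ b b≢a → cong 𝟙 (==-≢ (λ e → b≢a (inj b a e))))) (𝟙≤1 _)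

  fibre-image : ∀ {m n} (f : Fin m → Fin n) a → 1 ≤ fibre f (f a)
  fibre-image f a = ≤-trans (≤-reflexive (sym (cong 𝟙 (==-refl (f a))))) (term≤sum (λ b → 𝟙 (f b == f a)) a)

  sum-fibre : ∀ {m n} (f : Fin m → Fin n) (g : Fin n → ℕ) →
              sum (λ a → g (f a)) ≡ sum (λ v → fibre f v * g v)
  sum-fibre {m} {n} f g = trans (sum-cong-≗ expand) (trans (∑-comm (λ a v → 𝟙 (f a == v) * g v)) (sum-cong-≗ λ v → sym (*-distribʳ-sum (g v) (λ a → 𝟙 (f a == v)))))
    where
    expand : ∀ a → g (f a) ≡ sum (λ v → 𝟙 (f a == v) * g v)
    expand a = sym (trans (sum-single (f a) (λ v v≢ → cong (λ b → 𝟙 b * g v) (==-≢ (v≢ ∘ sym))))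
      (trans (cong (λ b → 𝟙 b * g (f a)) (==-refl (f a))) (*-identityˡ _)))

  module DoubleFamily {k l n : ℕ} (φ : Fin k → Fin l → Fin n) where

    fibre₂ : Fin n → ℕ
    fibre₂ v = sum (λ i → fibre (φ i) v)

    sum-fibre₂ : (g : Fin n → ℕ) → sum (λ i → sum (λ j → g (φ i j))) ≡ sum (λ v → fibre₂ v * g v)
    sum-fibre₂ g = trans (sum-cong-≗ (λ i → sum-fibre (φ i) g))
      (trans (∑-comm (λ i v → fibre (φ i) v * g v)) (sum-cong-≗ λ v → sym (*-distribʳ-sum (g v) (λ i → fibre (φ i) v))))

    fibre₂-≤1 : (∀ i i′ j j′ → φ i j ≡ φ i′ j′ → i ≡ i′ × j ≡ j′) → ∀ v → fibre₂ v ≤ 1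
    fibre₂-≤1 inj v with Fin.any? (λ i → 1 ≤? fibre (φ i) v)
    ... | no ¬p = ≤-trans (≤-reflexive (sum-0 (λ i → n<1⇒n≡0 (≰⇒> (λ q → ¬p (i , q)))))) z≤n
    ... | yes (i , q) = ≤-trans (≤-reflexive (sum-single i other)) (fibre-≤1 (φ i) (λ j j′ e → proj₂ (inj i i j j′ e)) v)
      where
      hit : ∀ i′ → 1 ≤ fibre (φ i′) v → ∃ λ j → φ i′ j ≡ v
      hit i′ q′ with sum-Fin⁻ q′
      ... | j , pos with φ i′ j == v in eq
      ...   | true = j , ==⇒≡ eq
      ...   | false = ⊥-elim (<-irrefl refl pos)
      other : ∀ i′ → i′ ≢ i → fibre (φ i′) v ≡ 0
      other i′ i′≢i with 1 ≤? fibre (φ i′) v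
      ... | no ¬q = n<1⇒n≡0 (≰⇒> ¬q)
      ... | yes q′ with hit i q | hit i′ q′
      ...   | j , e | j′ , e′ = ⊥-elim (i′≢i (proj₁ (inj i′ i j′ j (trans e′ (sym e)))))

    fibre₂-image : ∀ i j → 1 ≤ fibre₂ (φ i j)
    fibre₂-image i j = ≤-trans (fibre-image (φ i) j) (term≤sum (λ i′ → fibre (φ i′) (φ i j)) i)

    sum₂-≤ : (∀ i i′ j j′ → φ i j ≡ φ i′ j′ → i ≡ i′ × j ≡ j′) →
             (g : Fin n → ℕ) → sum (λ i → sum (λ j → g (φ i j))) ≤ sum g
    sum₂-≤ inj g = ≤-trans (≤-reflexive (sum-fibre₂ g))
      (sum-mono (λ v → ≤-trans (*-monoˡ-≤ (g v) (fibre₂-≤1 inj v)) (≤-reflexive (*-identityˡ _))))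

    sum≤sum₂ : (g : Fin n → ℕ) → (∀ v → g v ≢ 0 → ∃ λ i → ∃ λ j → φ i j ≡ v) →
               sum g ≤ sum (λ i → sum (λ j → g (φ i j)))
    sum≤sum₂ g cover = ≤-trans (sum-mono pt) (≤-reflexive (sym (sum-fibre₂ g)))
      where
      pt : ∀ v → g v ≤ fibre₂ v * g v
      pt v with g v in eq
      ... | zero = z≤n
      ... | suc x with cover v (λ e → 0≢1+n (trans (sym e) eq))
      ...   | i , j , refl = m≤m*n′ (fibre₂-image i j)
        where
        m≤m*n′ : ∀ {c y} → 1 ≤ c → y ≤ c * y
        m≤m*n′ {c} {y} p = ≤-trans (≤-reflexive (sym (*-identityˡ y))) (*-monoˡ-≤ y p)

  ∑-+₃ : ∀ {n} (f g h : Fin n → ℕ) → sum (λ i → f i + g i + h i) ≡ sum f + sum g + sum h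
  ∑-+₃ f g h = trans (∑-distrib-+ (λ i → f i + g i) h) (cong (_+ sum h) (∑-distrib-+ f g))

  -- Tilings

  -- Without function extensionality a function space can be searched only up to pointwise equality;
  -- hence the predicates have to respect `_≈_`.
  Searchable : (A : Set) → (A → A → Set) → Set₁
  Searchable A _≈_ = (P : A → Set) → (∀ {x y} → x ≈ y → P x → P y) → (∀ x → Dec (P x)) → Dec (∃ P)

  searchable-Fin : ∀ {n} → Searchable (Fin n) _≡_
  searchable-Fin P _ P? = Fin.any? P?

  searchable-→ : ∀ {m} {A : Set} {_≈_ : A → A → Set} → (∀ x → x ≈ x) →
                 Searchable A _≈_ → Searchable (Fin m → A) (λ f g → ∀ i → f i ≈ g i)
  searchable-→ {zero} _ _ P resp P? =
    map′ (_ ,_) (λ (_ , p) → resp (λ ()) p) (P? (λ ()))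
  searchable-→ {suc m} {A} {_≈_} ≈-refl search P resp P? =
    map′ (λ (a , f , p) → cons a f , p)
         (λ (f , p) → f zero , f ∘ suc , resp (λ { zero → ≈-refl _ ; (suc i) → ≈-refl _ }) p)
         (search (λ a → ∃ λ f → P (cons a f))
           (λ a≈b (f , p) → f , resp (λ { zero → a≈b ; (suc i) → ≈-refl _ }) p)
           (λ a → searchable-→ ≈-refl search (λ f → P (cons a f))
             (λ f≈g → resp (λ { zero → ≈-refl _ ; (suc i) → f≈g i })) (λ f → P? (cons a f))))
    where
    cons : A → (Fin m → A) → Fin (suc m) → A
    cons a f zero = a
    cons a f (suc i) = f i

  allPairs-lookup : ∀ {a r} {A : Set a} {R : A → A → Set r} → (∀ {x y} → R x y → R y x) →
                    ∀ {xs} → AllPairs R xs → ∀ i j → i ≢ j → R (lookup xs i) (lookup xs j)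
  allPairs-lookup R-sym (_ ∷ _) zero zero i≢j = ⊥-elim (i≢j refl)
  allPairs-lookup R-sym {_ ∷ xs} (r ∷ _) zero (suc j) _ = All.lookup r (∈-lookup j)
  allPairs-lookup R-sym {_ ∷ xs} (r ∷ _) (suc i) zero _ = R-sym (All.lookup r (∈-lookup i))
  allPairs-lookup R-sym (_ ∷ rs) (suc i) (suc j) i≢j = allPairs-lookup R-sym rs i j (i≢j ∘ cong suc)

  unique-⊆⇒length≤ : ∀ {a} {A : Set a} {xs ys : List A} → Unique xs → (∀ {x} → x ∈ xs → x ∈ ys) →
                     length xs ≤ length ys
  unique-⊆⇒length≤ {_} {_} {xs} {ys} u sub with length xs ≤? length ys
  ... | yes p = p
  ... | no ¬p with Fin.pigeonhole (≰⇒> ¬p) (λ i → index (sub (∈-lookup {xs = xs} i)))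
  ...   | i , j , i<j , eq = ⊥-elim (allPairs-lookup (λ x≢y → x≢y ∘ sym) u i j (Fin.<⇒≢ i<j)
            (trans (lookup-index (sub (∈-lookup i))) (trans (cong (lookup ys) eq) (sym (lookup-index (sub (∈-lookup j)))))))

  module Tilings {n : ℕ} (G : Tournament n) where

    Copy : Set
    Copy = Fin 4 → Fin n

    Apart : Copy → Copy → Set
    Apart f g = ∀ j j′ → f j ≢ g j′

    edge? : ∀ u v → Dec (Edge G u v)
    edge? u v = adj G u v Bool.≟ true

    isCopyOfD? : ∀ f → Dec (IsCopyOfD G f)
    isCopyOfD? f =
      Fin.all? (λ i → Fin.all? λ j → (f i Fin.≟ f j) →-dec (i Fin.≟ j)) ×-dec
      edge? _ _ ×-dec edge? _ _ ×-dec edge? _ _ ×-dec edge? _ _ ×-dec edge? _ _ ×-dec edge? _ _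

    isCopyOfD-resp : ∀ {f g : Copy} → (∀ i → f i ≡ g i) → IsCopyOfD G f → IsCopyOfD G g
    isCopyOfD-resp {f} {g} f≗g (inj , ab , bc₁ , bc₂ , c₁a , c₂a , c₁c₂) =
      (λ i j e → inj i j (trans (f≗g i) (trans e (sym (f≗g j))))) ,
      mv ab , mv bc₁ , mv bc₂ , mv c₁a , mv c₂a , mv c₁c₂
      where
      mv : ∀ {i j} → Edge G (f i) (f j) → Edge G (g i) (g j)
      mv = subst₂ (Edge G) (f≗g _) (f≗g _)

    dTiling? : ∀ k → Dec (DTiling G k)
    dTiling? k = map′
      (λ (φ , c , d) → record { φ = φ ; copies = c ; disjoint = d })
      (λ t → DTiling.φ t , DTiling.copies t , DTiling.disjoint t)
      (searchable-→ (λ _ _ → refl) (searchable-→ (λ _ → refl) searchable-Fin)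
        (λ φ → (∀ i → IsCopyOfD G (φ i)) × (∀ i i′ j j′ → φ i j ≡ φ i′ j′ → i ≡ i′))
        (λ f≗g (c , d) → (λ i → isCopyOfD-resp (f≗g i) (c i)) ,
          λ i i′ j j′ e → d i i′ j j′ (trans (f≗g i j) (trans e (sym (f≗g i′ j′)))))
        (λ φ → Fin.all? (isCopyOfD? ∘ φ) ×-dec
          Fin.all? λ i → Fin.all? λ i′ → Fin.all? λ j → Fin.all? λ j′ →
            (φ i j Fin.≟ φ i′ j′) →-dec (i Fin.≟ i′)))

    module _ {k : ℕ} (T : DTiling G k) where
      open DTiling T

      φ-injective : ∀ i i′ j j′ → φ i j ≡ φ i′ j′ → i ≡ i′ × j ≡ j′
      φ-injective i i′ j j′ e with disjoint i i′ j j′ e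
      ... | refl = refl , proj₁ (copies i) j j′ e

      tiling-size : k * 4 ≤ n
      tiling-size = subst₂ _≤_ (trans (sum-const k 4) refl) (trans (sum-const n 1) (*-identityʳ n))
        (DoubleFamily.sum₂-≤ φ φ-injective (λ _ → 1))

    -- Decidability of `DTiling G k` replaces the choice of a maximum: the size grows until `suc k`
    -- fails, and `k * 4 ≤ n` makes the fuel suffice.
    maximal-tiling : ∃ λ k → DTiling G k × ¬ DTiling G (suc k)
    maximal-tiling = go (suc n) 0 (≤-reflexive (sym (+-identityʳ _))) empty
      where
      empty : DTiling G 0
      empty = record { φ = λ () ; copies = λ () ; disjoint = λ () }
      go : ∀ fuel k → suc n ≤ fuel + k → DTiling G k → ∃ λ k → DTiling G k × ¬ DTiling G (suc k)
      go zero k n<k T = ⊥-elim (<⇒≱ n<k (≤-trans (m≤m*n k 4) (tiling-size T)))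
      go (suc fuel) k h T = step (dTiling? (suc k))
        where
        step : Dec (DTiling G (suc k)) → ∃ λ k → DTiling G k × ¬ DTiling G (suc k)
        step (no ¬T) = k , T , ¬T
        step (yes T′) = go fuel (suc k) (≤-trans h (≤-reflexive (sym (+-suc fuel k)))) T′

    fromList : (Cs : List Copy) → All (IsCopyOfD G) Cs → AllPairs Apart Cs → DTiling G (length Cs)
    fromList Cs cs ap = record
      { φ = lookup Cs
      ; copies = λ i → All.lookup cs (∈-lookup i)
      ; disjoint = λ i i′ j j′ e → dis i i′ j j′ e
      }
      where
      dis : ∀ i i′ j j′ → lookup Cs i j ≡ lookup Cs i′ j′ → i ≡ i′
      dis i i′ j j′ e with i Fin.≟ i′
      ... | yes p = p
      ... | no i≢i′ = ⊥-elim (allPairs-lookup (λ a j j′ → a j′ j ∘ sym) ap i i′ i≢i′ j j′ e)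

    shrink : ∀ {m k} → k ≤ m → DTiling G m → DTiling G k
    shrink k≤m T = record
      { φ = λ i → φ (inject≤ i k≤m)
      ; copies = λ i → copies (inject≤ i k≤m)
      ; disjoint = λ i i′ j j′ e → Fin.inject≤-injective k≤m k≤m i i′ (disjoint _ _ j j′ e)
      } where open DTiling T

    module _ {k : ℕ} (T : DTiling G k) where
      open DTiling T
      open import Data.List.Membership.DecPropositional (Fin._≟_ {k}) using (_∈?_)

      -- Dropping the tiles in `Q` loses at most `length Q` of them, even if `Q` has repetitions; so
      -- it is enough to compare `k` with `length Q + length kept`.
      exchange : (Q : List (Fin k)) (Cs : List Copy) → All (IsCopyOfD G) Cs → AllPairs Apart Cs →
                 (∀ {C} → C ∈ Cs → ∀ i → i ∉ Q → Apart (φ i) C) →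
                 length Q < length Cs → DTiling G (suc k)
      exchange Q Cs cs ap away lt = shrink size (fromList (map φ kept ++ Cs)
          (All.++⁺ (All.map⁺ (All.universal copies kept)) cs)
          (AllPairs.++⁺ (AllPairs.map⁺ keptApart) ap
            (All.map⁺ (All.tabulate λ {i} i∈ → All.tabulate λ C∈ → away C∈ i (proj₂ (∈-filter⁻ (¬? ∘ (_∈? Q)) {xs = allFin k} i∈))))))
        where
        kept : List (Fin k)
        kept = filter (¬? ∘ (_∈? Q)) (allFin k)
        keptApart : AllPairs (λ i i′ → Apart (φ i) (φ i′)) kept
        keptApart = AllPairs.map (λ i≢i′ j j′ e → i≢i′ (disjoint _ _ j j′ e))
          (Unique.filter⁺ (¬? ∘ (_∈? Q)) (Unique.allFin⁺ k))
        covered : ∀ {i} → i ∈ allFin k → i ∈ Q ++ kept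
        covered {i} i∈ with i ∈? Q
        ... | yes i∈Q = ∈-++⁺ˡ i∈Q
        ... | no i∉Q = ∈-++⁺ʳ Q (∈-filter⁺ (¬? ∘ (_∈? Q)) i∈ i∉Q)
        k≤ : k ≤ length Q + length kept
        k≤ = subst₂ _≤_ (length-tabulate (λ i → i)) (length-++ Q)
               (unique-⊆⇒length≤ (Unique.allFin⁺ k) covered)
        size : suc k ≤ length (map φ kept ++ Cs)
        size = subst (suc k ≤_) (sym (trans (length-++ (map φ kept)) (cong (_+ length Cs) (length-map φ kept))))
          (≤-trans (s≤s (≤-trans k≤ (≤-reflexive (+-comm (length Q) _))))
            (≤-trans (≤-reflexive (sym (+-suc (length kept) (length Q)))) (+-monoʳ-≤ (length kept) lt)))

  -- Resources built on a transitive sequence of blocks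

  -- plus: dominated by nearly all of the chosen block; minus: dominating nearly all of it; good: forms a copy of D with
  -- three vertices of two blocks; other: on the blocks, or mixed with respect to the chosen one.
  data Class : Set where
    plus minus good other : Class

  -- The last two arguments are the edge and its reverse. A back edge always points from plus to
  -- minus, but the relation `R` built from it can be read from either end.
  back : Class → Class → Bool → Bool → Bool
  back plus  minus e _ = e
  back minus plus  _ e = e
  back _     _     _ _ = false

  true≢false : true ≢ false
  true≢false ()

  module Resources {n : ℕ} (cls : Fin n → Class) (adj : Fin n → Fin n → Bool) where

    R : Fin n → Fin n → Bool
    R u v = back (cls u) (cls v) (adj u v) (adj v u)

    data Resource : Set where
      single : (v : Fin n) → cls v ≡ good → Resource
      pair   : (u v : Fin n) → R u v ≡ true → Resource

    _∈ᵣ_ : Fin n → Resource → Set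
    x ∈ᵣ single v _ = x ≡ v
    x ∈ᵣ pair u v _ = x ≡ u ⊎ x ≡ v

    DisjointR : Resource → Resource → Set
    DisjointR r r′ = ∀ {x} → x ∈ᵣ r → x ∈ᵣ r′ → ⊥

  module _ {n : ℕ} (G : Tournament n) where

    edge⇒≢ : ∀ {u v} → Edge G u v → u ≢ v
    edge⇒≢ {u} e refl = true≢false (trans (sym e) (loopless G u))

    mkCopy : (a b c₁ c₂ : Fin n) → Fin 4 → Fin n
    mkCopy a b c₁ c₂ zero = a
    mkCopy a b c₁ c₂ (suc zero) = b
    mkCopy a b c₁ c₂ (suc (suc zero)) = c₁
    mkCopy a b c₁ c₂ (suc (suc (suc zero))) = c₂

    mkCopy-correct : ∀ {a b c₁ c₂} → Edge G a b → Edge G b c₁ → Edge G b c₂ → Edge G c₁ a → Edge G c₂ a →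
                     Edge G c₁ c₂ → IsCopyOfD G (mkCopy a b c₁ c₂)
    mkCopy-correct {a} {b} {c₁} {c₂} ab bc₁ bc₂ c₁a c₂a cc = inj , ab , bc₁ , bc₂ , c₁a , c₂a , cc
      where
      no-loop : ∀ {A : Set} {u v} → Edge G u v → u ≡ v → A
      no-loop e eq = ⊥-elim (edge⇒≢ e eq)
      inj : ∀ i j → mkCopy a b c₁ c₂ i ≡ mkCopy a b c₁ c₂ j → i ≡ j
      inj zero zero _ = refl
      inj zero (suc zero) e = no-loop ab e
      inj zero (suc (suc zero)) e = no-loop c₁a (sym e)
      inj zero (suc (suc (suc zero))) e = no-loop c₂a (sym e)
      inj (suc zero) zero e = no-loop ab (sym e)
      inj (suc zero) (suc zero) _ = refl
      inj (suc zero) (suc (suc zero)) e = no-loop bc₁ e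
      inj (suc zero) (suc (suc (suc zero))) e = no-loop bc₂ e
      inj (suc (suc zero)) zero e = no-loop c₁a e
      inj (suc (suc zero)) (suc zero) e = no-loop bc₁ (sym e)
      inj (suc (suc zero)) (suc (suc zero)) _ = refl
      inj (suc (suc zero)) (suc (suc (suc zero))) e = no-loop cc e
      inj (suc (suc (suc zero))) zero e = no-loop c₂a e
      inj (suc (suc (suc zero))) (suc zero) e = no-loop bc₂ (sym e)
      inj (suc (suc (suc zero))) (suc (suc zero)) e = no-loop cc (sym e)
      inj (suc (suc (suc zero))) (suc (suc (suc zero))) _ = refl

    InCopy : (Fin 4 → Fin n) → (a b c₁ c₂ : Fin n) → Set
    InCopy C a b c₁ c₂ = ∀ j → C j ≡ a ⊎ C j ≡ b ⊎ C j ≡ c₁ ⊎ C j ≡ c₂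

    -- Apart from each other, `c₁` and `c₂` have the same neighbours in `D`, so whichever way the
    -- edge between them points, swapping their names gives a copy.
    copy-from : ∀ {a b c₁ c₂} → Edge G a b → Edge G b c₁ → Edge G b c₂ → Edge G c₁ a → Edge G c₂ a →
                c₁ ≢ c₂ → ∃ λ C → IsCopyOfD G C × InCopy C a b c₁ c₂
    copy-from {a} {b} {c₁} {c₂} ab bc₁ bc₂ c₁a c₂a c₁≢c₂ with total G c₁ c₂ c₁≢c₂
    ... | inj₁ e = mkCopy a b c₁ c₂ , mkCopy-correct ab bc₁ bc₂ c₁a c₂a e , λ where
      zero → inj₁ refl
      (suc zero) → inj₂ (inj₁ refl)
      (suc (suc zero)) → inj₂ (inj₂ (inj₁ refl))
      (suc (suc (suc zero))) → inj₂ (inj₂ (inj₂ refl))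
    ... | inj₂ e = mkCopy a b c₂ c₁ , mkCopy-correct ab bc₂ bc₁ c₂a c₁a e , λ where
      zero → inj₁ refl
      (suc zero) → inj₂ (inj₁ refl)
      (suc (suc zero)) → inj₂ (inj₂ (inj₂ refl))
      (suc (suc (suc zero))) → inj₂ (inj₂ (inj₁ refl))

  module Blocks {n : ℕ} (G : Tournament n) (q w h : ℕ) (3h≤w : h + h + h ≤ w)
    (L : Fin q → Fin w → Fin n)
    (L-injective : ∀ i a b → L i a ≡ L i b → a ≡ b)
    (L-edge : ∀ i j a b → i <F j → Edge G (L i a) (L j b)) where

    open import Data.List.Membership.DecPropositional (Fin._≟_ {n}) using (_∈?_)

    OnL : Fin n → Set
    OnL x = ∃ λ i → ∃ λ a → L i a ≡ x

    abstract
      onL? : ∀ x → Dec (OnL x)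
      onL? x = Fin.any? λ i → Fin.any? λ a → L i a Fin.≟ x

    outN inN : Fin n → Fin q → ℕ
    outN x i = card (λ a → adj G x (L i a))
    inN x i = card (λ a → adj G (L i a) x)

    -- Block `i` dominates the later block `j`, so out-neighbours in `i` and in-neighbours in `j`
    -- close cyclic triangles with `x`. With the blocks interchanged the triangles would be
    -- transitive.
    Good : Fin n → Set
    Good x = ∃ λ i → ∃ λ j → i <F j × h ≤ outN x i × h ≤ inN x j

    abstract
      good? : ∀ x → Dec (Good x)
      good? x = Fin.any? λ i → Fin.any? λ j → (i Fin.<? j) ×-dec (h ≤? outN x i) ×-dec (h ≤? inN x j)

    Mixed : Fin n → Fin q → Set
    Mixed x i = ¬ Good x × h ≤ outN x i × h ≤ inN x i

    -- Of two such blocks, the earlier one supplies out-neighbours and the later one in-neighbours,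
    -- which would make the vertex good.
    mixed-unique : ∀ x i j → Mixed x i → Mixed x j → i ≡ j
    mixed-unique x i j (¬g , o , ι) (_ , o′ , ι′) with Fin.<-cmp i j
    ... | tri< i<j _ _ = ⊥-elim (¬g (i , j , i<j , o , ι′))

    ... | tri≈ _ e _ = e
    ... | tri> _ _ j<i = ⊥-elim (¬g (j , i , j<i , o′ , ι))

    pick : ∀ i (Us : List (Fin n)) (p : Fin w → Bool) → length Us < card p → ∃ λ a → p a ≡ true × L i a ∉ Us
    pick i Us p lt with card-<⇒∃ {p = p} {q = λ a → ⌊ L i a ∈? Us ⌋} (≤-<-trans (bound Us) lt)
      where
      bound : ∀ Us → card (λ a → ⌊ L i a ∈? Us ⌋) ≤ length Us
      bound [] = ≤-reflexive (sum-0 {f = λ a → 𝟙 ⌊ L i a ∈? [] ⌋} (λ _ → refl))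
      bound (u ∷ Us) = ≤-trans (sum-mono pt)
        (≤-trans (≤-reflexive (∑-distrib-+ (λ a → 𝟙 (L i a == u)) (λ a → 𝟙 ⌊ L i a ∈? Us ⌋)))
          (+-mono-≤ (fibre-≤1 (L i) (L-injective i) u) (bound Us)))
        where
        pt : ∀ a → 𝟙 ⌊ L i a ∈? (u ∷ Us) ⌋ ≤ 𝟙 (L i a == u) + 𝟙 ⌊ L i a ∈? Us ⌋
        pt a with L i a Fin.≟ u | L i a ∈? Us
        ... | yes _ | _ = s≤s z≤n
        ... | no _ | yes _ = s≤s z≤n
        ... | no _ | no _ = z≤n
    ... | a , pa , qa with L i a ∈? Us
    ...   | no ∉ = a , pa , ∉

    pick₂ : ∀ i (Us : List (Fin n)) (p : Fin w → Bool) → suc (length Us) < card p →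
            ∃ λ a → ∃ λ b → a ≢ b × p a ≡ true × p b ≡ true × L i a ∉ Us × L i b ∉ Us
    pick₂ i Us p lt with pick i Us p (<-trans (n<1+n _) lt)
    ... | a , pa , a∉ with pick i (L i a ∷ Us) p lt
    ...   | b , pb , b∉ = a , b , (λ a≡b → b∉ (here (cong (L i) (sym a≡b)))) , pa , pb , a∉ , b∉ ∘ there

    module Classify (i₀ : Fin q) where

      abstract
        cls : Fin n → Class
        cls x with onL? x | good? x | h ≤? inN x i₀ | h ≤? outN x i₀
        ... | yes _ | _ | _ | _ = other
        ... | no _ | yes _ | _ | _ = good
        ... | no _ | no _ | no _ | _ = minus
        ... | no _ | no _ | yes _ | no _ = plus
        ... | no _ | no _ | yes _ | yes _ = other

        cls-good : ∀ x → cls x ≡ good → ¬ OnL x × Good x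
        cls-good x e with onL? x | good? x | h ≤? inN x i₀ | h ≤? outN x i₀
        cls-good x e | no ¬l | yes g | _ | _ = ¬l , g
        cls-good x () | yes _ | _ | _ | _
        cls-good x () | no _ | no _ | no _ | _
        cls-good x () | no _ | no _ | yes _ | no _
        cls-good x () | no _ | no _ | yes _ | yes _

        cls-minus : ∀ x → cls x ≡ minus → ¬ OnL x × inN x i₀ < h
        cls-minus x e with onL? x | good? x | h ≤? inN x i₀ | h ≤? outN x i₀
        cls-minus x e | no ¬l | no _ | no ¬i | _ = ¬l , ≰⇒> ¬i
        cls-minus x () | no ¬l | yes g | _ | _
        cls-minus x () | yes _ | _ | _ | _
        cls-minus x () | no _ | no _ | yes _ | no _
        cls-minus x () | no _ | no _ | yes _ | yes _

        cls-plus : ∀ x → cls x ≡ plus → ¬ OnL x × outN x i₀ < h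
        cls-plus x e with onL? x | good? x | h ≤? inN x i₀ | h ≤? outN x i₀
        cls-plus x e | no ¬l | no _ | yes _ | no ¬o = ¬l , ≰⇒> ¬o
        cls-plus x () | no ¬l | yes g | _ | _
        cls-plus x () | yes _ | _ | _ | _
        cls-plus x () | no _ | no _ | no _ | _
        cls-plus x () | no _ | no _ | yes _ | yes _

        cls-other : ∀ x → cls x ≡ other → OnL x ⊎ Mixed x i₀
        cls-other x e with onL? x | good? x | h ≤? inN x i₀ | h ≤? outN x i₀
        cls-other x e | yes l | _ | _ | _ = inj₁ l
        cls-other x () | no ¬l | yes g | _ | _
        cls-other x () | no _ | no _ | no _ | _
        cls-other x () | no _ | no _ | yes _ | no _
        cls-other x e | no _ | no ¬g | yes ι | yes o = inj₂ (¬g , o , ι)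

      open Resources cls (adj G) public

      Extends : Resource → List (Fin n) → Set
      Extends r Us = ∃ λ C → IsCopyOfD G C × ∀ j → (C j ∈ᵣ r) ⊎ (OnL (C j) × C j ∉ Us)

      -- Fewer than `h` block vertices dominate `v` and fewer than `h` are dominated by `u`. As
      -- `3h ≤ w`, more than `h` of them lie between `v` and `u`, and any two of these can be the
      -- doubled vertex of a triangle on the edge `uv`.
      extend-pair : ∀ {u v} → cls u ≡ plus → cls v ≡ minus → Edge G u v → ∀ Us → suc (length Us) < h →
                    ∃ λ C → IsCopyOfD G C × ∀ j → (C j ≡ u ⊎ C j ≡ v) ⊎ (OnL (C j) × C j ∉ Us)
      extend-pair {u} {v} eu ev uv Us lt =
        let a , b , a≢b , pa , pb , a∉ , b∉ = pick₂ i₀ Us p (<-≤-trans lt (<⇒≤ h<card))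
            va , au = ∧-true pa
            vb , bu = ∧-true pb
            C , isC , inC = copy-from G uv va vb au bu (a≢b ∘ L-injective i₀ a b)
        in C , isC , λ j → locate a∉ b∉ (inC j)
        where
        p : Fin w → Bool
        p a = adj G v (L i₀ a) ∧ adj G (L i₀ a) u
        ∧-true : ∀ {x y} → x ∧ y ≡ true → x ≡ true × y ≡ true
        ∧-true {true} {true} _ = refl , refl
        pt : ∀ a → 1 ≤ 𝟙 (p a) + 𝟙 (adj G (L i₀ a) v) + 𝟙 (adj G u (L i₀ a))
        pt a with total G v (L i₀ a) (λ e → proj₁ (cls-minus v ev) (i₀ , a , sym e))
                | total G (L i₀ a) u (λ e → proj₁ (cls-plus u eu) (i₀ , a , e))
        ... | inj₁ x | inj₁ y rewrite x | y = s≤s z≤n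
        ... | inj₂ x | _ rewrite x = ≤-trans (m≤n+m 1 (𝟙 (adj G v (L i₀ a) ∧ adj G (L i₀ a) u))) (m≤m+n _ _)
        ... | inj₁ x | inj₂ y rewrite y = m≤n+m 1 _
        w≤ : w ≤ card p + inN v i₀ + outN u i₀
        w≤ = subst₂ _≤_ (trans (sum-const w 1) (*-identityʳ w))
               (∑-+₃ (λ a → 𝟙 (p a)) (λ a → 𝟙 (adj G (L i₀ a) v)) (λ a → 𝟙 (adj G u (L i₀ a)))) (sum-mono pt)
        h<card : h < card p
        h<card = ≰⇒> λ c≤h → <⇒≱ (+-mono-≤-< (+-mono-≤ c≤h (<⇒≤ (proj₂ (cls-minus v ev)))) (proj₂ (cls-plus u eu)))
          (≤-trans 3h≤w w≤)
        locate : ∀ {x a b} → L i₀ a ∉ Us → L i₀ b ∉ Us → x ≡ u ⊎ x ≡ v ⊎ x ≡ L i₀ a ⊎ x ≡ L i₀ b →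
                 (x ≡ u ⊎ x ≡ v) ⊎ (OnL x × x ∉ Us)
        locate a∉ b∉ (inj₁ e) = inj₁ (inj₁ e)
        locate a∉ b∉ (inj₂ (inj₁ e)) = inj₁ (inj₂ e)
        locate a∉ b∉ (inj₂ (inj₂ (inj₁ refl))) = inj₂ ((i₀ , _ , refl) , a∉)
        locate a∉ b∉ (inj₂ (inj₂ (inj₂ refl))) = inj₂ ((i₀ , _ , refl) , b∉)

      extend-single : ∀ {v} → Good v → ∀ Us → suc (length Us) < h →
                      ∃ λ C → IsCopyOfD G C × ∀ j → C j ≡ v ⊎ (OnL (C j) × C j ∉ Us)
      extend-single {v} (i , j , i<j , out , inn) Us lt =
        let a , a′ , a≢a′ , va , va′ , a∉ , a′∉ = pick₂ i Us (λ a → adj G v (L i a)) (<-≤-trans lt out)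
            b , bv , b∉ = pick j Us (λ b → adj G (L j b) v) (<-≤-trans (<-trans (n<1+n _) lt) inn)
            C , isC , inC = copy-from G bv va va′ (L-edge i j a b i<j) (L-edge i j a′ b i<j) (a≢a′ ∘ L-injective i a a′)
        in C , isC , λ k → locate a∉ a′∉ b∉ (inC k)
        where
        locate : ∀ {x a a′ b} → L i a ∉ Us → L i a′ ∉ Us → L j b ∉ Us →
                 x ≡ L j b ⊎ x ≡ v ⊎ x ≡ L i a ⊎ x ≡ L i a′ → (x ≡ v) ⊎ (OnL x × x ∉ Us)
        locate a∉ a′∉ b∉ (inj₁ refl) = inj₂ ((j , _ , refl) , b∉)
        locate a∉ a′∉ b∉ (inj₂ (inj₁ e)) = inj₁ e
        locate a∉ a′∉ b∉ (inj₂ (inj₂ (inj₁ refl))) = inj₂ ((i , _ , refl) , a∉)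
        locate a∉ a′∉ b∉ (inj₂ (inj₂ (inj₂ refl))) = inj₂ ((i , _ , refl) , a′∉)

      R-cases : ∀ u v → R u v ≡ true →
                (cls u ≡ plus × cls v ≡ minus × Edge G u v) ⊎ (cls v ≡ plus × cls u ≡ minus × Edge G v u)
      R-cases u v ruv = go (cls u) (cls v) refl refl ruv
        where
        go : ∀ c d → cls u ≡ c → cls v ≡ d → back c d (adj G u v) (adj G v u) ≡ true →
             (cls u ≡ plus × cls v ≡ minus × Edge G u v) ⊎ (cls v ≡ plus × cls u ≡ minus × Edge G v u)
        go plus minus eu ev r = inj₁ (eu , ev , r)
        go minus plus eu ev r = inj₂ (ev , eu , r)

      resource-offL : ∀ r {x} → x ∈ᵣ r → ¬ OnL x
      resource-offL (single v g) refl = proj₁ (cls-good v g)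
      resource-offL (pair u v ruv) x∈ = [ case-uv x∈ , case-vu x∈ ]′ (R-cases u v ruv)
        where
        case-uv : ∀ {x u v} → x ≡ u ⊎ x ≡ v → (cls u ≡ plus × cls v ≡ minus × Edge G u v) → ¬ OnL x
        case-uv (inj₁ refl) (eu , ev , _) = proj₁ (cls-plus _ eu)
        case-uv (inj₂ refl) (eu , ev , _) = proj₁ (cls-minus _ ev)
        case-vu : ∀ {x u v} → x ≡ u ⊎ x ≡ v → (cls v ≡ plus × cls u ≡ minus × Edge G v u) → ¬ OnL x
        case-vu (inj₁ refl) (ev , eu , _) = proj₁ (cls-minus _ eu)
        case-vu (inj₂ refl) (ev , eu , _) = proj₁ (cls-plus _ ev)

      extend : ∀ r Us → suc (length Us) < h → Extends r Us
      extend (pair u v ruv) Us lt = [ forward , backward ]′ (R-cases u v ruv)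
        where
        forward : cls u ≡ plus × cls v ≡ minus × Edge G u v → Extends (pair u v ruv) Us
        forward (eu , ev , uv) = extend-pair eu ev uv Us lt
        backward : cls v ≡ plus × cls u ≡ minus × Edge G v u → Extends (pair u v ruv) Us
        backward (ev , eu , vu) =
          let C , isC , inC = extend-pair ev eu vu Us lt
          in C , isC , λ j → [ (λ { (inj₁ e) → inj₁ (inj₂ e) ; (inj₂ e) → inj₁ (inj₁ e) }) , inj₂ ]′ (inC j)
      extend (single v gv) Us lt = extend-single (proj₂ (cls-good v gv)) Us lt

      open Tilings G using (Copy; Apart)

      vertices : List Copy → List (Fin n)
      vertices [] = []
      vertices (C ∷ Cs) = C zero ∷ C (suc zero) ∷ C (suc (suc zero)) ∷ C (suc (suc (suc zero))) ∷ vertices Cs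

      length-vertices : ∀ Cs → length (vertices Cs) ≡ length Cs * 4
      length-vertices [] = refl
      length-vertices (C ∷ Cs) = cong (4 +_) (length-vertices Cs)

      ∈-vertices : ∀ {C Cs} → C ∈ Cs → ∀ j → C j ∈ vertices Cs
      ∈-vertices (here refl) zero = here refl
      ∈-vertices (here refl) (suc zero) = there (here refl)
      ∈-vertices (here refl) (suc (suc zero)) = there (there (here refl))
      ∈-vertices (here refl) (suc (suc (suc zero))) = there (there (there (here refl)))
      ∈-vertices (there C∈) j = there (there (there (there (∈-vertices C∈ j))))

      -- Greedy choice: the tail is realised first and the head avoids its vertices, four per copy,
      -- whence `length Rs * 4`. Off the blocks, copies are apart because the resources are disjoint
      -- and never meet the blocks.
      realise : ∀ Rs → AllPairs DisjointR Rs → suc (length Rs * 4) < h →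
                ∃ λ Cs → length Cs ≡ length Rs × All (IsCopyOfD G) Cs × AllPairs Apart Cs ×
                  (∀ {C} → C ∈ Cs → ∀ j → OnL (C j) ⊎ ∃ λ r → r ∈ Rs × C j ∈ᵣ r)
      realise [] [] lt = [] , refl , [] , [] , λ ()
      realise (r ∷ Rs) (r# ∷ Rs#) lt =
        let Cs , len , cs , apart , loc = realise Rs Rs# (≤-<-trans (s≤s (m≤n+m _ 4)) lt)
            C , isC , inC = extend r (vertices Cs)
              (≤-<-trans (s≤s (≤-trans (≤-reflexive (trans (length-vertices Cs) (cong (_* 4) len))) (m≤n+m _ 4))) lt)
        in C ∷ Cs , cong suc len , isC ∷ cs ,
           All.tabulate (λ C′∈ → apart-C {Cs} {C} inC loc C′∈) ∷ apart , locate {Cs} {C} inC loc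
        where
        Located : List Copy → Set
        Located Cs = ∀ {C′} → C′ ∈ Cs → ∀ j → OnL (C′ j) ⊎ ∃ λ r′ → r′ ∈ Rs × C′ j ∈ᵣ r′
        Within : List Copy → Copy → Set
        Within Cs C = ∀ j → (C j ∈ᵣ r) ⊎ (OnL (C j) × C j ∉ vertices Cs)
        apart-C : ∀ {Cs C} → Within Cs C → Located Cs → ∀ {C′} → C′ ∈ Cs → Apart C C′
        apart-C {Cs} inC loc C′∈ j j′ e with inC j | loc C′∈ j′
        ... | inj₂ (_ , C∉) | _ = C∉ (subst (_∈ vertices Cs) (sym e) (∈-vertices C′∈ j′))
        ... | inj₁ Cj∈r | inj₁ l = resource-offL r Cj∈r (subst OnL (sym e) l)
        ... | inj₁ Cj∈r | inj₂ (r′ , r′∈ , ∈r′) = All.lookup r# r′∈ (subst (_∈ᵣ r) e Cj∈r) ∈r′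
        locate : ∀ {Cs C} → Within Cs C → Located Cs →
                 ∀ {C′} → C′ ∈ C ∷ Cs → ∀ j → OnL (C′ j) ⊎ ∃ λ r′ → r′ ∈ r ∷ Rs × C′ j ∈ᵣ r′
        locate inC loc (here refl) j = [ (λ Cj∈ → inj₂ (r , here refl , Cj∈)) , inj₁ ∘ proj₁ ]′ (inC j)
        locate inC loc (there C′∈) j = [ inj₁ , (λ (r′ , r′∈ , x∈) → inj₂ (r′ , there r′∈ , x∈)) ]′ (loc C′∈ j)

      module _ {k : ℕ} (T : DTiling G k) (L-untiled : ∀ i j → ¬ OnL (DTiling.φ T i j)) where
        open DTiling T using (φ)

        -- Only the tiles met by the resources have to be given up; the block vertices cost nothing,
        -- being uncovered.
        augment : (Q : List (Fin k)) (Rs : List Resource) → AllPairs DisjointR Rs →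
                  (∀ {r} → r ∈ Rs → ∀ i j → φ i j ∈ᵣ r → i ∈ Q) →
                  length Q < length Rs → suc (length Rs * 4) < h → DTiling G (suc k)
        augment Q Rs Rs# cells lt lt′ =
          let Cs , len , cs , apart , loc = realise Rs Rs# lt′
          in Tilings.exchange G T Q Cs cs apart
               (λ C∈ i i∉ j j′ e → away (loc C∈ j′) i∉ e) (subst (length Q <_) (sym len) lt)
          where
          away : ∀ {x i j} → (OnL x ⊎ ∃ λ r → r ∈ Rs × x ∈ᵣ r) → i ∉ Q → φ i j ≢ x
          away {i = i} {j} (inj₁ l) i∉ refl = L-untiled i j l
          away {i = i} {j} (inj₂ (r , r∈ , x∈)) i∉ refl = i∉ (cells r∈ i j x∈)

  -- Rich and exposed vertices

  ⌊⌋-true : ∀ {A : Set} (a? : Dec A) → ⌊ a? ⌋ ≡ true → A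
  ⌊⌋-true (yes a) _ = a

  ⌊⌋-yes : ∀ {A : Set} (a? : Dec A) → A → ⌊ a? ⌋ ≡ true
  ⌊⌋-yes (yes _) _ = refl
  ⌊⌋-yes (no ¬a) a = ⊥-elim (¬a a)

  ⌊⌋-false : ∀ {A : Set} (a? : Dec A) → ⌊ a? ⌋ ≡ false → ¬ A
  ⌊⌋-false (no ¬a) _ = ¬a

  ⌊⌋-no : ∀ {A : Set} (a? : Dec A) → ¬ A → ⌊ a? ⌋ ≡ false
  ⌊⌋-no (yes a) ¬a = ⊥-elim (¬a a)
  ⌊⌋-no (no _) _ = refl

  ∧-true : ∀ {x y} → x ∧ y ≡ true → x ≡ true × y ≡ true
  ∧-true {true} {true} _ = refl , refl

  ∨-true : ∀ {x y} → x ∨ y ≡ true → x ≡ true ⊎ y ≡ true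
  ∨-true {true} _ = inj₁ refl
  ∨-true {false} e = inj₂ e

  𝟙-⌊⌋ : ∀ {A : Set} {m} (a? : Dec A) → (A → 1 ≤ m) → 𝟙 ⌊ a? ⌋ ≤ m
  𝟙-⌊⌋ (yes a) f = f a
  𝟙-⌊⌋ (no _) _ = z≤n

  isGood : Class → Bool
  isGood good = true
  isGood _ = false

  isGood⇒≡ : ∀ {c} → isGood c ≡ true → c ≡ good
  isGood⇒≡ {good} _ = refl

  isOther : Class → Bool
  isOther other = true
  isOther _ = false

  isPlus isMinus : Class → Bool
  isPlus plus = true
  isPlus _ = false
  isMinus minus = true
  isMinus _ = false

  data Sided : Class → Set where
    plus  : Sided plus
    minus : Sided minus

  sided? : ∀ c → Dec (Sided c)
  sided? plus = yes plus
  sided? minus = yes minus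
  sided? good = no λ ()
  sided? other = no λ ()

  -- `augmentation-free` is all that is kept of maximality. `d` is the threshold for "many", `M` the
  -- number of rounds, `B` the largest number of resources in one exchange. `4 + 2M` bounds the
  -- forbidden cells plus the rounds still to come; a cell has at most four vertices, so `d`
  -- candidates always leave an admissible one.
  module Closure {n k : ℕ} (φ : Fin k → Fin 4 → Fin n)
    (φ-injective : ∀ i i′ j j′ → φ i j ≡ φ i′ j′ → i ≡ i′ × j ≡ j′)
    (cls : Fin n → Class) (adj : Fin n → Fin n → Bool) (d M B : ℕ)
    (d-large : (4 + (M + M)) * 4 < d) (B-large : 4 + (M + M) ≤ B)
    (augmentation-free :
      (Q : List (Fin k)) (Rs : List (Resources.Resource cls adj)) →
      AllPairs (Resources.DisjointR cls adj) Rs →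
      (∀ {r} → r ∈ Rs → ∀ i j → Resources._∈ᵣ_ cls adj (φ i j) r → i ∈ Q) →
      length Q < length Rs → length Rs ≤ B → ⊥)
    where

    open Resources cls adj

    -- The cell of a vertex is its tile, or the vertex itself if it is in no tile.
    Cell : Set
    Cell = Fin k ⊎ Fin n

    Tiled : Fin n → Set
    Tiled v = ∃ λ i → ∃ λ j → φ i j ≡ v

    tiled? : ∀ v → Dec (Tiled v)
    tiled? v = Fin.any? λ i → Fin.any? λ j → φ i j Fin.≟ v

    abstract
      _≟ᶜ_ : (c c′ : Cell) → Dec (c ≡ c′)
      _≟ᶜ_ = Sum.≡-dec Fin._≟_ Fin._≟_

    open import Data.List.Membership.DecPropositional _≟ᶜ_ using (_∈?_)

    abstract
      cell : Fin n → Cell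
      cell v with tiled? v
      ... | yes (i , _) = inj₁ i
      ... | no _ = inj₂ v

      cell-φ : ∀ i j → cell (φ i j) ≡ inj₁ i
      cell-φ i j with tiled? (φ i j)
      ... | yes (i′ , j′ , e) = cong inj₁ (proj₁ (φ-injective i′ i j′ j e))
      ... | no ¬t = ⊥-elim (¬t (i , j , refl))

      cell-untiled : ∀ {v} → ¬ Tiled v → cell v ≡ inj₂ v
      cell-untiled {v} ¬t with tiled? v
      ... | yes t = ⊥-elim (¬t t)
      ... | no _ = refl

      cell-inj₁ : ∀ {v i} → cell v ≡ inj₁ i → ∃ λ j → φ i j ≡ v
      cell-inj₁ {v} e with tiled? v
      cell-inj₁ refl | yes (i , j , p) = j , p

      cell-inj₂ : ∀ {v u} → cell v ≡ inj₂ u → u ≡ v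
      cell-inj₂ {v} e with tiled? v
      cell-inj₂ refl | no _ = refl

    cell-size : ∀ c → card (λ y → ⌊ cell y ≟ᶜ c ⌋) ≤ 4
    cell-size (inj₁ i) = ≤-trans (sum-mono pt) (≤-reflexive (trans (sum-cong-≗ {x = fibre (φ i)} (λ v → sym (*-identityʳ (fibre (φ i) v)))) (sym (sum-fibre (φ i) (λ _ → 1)))))
      where
      pt : ∀ y → 𝟙 ⌊ cell y ≟ᶜ inj₁ i ⌋ ≤ fibre (φ i) y
      pt y = 𝟙-⌊⌋ (cell y ≟ᶜ inj₁ i) λ e →
        let j , p = cell-inj₁ e in subst (λ z → 1 ≤ fibre (φ i) z) p (fibre-image (φ i) j)
    cell-size (inj₂ u) = ≤-trans (≤-trans (sum-mono pt) (≤-reflexive (sum-single {f = λ y → 𝟙 (u == y)} u λ v v≢u → cong 𝟙 (==-≢ (v≢u ∘ sym))))) (≤-trans (𝟙≤1 _) (s≤s z≤n))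
      where
      pt : ∀ y → 𝟙 ⌊ cell y ≟ᶜ inj₂ u ⌋ ≤ 𝟙 (u == y)
      pt y = 𝟙-⌊⌋ (cell y ≟ᶜ inj₂ u) λ e →
        subst (λ z → 1 ≤ 𝟙 (u == z)) (cell-inj₂ e) (≤-reflexive (sym (cong 𝟙 (==-refl u))))

    cells-size : ∀ F → card (λ y → ⌊ cell y ∈? F ⌋) ≤ length F * 4
    cells-size [] = ≤-reflexive (sum-0 {f = λ y → 𝟙 ⌊ cell y ∈? [] ⌋} (λ _ → refl))
    cells-size (c ∷ F) = ≤-trans (sum-mono pt)
      (≤-trans (≤-reflexive (∑-distrib-+ (λ y → 𝟙 ⌊ cell y ≟ᶜ c ⌋) (λ y → 𝟙 ⌊ cell y ∈? F ⌋)))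
        (+-mono-≤ (cell-size c) (cells-size F)))
      where
      pt : ∀ y → 𝟙 ⌊ cell y ∈? (c ∷ F) ⌋ ≤ 𝟙 ⌊ cell y ≟ᶜ c ⌋ + 𝟙 ⌊ cell y ∈? F ⌋
      pt y = 𝟙-⌊⌋ (cell y ∈? (c ∷ F)) λ where
        (here e) → ≤-trans (≤-reflexive (sym (cong 𝟙 (⌊⌋-yes (cell y ≟ᶜ c) e)))) (m≤m+n _ _)
        (there m) → ≤-trans (≤-reflexive (sym (cong 𝟙 (⌊⌋-yes (cell y ∈? F) m)))) (m≤n+m _ _)

    tile-indices-size : ∀ F → card (λ i → ⌊ inj₁ i ∈? F ⌋) ≤ length F
    tile-indices-size [] = ≤-reflexive (sum-0 {f = λ i → 𝟙 ⌊ inj₁ i ∈? [] ⌋} (λ _ → refl))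
    tile-indices-size (c ∷ F) = ≤-trans (sum-mono pt)
      (≤-trans (≤-reflexive (∑-distrib-+ (λ i → 𝟙 ⌊ inj₁ i ≟ᶜ c ⌋) (λ i → 𝟙 ⌊ inj₁ i ∈? F ⌋)))
        (+-mono-≤ (one c) (tile-indices-size F)))
      where
      pt : ∀ i → 𝟙 ⌊ inj₁ i ∈? (c ∷ F) ⌋ ≤ 𝟙 ⌊ inj₁ i ≟ᶜ c ⌋ + 𝟙 ⌊ inj₁ i ∈? F ⌋
      pt i = 𝟙-⌊⌋ (inj₁ i ∈? (c ∷ F)) λ where
        (here e) → ≤-trans (≤-reflexive (sym (cong 𝟙 (⌊⌋-yes (inj₁ i ≟ᶜ c) e)))) (m≤m+n _ _)
        (there m) → ≤-trans (≤-reflexive (sym (cong 𝟙 (⌊⌋-yes (inj₁ i ∈? F) m)))) (m≤n+m _ _)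
      one : ∀ c → card (λ i → ⌊ inj₁ i ≟ᶜ c ⌋) ≤ 1
      one (inj₂ u) = ≤-trans (≤-reflexive (sum-0 {f = λ i → 𝟙 ⌊ inj₁ i ≟ᶜ inj₂ u ⌋} (λ i → cong 𝟙 (⌊⌋-no (inj₁ i ≟ᶜ inj₂ u) λ ())))) z≤n
      one (inj₁ i′) = ≤-trans (≤-reflexive (sum-single {f = λ i → 𝟙 ⌊ inj₁ i ≟ᶜ inj₁ i′ ⌋} i′
        λ i i≢ → cong 𝟙 (⌊⌋-no (inj₁ i ≟ᶜ inj₁ i′) (i≢ ∘ Sum.inj₁-injective)))) (𝟙≤1 _)

    -- Two tiles joined by two disjoint back edges lose nothing when traded for these two resources; this frees φ i j.
    TwoEdges : Fin k → Fin 4 → Fin k → Set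
    TwoEdges i j i′ = ∃ λ p → ∃ λ p′ → ∃ λ b → ∃ λ b′ →
      p ≢ p′ × b ≢ b′ × p ≢ j × p′ ≢ j × R (φ i p) (φ i′ b) ≡ true × R (φ i p′) (φ i′ b′) ≡ true

    abstract
      twoEdges? : ∀ i j i′ → Dec (TwoEdges i j i′)
      twoEdges? i j i′ = Fin.any? λ p → Fin.any? λ p′ → Fin.any? λ b → Fin.any? λ b′ →
        ¬? (p Fin.≟ p′) ×-dec ¬? (b Fin.≟ b′) ×-dec ¬? (p Fin.≟ j) ×-dec ¬? (p′ Fin.≟ j) ×-dec
        (R (φ i p) (φ i′ b) Bool.≟ true) ×-dec (R (φ i p′) (φ i′ b′) Bool.≟ true)

    -- With `d` partner tiles available, one of them avoids the few cells already in use.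
    Seed : Fin k → Fin 4 → Set
    Seed i j = d ≤ card (λ i′ → ⌊ twoEdges? i j i′ ⌋)

    -- Three ways to be free: the vertex lies in no tile, or a trade of two tiles frees it, or a
    -- rich mate pays for breaking up its tile.
    Released : (Fin n → Bool) → Fin n → Set
    Released ρ y = ¬ Tiled y ⊎ (∃ λ i → ∃ λ j → φ i j ≡ y × Seed i j)
      ⊎ (∃ λ i → ∃ λ j → ∃ λ j′ → φ i j ≡ y × j ≢ j′ × ρ (φ i j′) ≡ true)

    Exposed : (Fin n → Bool) → Fin n → Set
    Exposed ρ y = Sided (cls y) × Released ρ y

    abstract
      exposed? : ∀ ρ y → Dec (Exposed ρ y)
      exposed? ρ y = sided? (cls y) ×-dec (¬? (tiled? y)
        ⊎-dec (Fin.any? λ i → Fin.any? λ j → (φ i j Fin.≟ y) ×-dec (d ≤? card (λ i′ → ⌊ twoEdges? i j i′ ⌋)))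
        ⊎-dec (Fin.any? λ i → Fin.any? λ j → Fin.any? λ j′ → (φ i j Fin.≟ y) ×-dec ¬? (j Fin.≟ j′) ×-dec (ρ (φ i j′) Bool.≟ true)))

    exposedNbrs : (Fin n → Bool) → Fin n → ℕ
    exposedNbrs ρ v = card (λ y → R v y ∧ ⌊ exposed? ρ y ⌋)

    -- Each round measures exposure against the previous round only, so `reach` can unfold richness
    -- by induction on the rounds.
    rich : ℕ → Fin n → Bool
    rich zero v = isGood (cls v)
    rich (suc m) v = rich m v ∨ ⌊ d ≤? exposedNbrs (rich m) v ⌋

    good⇒rich : ∀ m {v} → cls v ≡ good → rich m v ≡ true
    good⇒rich zero e = cong isGood e
    good⇒rich (suc m) {v} e = cong (_∨ ⌊ d ≤? exposedNbrs (rich m) v ⌋) (good⇒rich m e)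

    tiles : List Cell → List (Fin k)
    tiles [] = []
    tiles (inj₁ i ∷ C) = i ∷ tiles C
    tiles (inj₂ _ ∷ C) = tiles C

    tiles-++ : ∀ C C′ → tiles (C ++ C′) ≡ tiles C ++ tiles C′
    tiles-++ [] C′ = refl
    tiles-++ (inj₁ i ∷ C) C′ = cong (i ∷_) (tiles-++ C C′)
    tiles-++ (inj₂ _ ∷ C) C′ = tiles-++ C C′

    ∈-tiles : ∀ {i C} → inj₁ i ∈ C → i ∈ tiles C
    ∈-tiles {C = inj₁ _ ∷ _} (here refl) = here refl
    ∈-tiles {C = inj₁ _ ∷ _} (there m) = there (∈-tiles m)
    ∈-tiles {C = inj₂ _ ∷ _} (there m) = ∈-tiles m

    length-tiles : ∀ C → length (tiles C) ≤ length C
    length-tiles [] = z≤n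
    length-tiles (inj₁ _ ∷ C) = s≤s (length-tiles C)
    length-tiles (inj₂ _ ∷ C) = m≤n⇒m≤1+n (length-tiles C)

    -- Replacing the tiles among C by copies of D built on Rs gains one copy, at the price of using v; nothing in F is touched.
    record Reach (v : Fin n) (F : List Cell) (b : ℕ) : Set where
      field
        C        : List Cell
        Rs       : List Resource
        disjoint : AllPairs DisjointR Rs
        excess   : length Rs ≡ suc (length (tiles C))
        avoids   : ∀ {c} → c ∈ C → c ∉ F
        located  : ∀ {r x} → r ∈ Rs → x ∈ᵣ r → x ≡ v ⊎ cell x ∈ C
        short    : length C ≤ b

    seed-partner : ∀ i j → Seed i j → ∀ F → length F < d → ∃ λ i′ → TwoEdges i j i′ × inj₁ i′ ∉ F
    seed-partner i j s F lt =
      let i′ , t , ∉F = card-<⇒∃ {p = λ i′ → ⌊ twoEdges? i j i′ ⌋} {q = λ i′ → ⌊ inj₁ i′ ∈? F ⌋}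
                          (≤-<-trans (tile-indices-size F) (<-≤-trans lt s))
      in i′ , ⌊⌋-true (twoEdges? i j i′) t , ⌊⌋-false (inj₁ i′ ∈? F) ∉F

    small : ∀ {F : List Cell} {m} → (length F + m) * 4 < d → length F * 4 < d
    small {F} {m} lt = ≤-<-trans (*-monoˡ-≤ 4 (m≤m+n (length F) m)) lt

    -- No tile is given up: the edge to an uncovered vertex is itself the surplus.
    step-untiled : ∀ {v y} → R v y ≡ true → ∀ {F} → cell y ∉ F → ¬ Tiled y → ∀ {b} → Reach v F (suc b)
    step-untiled {v} {y} vy {F} y∉F ¬t = record
      { C = inj₂ y ∷ []
      ; Rs = pair v y vy ∷ []
      ; disjoint = [] ∷ []
      ; excess = refl
      ; avoids = λ { (here refl) → subst (_∉ F) (cell-untiled ¬t) y∉F }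
      ; located = λ { (here refl) (inj₁ e) → inj₁ e ; (here refl) (inj₂ refl) → inj₂ (here (cell-untiled ¬t)) }
      ; short = s≤s z≤n
      }

    seed-pairs : ∀ {i j i′} → i ≢ i′ → TwoEdges i j i′ → ∃ λ r → ∃ λ r′ → DisjointR r r′ ×
      (∀ {x} → x ∈ᵣ r ⊎ x ∈ᵣ r′ → (cell x ≡ inj₁ i ⊎ cell x ≡ inj₁ i′) × x ≢ φ i j)
    seed-pairs {i} {j} {i′} i≢i′ (p , p′ , b , b′ , p≢p′ , b≢b′ , p≢j , p′≢j , pb , p′b′) =
      pair (φ i p) (φ i′ b) pb , pair (φ i p′) (φ i′ b′) p′b′ , dis , loc
      where
      dis : DisjointR (pair (φ i p) (φ i′ b) pb) (pair (φ i p′) (φ i′ b′) p′b′)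
      dis (inj₁ refl) (inj₁ e) = p≢p′ (proj₂ (φ-injective i i p p′ e))
      dis (inj₁ refl) (inj₂ e) = i≢i′ (proj₁ (φ-injective i i′ p b′ e))
      dis (inj₂ refl) (inj₁ e) = i≢i′ (sym (proj₁ (φ-injective i′ i b p′ e)))
      dis (inj₂ refl) (inj₂ e) = b≢b′ (proj₂ (φ-injective i′ i′ b b′ e))
      loc : ∀ {x} → (x ≡ φ i p ⊎ x ≡ φ i′ b) ⊎ (x ≡ φ i p′ ⊎ x ≡ φ i′ b′) →
            (cell x ≡ inj₁ i ⊎ cell x ≡ inj₁ i′) × x ≢ φ i j
      loc (inj₁ (inj₁ refl)) = inj₁ (cell-φ i p) , λ e → p≢j (proj₂ (φ-injective i i p j e))
      loc (inj₁ (inj₂ refl)) = inj₂ (cell-φ i′ b) , λ e → i≢i′ (sym (proj₁ (φ-injective i′ i b j e)))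
      loc (inj₂ (inj₁ refl)) = inj₁ (cell-φ i p′) , λ e → p′≢j (proj₂ (φ-injective i i p′ j e))
      loc (inj₂ (inj₂ refl)) = inj₂ (cell-φ i′ b′) , λ e → i≢i′ (sym (proj₁ (φ-injective i′ i b′ j e)))

    -- Tile `i` and its partner `i′` are exchanged for three resources: the two disjoint back edges
    -- between them and the edge from `v` to the freed vertex.
    step-seed : ∀ {v i j} → R v (φ i j) ≡ true → ∀ {F} → cell v ∈ F → cell (φ i j) ∉ F → Seed i j →
                suc (length F) < d → ∀ {b} → Reach v F (suc (suc b))
    step-seed {v} {i} {j} vy {F} v∈F y∉F s lt = build (seed-partner i j s (inj₁ i ∷ F) lt)
      where
      i∉F : inj₁ i ∉ F
      i∉F = subst (_∉ F) (cell-φ i j) y∉F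
      build : (∃ λ i′ → TwoEdges i j i′ × inj₁ i′ ∉ inj₁ i ∷ F) → ∀ {b} → Reach v F (suc (suc b))
      build (i′ , t , i′∉) = assemble (seed-pairs (λ e → i′∉ (here (cong inj₁ (sym e)))) t)
        where
        assemble : (∃ λ r → ∃ λ r′ → DisjointR r r′ ×
            (∀ {x} → x ∈ᵣ r ⊎ x ∈ᵣ r′ → (cell x ≡ inj₁ i ⊎ cell x ≡ inj₁ i′) × x ≢ φ i j)) →
          ∀ {b} → Reach v F (suc (suc b))
        assemble (r , r′ , r#r′ , loc) = record
          { C = inj₁ i ∷ inj₁ i′ ∷ []
          ; Rs = pair v (φ i j) vy ∷ r ∷ r′ ∷ []
          ; disjoint = ((λ {x} → first (inj₁ {B = x ∈ᵣ r′})) ∷ (λ {x} → first (inj₂ {A = x ∈ᵣ r})) ∷ []) ∷ (r#r′ ∷ []) ∷ [] ∷ []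
          ; excess = refl
          ; avoids = avoids′
          ; located = located
          ; short = s≤s (s≤s z≤n)
          }
          where
          avoids′ : ∀ {c} → c ∈ inj₁ i ∷ inj₁ i′ ∷ [] → c ∉ F
          avoids′ (here refl) = i∉F
          avoids′ (there (here refl)) = i′∉ ∘ there
          in-C : ∀ {x} → x ∈ᵣ r ⊎ x ∈ᵣ r′ → cell x ∈ inj₁ i ∷ inj₁ i′ ∷ []
          in-C x∈ = [ here , there ∘ here ]′ (proj₁ (loc x∈))
          first : ∀ {x} {A : Set} → (A → x ∈ᵣ r ⊎ x ∈ᵣ r′) → x ≡ v ⊎ x ≡ φ i j → A → ⊥
          first f (inj₁ refl) a = avoids′ (in-C (f a)) v∈F
          first f (inj₂ e) a = proj₂ (loc (f a)) e
          located : ∀ {s x} → s ∈ pair v (φ i j) vy ∷ r ∷ r′ ∷ [] → x ∈ᵣ s → x ≡ v ⊎ cell x ∈ inj₁ i ∷ inj₁ i′ ∷ []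
          located (here refl) (inj₁ e) = inj₁ e
          located (here refl) (inj₂ refl) = inj₂ (here (cell-φ i j))
          located (there (here refl)) x∈ = inj₂ (in-C (inj₁ x∈))
          located (there (there (here refl))) x∈ = inj₂ (in-C (inj₂ x∈))

    -- The surplus of the rich mate pays for tile `i`, so the edge from `v` to `φ i j` is pure gain.
    -- The tile is added to `F` to keep the mate's own exchange away from it.
    step-mate : ∀ {v i j j′} → R v (φ i j) ≡ true → ∀ {F} → cell v ∈ F → cell (φ i j) ∉ F → j ≢ j′ →
                ∀ {b} → Reach (φ i j′) (cell (φ i j) ∷ F) b → Reach v F (suc b)
    step-mate {v} {i} {j} {j′} vy {F} v∈F y∉F j≢j′ reached = record
      { C = inj₁ i ∷ C
      ; Rs = pair v (φ i j) vy ∷ Rs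
      ; disjoint = All.tabulate (λ r∈ → first r∈) ∷ disjoint
      ; excess = cong suc excess
      ; avoids = avoids′
      ; located = located′
      ; short = s≤s short
      }
      where
      open Reach reached
      cell≡ : cell (φ i j′) ≡ cell (φ i j)
      cell≡ = trans (cell-φ i j′) (sym (cell-φ i j))
      avoids′ : ∀ {c} → c ∈ inj₁ i ∷ C → c ∉ F
      avoids′ (here refl) = subst (_∉ F) (cell-φ i j) y∉F
      avoids′ (there c∈) = avoids c∈ ∘ there
      first : ∀ {r} → r ∈ Rs → ∀ {x} → x ≡ v ⊎ x ≡ φ i j → x ∈ᵣ r → ⊥
      first r∈ (inj₁ refl) x∈ = [ (λ { refl → y∉F (subst (_∈ F) cell≡ v∈F) }) , (λ c∈ → avoids c∈ (there v∈F)) ]′ (located r∈ x∈)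
      first r∈ (inj₂ refl) x∈ = [ (λ e → j≢j′ (proj₂ (φ-injective i i j j′ e))) , (λ c∈ → avoids c∈ (here refl)) ]′ (located r∈ x∈)
      located′ : ∀ {r x} → r ∈ pair v (φ i j) vy ∷ Rs → x ∈ᵣ r → x ≡ v ⊎ cell x ∈ inj₁ i ∷ C
      located′ (here refl) (inj₁ e) = inj₁ e
      located′ (here refl) (inj₂ refl) = inj₂ (here (cell-φ i j))
      located′ (there r∈) x∈ = inj₂ ([ (λ { refl → here (cell-φ i j′) }) , there ]′ (located r∈ x∈))

    weaken : ∀ {v F b} → Reach v F b → Reach v F (suc b)
    weaken r = record { Reach r hiding (short) ; short = m≤n⇒m≤1+n (Reach.short r) }

    -- Passing to a mate adds one cell to `F` and lowers the round by one, so `length F + m` never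
    -- grows and the forbidden vertices stay fewer than the `d` candidates. Requiring `cell v ∈ F`
    -- keeps the exchange off the tile of `v` itself.
    reach : ∀ m v → rich m v ≡ true → ∀ F → cell v ∈ F → (length F + m) * 4 < d → Reach v F (suc m)
    reach zero v g F v∈F lt = record
      { C = [] ; Rs = single v (isGood⇒≡ g) ∷ [] ; disjoint = [] ∷ [] ; excess = refl
      ; avoids = λ () ; located = λ { (here refl) e → inj₁ e } ; short = z≤n }
    reach (suc m) v ρ F v∈F lt = [ old , new ]′ (∨-true ρ)
      where
      lt′ : (length F + m) * 4 < d
      lt′ = ≤-<-trans (*-monoˡ-≤ 4 (+-monoʳ-≤ (length F) (n≤1+n m))) lt
      lt″ : (suc (length F) + m) * 4 < d
      lt″ = subst (λ x → x * 4 < d) (+-suc (length F) m) lt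
      lt‴ : suc (length F) < d
      lt‴ = ≤-<-trans (≤-trans (m≤m*n (suc (length F)) 4) (*-monoˡ-≤ 4 (m≤m+n (suc (length F)) m))) lt″
      old : rich m v ≡ true → Reach v F (suc (suc m))
      old ρ′ = weaken (reach m v ρ′ F v∈F lt′)
      via : ∀ {y} → R v y ≡ true → cell y ∉ F → Released (rich m) y → Reach v F (suc (suc m))
      via vy y∉ (inj₁ ¬t) = step-untiled vy y∉ ¬t
      via vy y∉ (inj₂ (inj₁ (i , j , refl , s))) = step-seed vy v∈F y∉ s lt‴
      via vy y∉ (inj₂ (inj₂ (i , j , j′ , refl , j≢j′ , ρ′))) =
        step-mate vy v∈F y∉ j≢j′ (reach m (φ i j′) ρ′ (cell (φ i j) ∷ F)
          (here (trans (cell-φ i j′) (sym (cell-φ i j)))) lt″)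
      new : ⌊ d ≤? exposedNbrs (rich m) v ⌋ ≡ true → Reach v F (suc (suc m))
      new h =
        let y , vy∧e , y∉ = card-<⇒∃ {p = λ y → R v y ∧ ⌊ exposed? (rich m) y ⌋} {q = λ y → ⌊ cell y ∈? F ⌋}
                              (≤-<-trans (cells-size F) (<-≤-trans (small {F} lt) (⌊⌋-true (d ≤? exposedNbrs (rich m) v) h)))
            vy , e = ∧-true vy∧e
        in via vy (⌊⌋-false (cell y ∈? F) y∉) (proj₂ (⌊⌋-true (exposed? (rich m) y) e))

    module _ {m : ℕ} (m≤M : m ≤ M) where

      private
        double : m + m ≤ M + M
        double = +-mono-≤ m≤M m≤M

        Rs-short : ∀ {v F} (r : Reach v F (suc m)) → length (Reach.Rs r) ≤ suc (suc m)
        Rs-short r = subst (_≤ suc (suc m)) (sym (Reach.excess r)) (s≤s (≤-trans (length-tiles (Reach.C r)) (Reach.short r)))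

        near : ∀ l → l ≤ 4 + m → (l + m) * 4 < d
        near l l≤ = ≤-<-trans (*-monoˡ-≤ 4 (≤-trans (+-monoˡ-≤ m l≤) (+-monoʳ-≤ 4 double))) d-large

        tile-of : ∀ {i j c} → cell (φ i j) ≡ inj₁ c → i ≡ c
        tile-of {i} {j} e = Sum.inj₁-injective (trans (sym (cell-φ i j)) e)

        tile-∈ : ∀ {i j C} → cell (φ i j) ∈ C → i ∈ tiles C
        tile-∈ {i} {j} {C} c∈ = ∈-tiles (subst (_∈ C) (cell-φ i j) c∈)

      -- If `v` is in no tile, using it costs nothing and the surplus of `Reach` enlarges the
      -- tiling.
      reach⇒tiled : ∀ {v F} → Reach v F (suc m) → Tiled v
      reach⇒tiled {v} r₀ = decide (tiled? v)
        where
        open Reach r₀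
        decide : Dec (Tiled v) → Tiled v
        decide (yes t) = t
        decide (no ¬t) = ⊥-elim (augmentation-free (tiles C) Rs disjoint
          (λ r∈ i j x∈ → [ (λ e → ⊥-elim (¬t (i , j , e))) , tile-∈ ]′ (located r∈ x∈))
          (≤-reflexive (sym excess))
          (≤-trans (Rs-short r₀)
            (≤-trans (≤-trans (+-mono-≤ {2} {4} (s≤s (s≤s z≤n)) (m≤m+n m m)) (+-monoʳ-≤ 4 double)) B-large)))

      rich⇒tiled : ∀ {v} → rich m v ≡ true → Tiled v
      rich⇒tiled {v} ρ = reach⇒tiled (reach m v ρ (cell v ∷ []) (here refl) (near 1 (s≤s z≤n)))

      -- Giving up tile `i` once serves both vertices: `1 + t₁ + t₂` tiles against
      -- `(1 + t₁) + (1 + t₂)` resources. Forbidding `C₁` to the second exchange keeps the two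
      -- disjoint.
      two-reaches : ∀ {i j j′} → j ≢ j′ → (r₁ : Reach (φ i j) (inj₁ i ∷ []) (suc m)) →
                    Reach (φ i j′) (inj₁ i ∷ Reach.C r₁) (suc m) → ⊥
      two-reaches {i} {j} {j′} j≢j′ r₁ r₂ = augmentation-free (i ∷ tiles (C₁ ++ C₂)) (Rs₁ ++ Rs₂)
        (AllPairs.++⁺ disjoint₁ disjoint₂ (All.tabulate λ r∈ → All.tabulate λ r′∈ → λ x∈ x∈′ → clash (located₁ r∈ x∈) (located₂ r′∈ x∈′)))
        (λ r∈ a b x∈ → [ (λ r∈₁ → covers₁ (located₁ r∈₁ x∈)) , (λ r∈₂ → covers₂ (located₂ r∈₂ x∈)) ]′ (∈-++⁻ Rs₁ r∈))
        (≤-reflexive size)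
        (≤-trans (≤-trans (≤-reflexive (length-++ Rs₁)) (+-mono-≤ (Rs-short r₁) (Rs-short r₂)))
          (≤-trans (≤-reflexive (cong (2 +_) (+-comm m (2 + m)))) (≤-trans (+-monoʳ-≤ 4 double) B-large)))
        where
        open Reach r₁ renaming (C to C₁; Rs to Rs₁; disjoint to disjoint₁; located to located₁; excess to excess₁; avoids to avoids₁)
        open Reach r₂ renaming (C to C₂; Rs to Rs₂; disjoint to disjoint₂; located to located₂; excess to excess₂; avoids to avoids₂)
        clash : ∀ {x} → x ≡ φ i j ⊎ cell x ∈ C₁ → x ≡ φ i j′ ⊎ cell x ∈ C₂ → ⊥
        clash (inj₁ refl) (inj₁ e) = j≢j′ (proj₂ (φ-injective i i j j′ e))
        clash (inj₁ refl) (inj₂ c∈) = avoids₂ c∈ (here (cell-φ i j))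
        clash (inj₂ c∈) (inj₁ refl) = avoids₁ c∈ (here (cell-φ i j′))
        clash (inj₂ c∈) (inj₂ c∈′) = avoids₂ c∈′ (there c∈)
        covers₁ : ∀ {a b} → φ a b ≡ φ i j ⊎ cell (φ a b) ∈ C₁ → a ∈ i ∷ tiles (C₁ ++ C₂)
        covers₁ {a} {b} (inj₁ e) = here (proj₁ (φ-injective a i b j e))
        covers₁ (inj₂ c∈) = there (tile-∈ (∈-++⁺ˡ c∈))
        covers₂ : ∀ {a b} → φ a b ≡ φ i j′ ⊎ cell (φ a b) ∈ C₂ → a ∈ i ∷ tiles (C₁ ++ C₂)
        covers₂ {a} {b} (inj₁ e) = here (proj₁ (φ-injective a i b j′ e))
        covers₂ (inj₂ c∈) = there (tile-∈ (∈-++⁺ʳ C₁ c∈))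
        size : suc (suc (length (tiles (C₁ ++ C₂)))) ≡ length (Rs₁ ++ Rs₂)
        size = trans (cong (2 +_) (trans (cong length (tiles-++ C₁ C₂)) (length-++ (tiles C₁))))
          (sym (trans (length-++ Rs₁) (trans (cong₂ _+_ excess₁ excess₂) (cong suc (+-suc _ _)))))

      rich-unique : ∀ {i j j′} → rich m (φ i j) ≡ true → rich m (φ i j′) ≡ true → j ≢ j′ → ⊥
      rich-unique {i} {j} {j′} ρ ρ′ j≢j′ = two-reaches j≢j′ r₁
        (reach m (φ i j′) ρ′ (inj₁ i ∷ Reach.C r₁) (here (cell-φ i j′)) (near (suc (length (Reach.C r₁))) (s≤s (≤-trans (Reach.short r₁) (m≤n+m (suc m) 2)))))
        where
        r₁ : Reach (φ i j) (inj₁ i ∷ []) (suc m)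
        r₁ = reach m (φ i j) ρ (inj₁ i ∷ []) (here (cell-φ i j)) (near 1 (s≤s z≤n))

      -- The seed trades tile `i` and a partner for two resources that spare `φ i j`, which remains
      -- available for its own exchange: `2 + t` tiles against `3 + t` resources.
      reach-and-seed : ∀ {i j} → Reach (φ i j) (inj₁ i ∷ []) (suc m) → Seed i j → ⊥
      reach-and-seed {i} {j} r₀ s = finish (seed-partner i j s (inj₁ i ∷ C)
          (≤-<-trans (≤-trans (s≤s short) (≤-trans (n≤1+n _) (m≤m*n (3 + m) 4))) (near 3 (s≤s (s≤s (s≤s z≤n))))))
        where
        open Reach r₀
        finish : (∃ λ i′ → TwoEdges i j i′ × inj₁ i′ ∉ inj₁ i ∷ C) → ⊥
        finish (i′ , t , i′∉) = assemble (seed-pairs (λ e → i′∉ (here (cong inj₁ (sym e)))) t)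
          where
          assemble : (∃ λ r → ∃ λ r′ → DisjointR r r′ ×
            (∀ {x} → x ∈ᵣ r ⊎ x ∈ᵣ r′ → (cell x ≡ inj₁ i ⊎ cell x ≡ inj₁ i′) × x ≢ φ i j)) → ⊥
          assemble (r , r′ , r#r′ , loc) = augmentation-free (i ∷ i′ ∷ tiles C) (r ∷ r′ ∷ Rs)
            ((r#r′ ∷ All.tabulate (λ s∈ x∈ x∈′ → clash (loc (inj₁ x∈)) (located s∈ x∈′))) ∷
             All.tabulate (λ s∈ x∈ x∈′ → clash (loc (inj₂ x∈)) (located s∈ x∈′)) ∷ disjoint)
            covers
            (≤-reflexive (cong (2 +_) (sym excess)))
            (≤-trans (+-monoʳ-≤ 2 (Rs-short r₀)) (≤-trans (+-monoʳ-≤ 4 (≤-trans (m≤m+n m m) double)) B-large))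
            where
            clash : ∀ {x} → (cell x ≡ inj₁ i ⊎ cell x ≡ inj₁ i′) × x ≢ φ i j → x ≡ φ i j ⊎ cell x ∈ C → ⊥
            clash (_ , x≢) (inj₁ e) = x≢ e
            clash (inj₁ e , _) (inj₂ c∈) = avoids c∈ (here e)
            clash (inj₂ e , _) (inj₂ c∈) = i′∉ (there (subst (_∈ C) e c∈))
            covers-pair : ∀ {a b} → cell (φ a b) ≡ inj₁ i ⊎ cell (φ a b) ≡ inj₁ i′ → a ∈ i ∷ i′ ∷ tiles C
            covers-pair (inj₁ e) = here (tile-of e)
            covers-pair (inj₂ e) = there (here (tile-of e))
            covers : ∀ {s} → s ∈ r ∷ r′ ∷ Rs → ∀ a b → φ a b ∈ᵣ s → a ∈ i ∷ i′ ∷ tiles C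
            covers (here refl) a b x∈ = covers-pair (proj₁ (loc (inj₁ x∈)))
            covers (there (here refl)) a b x∈ = covers-pair (proj₁ (loc (inj₂ x∈)))
            covers (there (there s∈)) a b x∈ =
              [ (λ e → here (proj₁ (φ-injective a i b j e))) , (λ c∈ → there (there (tile-∈ c∈))) ]′ (located s∈ x∈)

      rich-not-seed : ∀ {i j} → rich m (φ i j) ≡ true → Seed i j → ⊥
      rich-not-seed {i} {j} ρ =
        reach-and-seed (reach m (φ i j) ρ (inj₁ i ∷ []) (here (cell-φ i j)) (near 1 (s≤s z≤n)))

      rich-not-exposed : ∀ {v} → rich m v ≡ true → ¬ Exposed (rich m) v
      rich-not-exposed ρ (_ , inj₁ ¬t) = ¬t (rich⇒tiled ρ)
      rich-not-exposed ρ (_ , inj₂ (inj₁ (i , j , refl , s))) = rich-not-seed ρ s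
      rich-not-exposed ρ (_ , inj₂ (inj₂ (i , j , j′ , refl , j≢j′ , ρ′))) = rich-unique ρ ρ′ j≢j′

      -- A rich vertex releases its three mates. None of them is good, since good vertices are rich
      -- and a tile has only one rich vertex; so each is exposed or of class `other`.
      3rich≤exposed : 3 * card (rich m) ≤ card (λ y → ⌊ exposed? (rich m) y ⌋) + card (λ y → isOther (cls y))
      3rich≤exposed = begin
        3 * card (rich m)
          ≤⟨ *-monoʳ-≤ 3 (DoubleFamily.sum≤sum₂ φ (λ v → 𝟙 (rich m v)) covered) ⟩
        3 * sum (λ i → sum (λ j → 𝟙 (rich m (φ i j))))
          ≡⟨ *-distribˡ-sum 3 (λ i → sum (λ j → 𝟙 (rich m (φ i j)))) ⟩
        sum (λ i → 3 * sum (λ j → 𝟙 (rich m (φ i j))))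
          ≤⟨ sum-mono per-tile ⟩
        sum (λ i → sum (λ j → weight (φ i j)))
          ≤⟨ DoubleFamily.sum₂-≤ φ φ-injective weight ⟩
        sum weight
          ≡⟨ ∑-distrib-+ (λ y → 𝟙 ⌊ exposed? (rich m) y ⌋) (λ y → 𝟙 (isOther (cls y))) ⟩
        card (λ y → ⌊ exposed? (rich m) y ⌋) + card (λ y → isOther (cls y)) ∎
        where
        open ≤-Reasoning
        weight : Fin n → ℕ
        weight y = 𝟙 ⌊ exposed? (rich m) y ⌋ + 𝟙 (isOther (cls y))
        covered : ∀ v → 𝟙 (rich m v) ≢ 0 → ∃ λ i → ∃ λ j → φ i j ≡ v
        covered v h = rich⇒tiled (positive (rich m v) h)
          where
          positive : ∀ b → 𝟙 b ≢ 0 → b ≡ true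
          positive true _ = refl
          positive false h = ⊥-elim (h refl)
        mate-weight : ∀ i j j′ → rich m (φ i j′) ≡ true → j ≢ j′ → 1 ≤ weight (φ i j)
        mate-weight i j j′ ρ′ j≢j′ = by-class (cls (φ i j)) refl
          where
          exposed : Sided (cls (φ i j)) → 1 ≤ weight (φ i j)
          exposed s = ≤-trans (≤-reflexive (sym (cong 𝟙 (⌊⌋-yes (exposed? (rich m) (φ i j))
            (s , inj₂ (inj₂ (i , j , j′ , refl , j≢j′ , ρ′))))))) (m≤m+n _ _)
          by-class : ∀ c → cls (φ i j) ≡ c → 1 ≤ weight (φ i j)
          by-class plus e = exposed (subst Sided (sym e) plus)
          by-class minus e = exposed (subst Sided (sym e) minus)
          by-class good e = ⊥-elim (rich-unique (good⇒rich m e) ρ′ j≢j′)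
          by-class other e = ≤-trans (≤-reflexive (sym (cong (𝟙 ∘ isOther) e))) (m≤n+m _ _)
        per-tile : ∀ i → 3 * sum (λ j → 𝟙 (rich m (φ i j))) ≤ sum (λ j → weight (φ i j))
        per-tile i = decide (Fin.any? λ j → rich m (φ i j) Bool.≟ true)
          where
          decide : Dec (∃ λ j → rich m (φ i j) ≡ true) → 3 * sum (λ j → 𝟙 (rich m (φ i j))) ≤ sum (λ j → weight (φ i j))
          decide (no ¬ρ) = ≤-trans (≤-reflexive (trans (cong (3 *_) (sum-0 {f = λ j → 𝟙 (rich m (φ i j))}
            λ j → cong 𝟙 (Bool.¬-not (λ ρ → ¬ρ (j , ρ))))) (*-zeroʳ 3))) z≤n
          decide (yes (j₀ , ρ₀)) = ≤-trans (*-monoʳ-≤ 3 (≤-trans (≤-reflexive (sum-single {f = λ j → 𝟙 (rich m (φ i j))} j₀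
            λ j j≢ → cong 𝟙 (Bool.¬-not (λ ρ → rich-unique ρ ρ₀ j≢)))) (𝟙≤1 _)))
            -- Adding 1 for `j₀` itself makes the bound uniform over the four indices:
            -- `4 ≤ weights + 1`.
            (+-cancelʳ-≤ 1 3 _ (≤-trans (sum-mono {f = λ _ → 1} pt) (≤-reflexive (trans
              (∑-distrib-+ (λ j → weight (φ i j)) (λ j → 𝟙 (j == j₀)))
              (cong (sum (λ j → weight (φ i j)) +_) (trans (sum-single {f = λ j → 𝟙 (j == j₀)} j₀ λ j j≢ → cong 𝟙 (==-≢ j≢)) (cong 𝟙 (==-refl j₀))))))))
            where
            pt : ∀ j → 1 ≤ weight (φ i j) + 𝟙 (j == j₀)
            pt j = case (j Fin.≟ j₀)
              where
              case : Dec (j ≡ j₀) → 1 ≤ weight (φ i j) + 𝟙 (j == j₀)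
              case (yes refl) = ≤-trans (≤-reflexive (sym (cong 𝟙 (==-refl j)))) (m≤n+m _ _)
              case (no j≢) = ≤-trans (mate-weight i j j₀ ρ₀ j≢) (m≤m+n _ _)

  -- Counting degrees

  sum-product : ∀ {m n} (f : Fin m → ℕ) (g : Fin n → ℕ) → sum (λ v → sum (λ u → f v * g u)) ≡ sum f * sum g
  sum-product f g = trans (sum-cong-≗ (λ v → sym (*-distribˡ-sum (f v) g))) (sym (*-distribʳ-sum (sum g) f))

  sum₂-+ : ∀ {m n} (f g : Fin m → Fin n → ℕ) →
           sum (λ v → sum (λ u → f v u + g v u)) ≡ sum (λ v → sum (f v)) + sum (λ v → sum (g v))
  sum₂-+ f g = trans (sum-cong-≗ (λ v → ∑-distrib-+ (f v) (g v))) (∑-distrib-+ (λ v → sum (f v)) (λ v → sum (g v)))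

  sum₂-mono : ∀ {m n} {f g : Fin m → Fin n → ℕ} → (∀ v u → f v u ≤ g v u) →
              sum (λ v → sum (f v)) ≤ sum (λ v → sum (g v))
  sum₂-mono h = sum-mono (λ v → sum-mono (h v))

  -- `A` is abstract so that one count serves the minus side with the given edges and the plus side
  -- with all edges reversed.
  module DegreeCount {n : ℕ} (A : Fin n → Fin n → Bool) (A-antisym : ∀ u v → 𝟙 (A u v) + 𝟙 (A v u) ≤ 1)
    (g : ℕ) (degree : ∀ v → n ≤ 2 * sum (λ u → 𝟙 (A u v)) + 2 * g) where

    inner : (Fin n → Bool) → ℕ
    inner E = sum (λ v → sum (λ u → 𝟙 (E v) * 𝟙 (E u) * 𝟙 (A u v)))

    2inner≤ : ∀ E → 2 * inner E ≤ card E * card E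
    2inner≤ E = begin
      2 * inner E
        ≡⟨ cong (inner E +_) (+-identityʳ _) ⟩
      inner E + inner E
        ≡⟨ cong (inner E +_) (∑-comm (λ v u → 𝟙 (E v) * 𝟙 (E u) * 𝟙 (A u v))) ⟩
      inner E + sum (λ v → sum (λ u → 𝟙 (E u) * 𝟙 (E v) * 𝟙 (A v u)))
        ≡⟨ sum₂-+ (λ v u → 𝟙 (E v) * 𝟙 (E u) * 𝟙 (A u v)) (λ v u → 𝟙 (E u) * 𝟙 (E v) * 𝟙 (A v u)) ⟨
      sum (λ v → sum (λ u → 𝟙 (E v) * 𝟙 (E u) * 𝟙 (A u v) + 𝟙 (E u) * 𝟙 (E v) * 𝟙 (A v u)))
        ≤⟨ sum₂-mono (λ v u → pt (𝟙 (E v)) (𝟙 (E u)) (A-antisym u v)) ⟩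
      sum (λ v → sum (λ u → 𝟙 (E v) * 𝟙 (E u)))
        ≡⟨ sum-product (𝟙 ∘ E) (𝟙 ∘ E) ⟩
      card E * card E ∎
      where
      open ≤-Reasoning
      rearrange : ∀ x y a b → x * y * a + y * x * b ≡ x * y * (a + b)
      rearrange = solve-∀
      pt : ∀ x y {a b} → a + b ≤ 1 → x * y * a + y * x * b ≤ x * y
      pt x y {a} {b} h = ≤-trans (≤-reflexive (rearrange x y a b))
        (≤-trans (*-monoʳ-≤ (x * y) h) (≤-reflexive (*-identityʳ _)))

    -- Counts edges into `E`. Sources inside `E` give at most half of `|E|²`, sources weighted by
    -- `κ` are charged in full to every vertex of `E`, and `T` records the remaining edges one by
    -- one.
    degree-bound : (E : Fin n → Bool) (κ : Fin n → ℕ) (T : Fin n → Fin n → ℕ) →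
      (∀ v u → 𝟙 (E v) * 𝟙 (A u v) ≤ 𝟙 (E v) * 𝟙 (E u) * 𝟙 (A u v) + 𝟙 (E v) * κ u + T u v) →
      card E * n ≤ card E * card E + 2 * (card E * sum κ + sum (λ u → sum (T u))) + 2 * g * card E
    degree-bound E κ T pt = begin
      card E * n
        ≡⟨ *-distribʳ-sum n (𝟙 ∘ E) ⟩
      sum (λ v → 𝟙 (E v) * n)
        ≤⟨ sum-mono (λ v → *-monoʳ-≤ (𝟙 (E v)) (degree v)) ⟩
      sum (λ v → 𝟙 (E v) * (2 * sum (λ u → 𝟙 (A u v)) + 2 * g))
        ≡⟨ sum-cong-≗ (λ v → trans (rearrange (𝟙 (E v)) (sum (λ u → 𝟙 (A u v))) (2 * g)) (cong (λ z → 2 * z + 2 * g * 𝟙 (E v)) (*-distribˡ-sum (𝟙 (E v)) (λ u → 𝟙 (A u v))))) ⟩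
      sum (λ v → 2 * edges v + 2 * g * 𝟙 (E v))
        ≡⟨ ∑-distrib-+ (λ v → 2 * edges v) (λ v → 2 * g * 𝟙 (E v)) ⟩
      sum (λ v → 2 * edges v) + sum (λ v → 2 * g * 𝟙 (E v))
        ≡⟨ cong₂ _+_ (*-distribˡ-sum 2 edges) (*-distribˡ-sum (2 * g) (𝟙 ∘ E)) ⟨
      2 * sum edges + 2 * g * card E
        ≤⟨ +-monoˡ-≤ (2 * g * card E) (*-monoʳ-≤ 2 (sum₂-mono pt)) ⟩
      2 * sum (λ v → sum (λ u → 𝟙 (E v) * 𝟙 (E u) * 𝟙 (A u v) + 𝟙 (E v) * κ u + T u v)) + 2 * g * card E
        ≡⟨ cong (λ z → 2 * z + 2 * g * card E) (trans
             (sum₂-+ (λ v u → 𝟙 (E v) * 𝟙 (E u) * 𝟙 (A u v) + 𝟙 (E v) * κ u) (λ v u → T u v))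
             (cong₂ _+_ (trans (sum₂-+ (λ v u → 𝟙 (E v) * 𝟙 (E u) * 𝟙 (A u v)) (λ v u → 𝟙 (E v) * κ u))
               (cong (inner E +_) (sum-product (𝟙 ∘ E) κ))) (∑-comm (λ v u → T u v)))) ⟩
      2 * (inner E + card E * sum κ + sum (λ u → sum (T u))) + 2 * g * card E
        ≡⟨ regroup (inner E) (card E * sum κ) (sum (λ u → sum (T u))) (2 * g * card E) ⟩
      2 * inner E + 2 * (card E * sum κ + sum (λ u → sum (T u))) + 2 * g * card E
        ≤⟨ +-monoˡ-≤ (2 * g * card E) (+-monoˡ-≤ _ (2inner≤ E)) ⟩
      card E * card E + 2 * (card E * sum κ + sum (λ u → sum (T u))) + 2 * g * card E ∎
      where
      open ≤-Reasoning
      edges : Fin n → ℕ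
      edges v = sum (λ u → 𝟙 (E v) * 𝟙 (A u v))
      rearrange : ∀ x y z → x * (2 * y + z) ≡ 2 * (x * y) + z * x
      rearrange = solve-∀
      regroup : ∀ a b c e → 2 * (a + b + c) + e ≡ 2 * a + 2 * (b + c) + e
      regroup = solve-∀

    -- Here m is one side, p the other, o the unclassified vertices, ρ and ρ′ the rich vertices before and after one more
    -- round, and ε the exposed ones.  Edges into the exposed part E of m start in E, in the rest of m, in ρ, ρ′ or o, or in
    -- p, where vertices outside ρ′ send few edges to E.  If E is tiny, the bound side-large is used instead.
    module OneSide (m p o ρ ρ′ ε : Fin n → Bool) (a₀ d : ℕ)
      (classified : ∀ v → 1 ≤ 𝟙 (m v) + 𝟙 (p v) + 𝟙 (o v) + 𝟙 (ρ v))
      (few : ∀ u → ρ′ u ≡ false → p u ≡ true → card (λ v → m v ∧ A u v ∧ ε v) ≤ d)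
      (good-or-side : card m + a₀ ≤ card (λ v → m v ∧ ε v) + card (λ v → m v ∧ not (ε v) ∧ not (ρ v)) + card ρ)
      (1≤g : 1 ≤ g) (d≤g : d ≤ g) (nd≤gg : n * d ≤ g * g) (o≤2g : card o ≤ 2 * g)
      (new≤d : card (λ v → ρ′ v ∧ not (ρ v)) ≤ d)
      (side-large : n ≤ 2 * (card m + a₀) + 8 * g)
      where

      private
        E U N : Fin n → Bool
        E v = m v ∧ ε v
        U v = m v ∧ not (ε v) ∧ not (ρ v)
        N v = ρ′ v ∧ not (ρ v)
        e = card E
        u = card U
        a = card ρ
        κ : Fin n → ℕ
        κ v = 𝟙 (U v) + 𝟙 (ρ v) + (𝟙 (N v) + 𝟙 (o v))
        T : Fin n → Fin n → ℕ
        T x v = 𝟙 (not (ρ′ x) ∧ p x) * 𝟙 (m v ∧ A x v ∧ ε v)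

        Σκ : sum κ ≤ u + a + 3 * g
        Σκ = ≤-trans (≤-reflexive (trans (∑-distrib-+ (λ v → 𝟙 (U v) + 𝟙 (ρ v)) (λ v → 𝟙 (N v) + 𝟙 (o v)))
            (cong₂ _+_ (∑-distrib-+ (𝟙 ∘ U) (𝟙 ∘ ρ)) (∑-distrib-+ (𝟙 ∘ N) (𝟙 ∘ o)))))
          (+-monoʳ-≤ (u + a) (+-mono-≤ (≤-trans new≤d d≤g) o≤2g))

        ΣT : sum (λ x → sum (T x)) ≤ n * d
        ΣT = sum-bound d row
          where
          row : ∀ x → sum (T x) ≤ d
          row x = ≤-trans (≤-reflexive (sym (*-distribˡ-sum (𝟙 (not (ρ′ x) ∧ p x)) (λ v → 𝟙 (m v ∧ A x v ∧ ε v)))))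
                    (go (ρ′ x) (p x) refl refl)
            where
            go : ∀ r q → ρ′ x ≡ r → p x ≡ q → 𝟙 (not r ∧ q) * card (λ v → m v ∧ A x v ∧ ε v) ≤ d
            go false true er eq = ≤-trans (≤-reflexive (+-identityʳ _)) (few x er eq)
            go true _ _ _ = z≤n
            go false false _ _ = z≤n

        pt : ∀ v x → 𝟙 (E v) * 𝟙 (A x v) ≤ 𝟙 (E v) * 𝟙 (E x) * 𝟙 (A x v) + 𝟙 (E v) * κ x + T x v
        pt v x = go (m v) (ε v) (A x v) (m x) (ε x) (p x) (o x) (ρ x) (ρ′ x) (classified x)
          where
          go : ∀ mv εv t mx εx px ox ρx ρ′x → 1 ≤ 𝟙 mx + 𝟙 px + 𝟙 ox + 𝟙 ρx →
               𝟙 (mv ∧ εv) * 𝟙 t ≤ 𝟙 (mv ∧ εv) * 𝟙 (mx ∧ εx) * 𝟙 t +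
                 𝟙 (mv ∧ εv) * (𝟙 (mx ∧ not εx ∧ not ρx) + 𝟙 ρx + (𝟙 (ρ′x ∧ not ρx) + 𝟙 ox)) +
                 𝟙 (not ρ′x ∧ px) * 𝟙 (mv ∧ t ∧ εv)
          go false _ _ _ _ _ _ _ _ _ = z≤n
          go true false _ _ _ _ _ _ _ _ = z≤n
          go true true false _ _ _ _ _ _ _ = z≤n
          go true true true true true _ _ _ _ _ = s≤s z≤n
          go true true true true false _ _ false _ _ = s≤s z≤n
          go true true true true false _ _ true _ _ = s≤s z≤n
          go true true true false _ _ _ true _ _ = s≤s z≤n
          go true true true false _ _ _ false true _ = s≤s z≤n
          go true true true false _ _ true false false _ = s≤s z≤n
          go true true true false _ true false false false _ = s≤s z≤n
          go true true true false _ false false false false ()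

        large : g ≤ e → n ≤ e + 2 * u + 2 * a + 10 * g
        -- The stray edges number at most `n * d ≤ g * g ≤ e * g`, so the whole inequality can be
        -- divided by `e`.
        large g≤e = *-cancelˡ-≤ e ⦃ >-nonZero (≤-trans 1≤g g≤e) ⦄ (begin
          e * n
            ≤⟨ degree-bound E κ T pt ⟩
          e * e + 2 * (e * sum κ + sum (λ x → sum (T x))) + 2 * g * e
            ≤⟨ +-monoˡ-≤ (2 * g * e) (+-monoʳ-≤ (e * e) (*-monoʳ-≤ 2 (+-mono-≤ (*-monoʳ-≤ e Σκ)
                 (≤-trans ΣT (≤-trans nd≤gg (*-monoˡ-≤ g g≤e)))))) ⟩
          e * e + 2 * (e * (u + a + 3 * g) + e * g) + 2 * g * e
            ≡⟨ regroup e u a g ⟩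
          e * (e + 2 * u + 2 * a + 10 * g) ∎)
          where
          open ≤-Reasoning
          regroup : ∀ e u a g → e * e + 2 * (e * (u + a + 3 * g) + e * g) + 2 * g * e ≡ e * (e + 2 * u + 2 * a + 10 * g)
          regroup = solve-∀

        small : e ≤ g → n ≤ e + 2 * u + 2 * a + 10 * g
        -- Here the bound comes from the block degrees; it contains `2e` instead of `e`, and the
        -- extra `e ≤ g` fits into the gap between 8 and 10.
        small e≤g = begin
          n
            ≤⟨ side-large ⟩
          2 * (card m + a₀) + 8 * g
            ≤⟨ +-monoˡ-≤ (8 * g) (*-monoʳ-≤ 2 good-or-side) ⟩
          2 * (e + u + a) + 8 * g
            ≡⟨ regroup e u a g ⟩
          e + 2 * u + 2 * a + 8 * g + e
            ≤⟨ +-monoʳ-≤ (e + 2 * u + 2 * a + 8 * g) (≤-trans e≤g (m≤m+n g g)) ⟩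
          e + 2 * u + 2 * a + 8 * g + (g + g)
            ≡⟨ regroup′ e u a g ⟩
          e + 2 * u + 2 * a + 10 * g ∎
          where
          open ≤-Reasoning
          regroup : ∀ e u a g → 2 * (e + u + a) + 8 * g ≡ e + 2 * u + 2 * a + 8 * g + e
          regroup = solve-∀
          regroup′ : ∀ e u a g → e + 2 * u + 2 * a + 8 * g + (g + g) ≡ e + 2 * u + 2 * a + 10 * g
          regroup′ = solve-∀

      side-bound : n ≤ e + 2 * u + 2 * a + 10 * g
      side-bound = [ large , small ]′ (≤-total g e)

  -- Here e, u, a, o count exposed, remaining, rich and unclassified vertices.
  two-sides : ∀ {n e₁ e₂ u₁ u₂ a o g} → n ≤ e₁ + 2 * u₁ + 2 * a + 10 * g → n ≤ e₂ + 2 * u₂ + 2 * a + 10 * g →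
              e₁ + e₂ + (u₁ + u₂) + a ≤ n → 3 * a ≤ e₁ + e₂ + o → o ≤ 2 * g → e₁ + e₂ ≤ 64 * g
  two-sides {n} {e₁} {e₂} {u₁} {u₂} {a} {o} {g} h₁ h₂ h₃ h₄ h₅ =
    -- With `e` and `u` summed over both sides, adding the sides and inserting `u ≤ n - e - a` gives
    -- `e ≤ 2a + 20g`. Then `3a ≤ e + o` gives `e ≤ 2o + 60g ≤ 64g`. The multipliers 3, 6, 2, 2 do
    -- this without subtraction.
    +-cancelʳ-≤ (6 * n + 5 * (e₁ + e₂) + 6 * (u₁ + u₂) + 12 * a + 2 * o) _ _ (begin
      e₁ + e₂ + (6 * n + 5 * (e₁ + e₂) + 6 * (u₁ + u₂) + 12 * a + 2 * o)
        ≡⟨ left n (e₁ + e₂) (u₁ + u₂) a o ⟩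
      3 * (n + n) + 6 * (e₁ + e₂ + (u₁ + u₂) + a) + 2 * (3 * a) + 2 * o
        ≤⟨ +-mono-≤ (+-mono-≤ (+-mono-≤ (*-monoʳ-≤ 3 (+-mono-≤ h₁ h₂)) (*-monoʳ-≤ 6 h₃)) (*-monoʳ-≤ 2 h₄)) (*-monoʳ-≤ 2 h₅) ⟩
      3 * (e₁ + 2 * u₁ + 2 * a + 10 * g + (e₂ + 2 * u₂ + 2 * a + 10 * g)) + 6 * n + 2 * (e₁ + e₂ + o) + 2 * (2 * g)
        ≡⟨ right n e₁ e₂ u₁ u₂ a o g ⟩
      64 * g + (6 * n + 5 * (e₁ + e₂) + 6 * (u₁ + u₂) + 12 * a + 2 * o) ∎)
    where
    open ≤-Reasoning
    left : ∀ n e u a o → e + (6 * n + 5 * e + 6 * u + 12 * a + 2 * o) ≡ 3 * (n + n) + 6 * (e + u + a) + 2 * (3 * a) + 2 * o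
    left = solve-∀
    right : ∀ n e₁ e₂ u₁ u₂ a o g →
      3 * (e₁ + 2 * u₁ + 2 * a + 10 * g + (e₂ + 2 * u₂ + 2 * a + 10 * g)) + 6 * n + 2 * (e₁ + e₂ + o) + 2 * (2 * g)
      ≡ 64 * g + (6 * n + 5 * (e₁ + e₂) + 6 * (u₁ + u₂) + 12 * a + 2 * o)
    right = solve-∀

  -- `x`, `y`, `a`, `b`, `r` stand for the numbers of minus, plus, good and other vertices and of
  -- back edges. Minus vertices need about `xn/2` in-edges and find only `x²/2` among themselves, so
  -- about `xy/2` come from plus. As both sides have about `n/2` vertices, `8r` is at least nearly
  -- `n²`.
  many-back-edges : ∀ {n x y a b r g} → n ≤ 2 * (x + a) + 8 * g → n ≤ 2 * (y + a) + 8 * g → x + y ≤ n →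
    a ≤ 22 * g → b ≤ 2 * g → x * n ≤ x * x + 2 * (x * (a + b) + r) + 2 * g * x →
    n * n ≤ 4 * (2 * r) + 252 * (g * n)
  many-back-edges {n} {x} {y} {a} {b} {r} {g} hx hy x+y≤n a≤ b≤ degree = begin
    n * n
      ≤⟨ *-monoʳ-≤ n (simplify {y} hy) ⟩
    n * (2 * y + 52 * g)
      ≡⟨ expand₁ n y g ⟩
    2 * y * n + 52 * (g * n)
      ≤⟨ +-monoˡ-≤ (52 * (g * n)) (*-monoʳ-≤ (2 * y) (simplify {x} hx)) ⟩
    2 * y * (2 * x + 52 * g) + 52 * (g * n)
      ≡⟨ expand₂ n x y g ⟩
    4 * (x * y) + 104 * (g * y) + 52 * (g * n)
      ≤⟨ +-monoˡ-≤ (52 * (g * n)) (+-mono-≤ (*-monoʳ-≤ 4 xy≤) (≤-trans (m≤m+n _ (96 * (g * y))) (≤-reflexive (sym (*-distribʳ-+ (g * y) 104 96))))) ⟩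
    4 * (50 * (g * x) + 2 * r) + 200 * (g * y) + 52 * (g * n)
      ≡⟨ expand₃ n x y r g ⟩
    4 * (2 * r) + 200 * (g * (x + y)) + 52 * (g * n)
      ≤⟨ +-monoˡ-≤ (52 * (g * n)) (+-monoʳ-≤ (4 * (2 * r)) (*-monoʳ-≤ 200 (*-monoʳ-≤ g x+y≤n))) ⟩
    4 * (2 * r) + 200 * (g * n) + 52 * (g * n)
      ≡⟨ expand₄ r (g * n) ⟩
    4 * (2 * r) + 252 * (g * n) ∎
    where
    open ≤-Reasoning
    expand₀ : ∀ y g → 2 * (y + 22 * g) + 8 * g ≡ 2 * y + 52 * g
    expand₀ = solve-∀
    simplify : ∀ {y} → n ≤ 2 * (y + a) + 8 * g → n ≤ 2 * y + 52 * g
    simplify {y} h = ≤-trans h (≤-trans (+-monoˡ-≤ (8 * g) (*-monoʳ-≤ 2 (+-monoʳ-≤ y a≤))) (≤-reflexive (expand₀ y g)))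
    expand₁ : ∀ n y g → n * (2 * y + 52 * g) ≡ 2 * y * n + 52 * (g * n)
    expand₁ = solve-∀
    expand₂ : ∀ n x y g → 2 * y * (2 * x + 52 * g) + 52 * (g * n) ≡ 4 * (x * y) + 104 * (g * y) + 52 * (g * n)
    expand₂ = solve-∀
    expand₃ : ∀ n x y r g → 4 * (50 * (g * x) + 2 * r) + 200 * (g * y) + 52 * (g * n) ≡
              4 * (2 * r) + 200 * (g * (x + y)) + 52 * (g * n)
    expand₃ = solve-∀
    expand₄ : ∀ r m → 4 * (2 * r) + 200 * m + 52 * m ≡ 4 * (2 * r) + 252 * m
    expand₄ = solve-∀
    collect : ∀ x r g → x * x + 2 * (x * (22 * g + 2 * g) + r) + 2 * g * x ≡ x * x + (50 * (g * x) + 2 * r)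
    collect = solve-∀
    xy≤ : x * y ≤ 50 * (g * x) + 2 * r
    xy≤ = +-cancelˡ-≤ (x * x) _ _ (begin
      x * x + x * y
        ≡⟨ *-distribˡ-+ x x y ⟨
      x * (x + y)
        ≤⟨ *-monoʳ-≤ x x+y≤n ⟩
      x * n
        ≤⟨ degree ⟩
      x * x + 2 * (x * (a + b) + r) + 2 * g * x
        ≤⟨ +-monoˡ-≤ (2 * g * x) (+-monoʳ-≤ (x * x) (*-monoʳ-≤ 2 (+-monoˡ-≤ r (*-monoʳ-≤ x (+-mono-≤ a≤ b≤))))) ⟩
      x * x + 2 * (x * (22 * g + 2 * g) + r) + 2 * g * x
        ≡⟨ collect x r g ⟩
      x * x + (50 * (g * x) + 2 * r) ∎)

  -- `e` counts back edges between tiles and `s` the agreeing pairs of tiles. Up to errors,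
  -- `s ≥ k²/3` leaves `e ≤ 11k²/3`, and `k ≤ n/4` turns this into `11n²/48`, just below the
  -- `12n²/48` that the degrees demand.
  few-edges-between-tiles : ∀ {n k e s g} → k * 4 ≤ n → e + s ≤ 4 * (k * k) + 1190 * (k * g) → k * k ≤ 3 * s →
    48 * e ≤ 11 * (n * n) + 14280 * (g * n)
  few-edges-between-tiles {n} {k} {e} {s} {g} 4k≤n es ks = begin
    48 * e
      ≡⟨ expand₁ e ⟩
    16 * (3 * e)
      ≤⟨ *-monoʳ-≤ 16 3e≤ ⟩
    16 * (11 * (k * k) + 3570 * (k * g))
      ≡⟨ expand₂ k g ⟩
    11 * ((k * 4) * (k * 4)) + 14280 * (g * (k * 4))
      ≤⟨ +-mono-≤ (*-monoʳ-≤ 11 (*-mono-≤ 4k≤n 4k≤n)) (*-monoʳ-≤ 14280 (*-monoʳ-≤ g 4k≤n)) ⟩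
    11 * (n * n) + 14280 * (g * n) ∎
    where
    open ≤-Reasoning
    expand₁ : ∀ e → 48 * e ≡ 16 * (3 * e)
    expand₁ = solve-∀
    expand₂ : ∀ k g → 16 * (11 * (k * k) + 3570 * (k * g)) ≡ 11 * ((k * 4) * (k * 4)) + 14280 * (g * (k * 4))
    expand₂ = solve-∀
    expand₃ : ∀ m p → 3 * (4 * m + 1190 * p) ≡ 11 * m + 3570 * p + m
    expand₃ = solve-∀
    3e≤ : 3 * e ≤ 11 * (k * k) + 3570 * (k * g)
    3e≤ = +-cancelʳ-≤ (k * k) _ _ (begin
      3 * e + k * k
        ≤⟨ +-monoʳ-≤ (3 * e) ks ⟩
      3 * e + 3 * s
        ≡⟨ *-distribˡ-+ 3 e s ⟨
      3 * (e + s)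
        ≤⟨ *-monoʳ-≤ 3 es ⟩
      3 * (4 * (k * k) + 1190 * (k * g))
        ≡⟨ expand₃ (k * k) (k * g) ⟩
      11 * (k * k) + 3570 * (k * g) + k * k ∎)

  -- Twelve times the lower bound against the upper bound leaves one spare `n²`, which the errors
  -- must cover: `14280 + 12 * (4 * 132 + 252) = 23640`.
  few-vertices : ∀ {n r e t g} → .{{NonZero n}} → n * n ≤ 4 * (2 * r) + 252 * (g * n) → 2 * r ≤ t → t ≤ e + 132 * (g * n) →
    48 * e ≤ 11 * (n * n) + 14280 * (g * n) → n ≤ 23640 * g
  few-vertices {n} {r} {e} {t} {g} h₁ h₂ h₃ h₄ = *-cancelʳ-≤ n (23640 * g) n
    (+-cancelˡ-≤ (11 * (n * n)) _ _ (begin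
      11 * (n * n) + n * n
        ≡⟨ expand₁ (n * n) ⟩
      12 * (n * n)
        ≤⟨ *-monoʳ-≤ 12 h₁ ⟩
      12 * (4 * (2 * r) + 252 * (g * n))
        ≤⟨ *-monoʳ-≤ 12 (+-monoˡ-≤ (252 * (g * n)) (*-monoʳ-≤ 4 (≤-trans h₂ h₃))) ⟩
      12 * (4 * (e + 132 * (g * n)) + 252 * (g * n))
        ≡⟨ expand₂ e (g * n) ⟩
      48 * e + 9360 * (g * n)
        ≤⟨ +-monoˡ-≤ (9360 * (g * n)) h₄ ⟩
      11 * (n * n) + 14280 * (g * n) + 9360 * (g * n)
        ≡⟨ expand₃ (n * n) g n ⟩
      11 * (n * n) + 23640 * g * n ∎))
    where
    open ≤-Reasoning
    expand₁ : ∀ m → 11 * m + m ≡ 12 * m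
    expand₁ = solve-∀
    expand₂ : ∀ e p → 12 * (4 * (e + 132 * p) + 252 * p) ≡ 48 * e + 9360 * p
    expand₂ = solve-∀
    expand₃ : ∀ m g n → 11 * m + 14280 * (g * n) + 9360 * (g * n) ≡ 11 * m + 23640 * g * n
    expand₃ = solve-∀

  -- Edges between two tiles

  2ab≤ : ∀ a b → 2 * (a * b) ≤ a * a + b * b
  2ab≤ a b = [ (λ h → ordered a b h) , (λ h → subst₂ _≤_ (cong (2 *_) (*-comm b a)) (+-comm (b * b) (a * a)) (ordered b a h)) ]′ (≤-total a b)
    where
    square : ∀ a c → 2 * (a * (c + a)) + c * c ≡ a * a + (c + a) * (c + a)
    square = solve-∀
    ordered : ∀ a b → a ≤ b → 2 * (a * b) ≤ a * a + b * b
    ordered a b a≤b = subst (λ z → 2 * (a * z) ≤ a * a + z * z) (m∸n+n≡m a≤b)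
      (≤-trans (m≤m+n _ ((b ∸ a) * (b ∸ a))) (≤-reflexive (square a (b ∸ a))))

  square-sum₃ : ∀ a b c → (a + (b + (c + 0))) * (a + (b + (c + 0))) ≤ 3 * (a * a + (b * b + (c * c + 0)))
  square-sum₃ a b c = ≤-trans (≤-reflexive (left a b c))
    (≤-trans (+-monoʳ-≤ (a * a + b * b + c * c) (+-mono-≤ (+-mono-≤ (2ab≤ a b) (2ab≤ b c)) (2ab≤ a c)))
      (≤-reflexive (right a b c)))
    where
    left : ∀ a b c → (a + (b + (c + 0))) * (a + (b + (c + 0))) ≡ a * a + b * b + c * c + (2 * (a * b) + 2 * (b * c) + 2 * (a * c))
    left = solve-∀
    right : ∀ a b c → a * a + b * b + c * c + (a * a + b * b + (b * b + c * c) + (a * a + c * c)) ≡ 3 * (a * a + (b * b + (c * c + 0)))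
    right = solve-∀

  -- Cauchy–Schwarz for the sizes of the three classes.
  agreeing-pairs : ∀ {k} (f : Fin k → Fin 3) → k * k ≤ 3 * sum (λ i → card (λ i′ → f i′ == f i))
  agreeing-pairs {k} f = begin
    k * k
      ≡⟨ cong₂ _*_ k≡ k≡ ⟩
    sum N * sum N
      ≤⟨ square-sum₃ (N zero) (N (suc zero)) (N (suc (suc zero))) ⟩
    3 * sum (λ t → N t * N t)
      ≡⟨ cong (3 *_) pairs ⟩
    3 * sum (λ i → card (λ i′ → f i′ == f i)) ∎
    where
    open ≤-Reasoning
    N : Fin 3 → ℕ
    N t = card (λ i → f i == t)
    collapse : ∀ i (h : Fin 3 → ℕ) → sum (λ t → 𝟙 (f i == t) * h t) ≡ h (f i)
    collapse i h = trans (sum-single {f = λ t → 𝟙 (f i == t) * h t} (f i) (λ t t≢ → cong (λ b → 𝟙 b * h t) (==-≢ (t≢ ∘ sym))))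
      (trans (cong (λ b → 𝟙 b * h (f i)) (==-refl (f i))) (*-identityˡ _))
    k≡ : k ≡ sum N
    k≡ = trans (sym (trans (sum-const k 1) (*-identityʳ k)))
      (trans (sum-cong-≗ (λ i → sym (trans (sum-cong-≗ (λ t → sym (*-identityʳ (𝟙 (f i == t))))) (collapse i (λ _ → 1)))))
        (∑-comm (λ i t → 𝟙 (f i == t))))
    pairs : sum (λ t → N t * N t) ≡ sum (λ i → card (λ i′ → f i′ == f i))
    pairs = trans (sum-cong-≗ (λ t → *-distribʳ-sum (N t) (λ i → 𝟙 (f i == t))))
      (trans (∑-comm (λ t i → 𝟙 (f i == t) * N t)) (sum-cong-≗ (λ i → collapse i N)))

  third-index : (p p′ : Fin 4) → ∃ λ j → p ≢ j × p′ ≢ j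
  third-index zero zero = suc zero , (λ ()) , (λ ())
  third-index zero (suc zero) = suc (suc zero) , (λ ()) , (λ ())
  third-index zero (suc (suc _)) = suc zero , (λ ()) , (λ ())
  third-index (suc zero) zero = suc (suc zero) , (λ ()) , (λ ())
  third-index (suc (suc _)) zero = suc zero , (λ ()) , (λ ())
  third-index (suc _) (suc _) = zero , (λ ()) , (λ ())

  card₄ : (f : Fin 4 → Bool) → (∀ b → f b ≡ true) ⊎ card f ≤ 3
  card₄ f = decide (Fin.any? λ b → f b Bool.≟ false)
    where
    decide : Dec (∃ λ b → f b ≡ false) → (∀ b → f b ≡ true) ⊎ card f ≤ 3
    decide (no ¬b) = inj₁ (λ b → Bool.¬-not (λ e → ¬b (b , e)))
    decide (yes (b , e)) = inj₂ (+-cancelʳ-≤ 1 _ 3 (≤-trans (≤-reflexive (sym (trans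
        (∑-distrib-+ (𝟙 ∘ f) (λ c → 𝟙 (c == b)))
        (cong (card f +_) (trans (sum-single {f = λ c → 𝟙 (c == b)} b (λ c c≢ → cong 𝟙 (==-≢ c≢))) (cong 𝟙 (==-refl b)))))))
      (sum-bound {n = 4} 1 pt)))
      where
      pt : ∀ c → 𝟙 (f c) + 𝟙 (c == b) ≤ 1
      pt c = go (c Fin.≟ b)
        where
        go : (q : Dec (c ≡ b)) → 𝟙 (f c) + 𝟙 ⌊ q ⌋ ≤ 1
        go (yes refl) rewrite e = ≤-refl
        go (no _) = ≤-trans (≤-reflexive (+-identityʳ _)) (𝟙≤1 (f c))

  tileType : (Fin 4 → Class) → Fin 3
  tileType c = go (Fin.all? λ j → isMinus (c j) Bool.≟ true) (Fin.all? λ j → isPlus (c j) Bool.≟ true)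
    where
    go : Dec (∀ j → isMinus (c j) ≡ true) → Dec (∀ j → isPlus (c j) ≡ true) → Fin 3
    go (yes _) _ = zero
    go (no _) (yes _) = suc zero
    go (no _) (no _) = suc (suc zero)

  module _ (c : Fin 4 → Class) where

    tileType-minus : tileType c ≡ zero → ∀ j → isMinus (c j) ≡ true
    tileType-minus e with Fin.all? (λ j → isMinus (c j) Bool.≟ true) | Fin.all? (λ j → isPlus (c j) Bool.≟ true)
    ... | yes h | _ = h
    tileType-minus () | no _ | yes _
    tileType-minus () | no _ | no _

    tileType-plus : tileType c ≡ suc zero → ∀ j → isPlus (c j) ≡ true
    tileType-plus e with Fin.all? (λ j → isMinus (c j) Bool.≟ true) | Fin.all? (λ j → isPlus (c j) Bool.≟ true)
    tileType-plus () | yes h | _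
    ... | no _ | yes h = h
    tileType-plus () | no _ | no _

    tileType-all-minus : (∀ j → isMinus (c j) ≡ true) → tileType c ≡ zero
    tileType-all-minus h with Fin.all? (λ j → isMinus (c j) Bool.≟ true) | Fin.all? (λ j → isPlus (c j) Bool.≟ true)
    ... | yes _ | _ = refl
    ... | no ¬h | _ = ⊥-elim (¬h h)

    tileType-all-plus : (∀ j → isPlus (c j) ≡ true) → tileType c ≡ suc zero
    tileType-all-plus h with Fin.all? (λ j → isMinus (c j) Bool.≟ true) | Fin.all? (λ j → isPlus (c j) Bool.≟ true)
    ... | yes h′ | _ = ⊥-elim (clash (c zero) (h zero) (h′ zero))
      where
      clash : ∀ c → isPlus c ≡ true → isMinus c ≡ true → ⊥
      clash plus _ ()
      clash minus () _
    ... | no _ | yes _ = refl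
    ... | no _ | no ¬h = ⊥-elim (¬h h)

  Opposite : Class → Class → Set
  Opposite c c′ = (isPlus c ≡ true × isMinus c′ ≡ true) ⊎ (isMinus c ≡ true × isPlus c′ ≡ true)

  opposite-sym : ∀ {c c′} → Opposite c c′ → Opposite c′ c
  opposite-sym (inj₁ (p , m)) = inj₂ (m , p)
  opposite-sym (inj₂ (m , p)) = inj₁ (p , m)

  back⇒opposite : ∀ c c′ {s t} → back c c′ s t ≡ true → Opposite c c′
  back⇒opposite plus minus _ = inj₁ (refl , refl)
  back⇒opposite minus plus _ = inj₂ (refl , refl)

  not-both : ∀ c → isPlus c ≡ true → isMinus c ≡ true → ⊥
  not-both plus _ ()
  not-both minus () _

  -- A vertex joined to all of the other tile makes that tile pure, of the class opposite to its
  -- own. Equal types would put the vertex itself into that class.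
  full-star⇒types-differ : ∀ (c c′ : Fin 4 → Class) p → (∀ b → Opposite (c p) (c′ b)) → tileType c ≢ tileType c′
  full-star⇒types-differ c c′ p opp eq = go (opp zero)
    where
    side-plus : isPlus (c p) ≡ true → ∀ b → Opposite (c p) (c′ b) → isMinus (c′ b) ≡ true
    side-plus pl b (inj₁ (_ , m)) = m
    side-plus pl b (inj₂ (m , _)) = ⊥-elim (not-both (c p) pl m)
    side-minus : isMinus (c p) ≡ true → ∀ b → Opposite (c p) (c′ b) → isPlus (c′ b) ≡ true
    side-minus mi b (inj₁ (pl , _)) = ⊥-elim (not-both (c p) pl mi)
    side-minus mi b (inj₂ (_ , pl)) = pl
    go : Opposite (c p) (c′ zero) → ⊥
    go (inj₁ (pl , _)) = not-both (c p) pl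
      (tileType-minus c (trans eq (tileType-all-minus c′ (λ b → side-plus pl b (opp b)))) p)
    go (inj₂ (mi , _)) = not-both (c p)
      (tileType-plus c (trans eq (tileType-all-plus c′ (λ b → side-minus mi b (opp b)))) p) mi

  -- Without two disjoint edges E is a star, and a star with four edges makes one of the two types pure.
  star-bound : (c c′ : Fin 4 → Class) (E : Fin 4 → Fin 4 → Bool) →
    (∀ p b → E p b ≡ true → Opposite (c p) (c′ b)) →
    (∀ p p′ b b′ → p ≢ p′ → b ≢ b′ → E p b ≡ true → E p′ b′ ≡ true → ⊥) →
    sum (λ p → card (E p)) + 𝟙 (tileType c′ == tileType c) ≤ 4
  star-bound c c′ E opp no₂ = decide (Fin.any? λ p → Fin.any? λ b → E p b Bool.≟ true)
    where
    same : Bool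
    same = tileType c′ == tileType c
    full : (f : Fin 4 → Bool) → ((∀ b → f b ≡ true) → tileType c ≢ tileType c′) → card f + 𝟙 same ≤ 4
    full f differ = [ (λ h → ≤-trans (+-mono-≤ (sum-bound {n = 4} 1 (𝟙≤1 ∘ f)) (≤-reflexive (cong 𝟙 (==-≢ (differ h ∘ sym))))) ≤-refl) ,
                      (λ h → +-mono-≤ h (𝟙≤1 same)) ]′ (card₄ f)
    row : ∀ p₀ → (∀ p b → p ≢ p₀ → E p b ≡ false) → sum (λ p → card (E p)) + 𝟙 same ≤ 4
    row p₀ off = subst (λ z → z + 𝟙 same ≤ 4)
      (sym (sum-single {f = λ p → card (E p)} p₀ (λ p p≢ → sum-0 {f = λ b → 𝟙 (E p b)} (λ b → cong 𝟙 (off p b p≢)))))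
      (full (E p₀) (λ h → full-star⇒types-differ c c′ p₀ (λ b → opp p₀ b (h b))))
    column : ∀ b₀ → (∀ p b → b ≢ b₀ → E p b ≡ false) → sum (λ p → card (E p)) + 𝟙 same ≤ 4
    column b₀ off = subst (λ z → z + 𝟙 same ≤ 4)
      (sym (sum-cong-≗ (λ p → sum-single {f = λ b → 𝟙 (E p b)} b₀ (λ b b≢ → cong 𝟙 (off p b b≢)))))
      (full (λ p → E p b₀) (λ h → full-star⇒types-differ c′ c b₀ (λ p → opposite-sym (opp p b₀ (h p))) ∘ sym))
    decide : Dec (∃ λ p → ∃ λ b → E p b ≡ true) → sum (λ p → card (E p)) + 𝟙 same ≤ 4
    decide (no ¬e) = row zero (λ p b _ → Bool.¬-not (λ e → ¬e (p , b , e)))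
    decide (yes (p₀ , b₀ , e₀)) = decide′ (Fin.any? λ p → Fin.any? λ b → ¬? (p Fin.≟ p₀) ×-dec (E p b Bool.≟ true))
      where
      decide′ : Dec (∃ λ p → ∃ λ b → p ≢ p₀ × E p b ≡ true) → sum (λ p → card (E p)) + 𝟙 same ≤ 4
      decide′ (no ¬e) = row p₀ (λ p b p≢ → Bool.¬-not (λ e → ¬e (p , b , p≢ , e)))
      -- The edge in row `p₁` must share the column `b₀` with `e₀`; an edge off that column would be
      -- disjoint from one of these two.
      decide′ (yes (p₁ , b₁ , p₁≢ , e₁)) = column b₀ (λ p b b≢ → Bool.¬-not (outside p b b≢))
        where
        e₁′ : E p₁ b₀ ≡ true
        e₁′ = go (b₁ Fin.≟ b₀)
          where
          go : Dec (b₁ ≡ b₀) → E p₁ b₀ ≡ true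
          go (yes refl) = e₁
          go (no b₁≢) = ⊥-elim (no₂ p₁ p₀ b₁ b₀ p₁≢ b₁≢ e₁ e₀)
        outside : ∀ p b → b ≢ b₀ → E p b ≢ true
        outside p b b≢ e = go (p Fin.≟ p₀)
          where
          go : Dec (p ≡ p₀) → ⊥
          go (no p≢) = no₂ p p₀ b b₀ p≢ b≢ e e₀
          go (yes refl) = no₂ p p₁ b b₀ (p₁≢ ∘ sym) b≢ e e₁′

  -- The two halves of the contradiction

  -- `n < M * d` says that `M` rounds with `d` new rich vertices each are impossible;
  -- `n * d ≤ g * g` makes `d` stray edges per vertex negligible.
  module Endgame {n k : ℕ} (φ : Fin k → Fin 4 → Fin n)
    (φ-injective : ∀ i i′ j j′ → φ i j ≡ φ i′ j′ → i ≡ i′ × j ≡ j′)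
    (cls : Fin n → Class) (adj : Fin n → Fin n → Bool) (d M B : ℕ)
    (d-large : (4 + (M + M)) * 4 < d) (B-large : 4 + (M + M) ≤ B)
    (augmentation-free :
      (Q : List (Fin k)) (Rs : List (Resources.Resource cls adj)) →
      AllPairs (Resources.DisjointR cls adj) Rs →
      (∀ {r} → r ∈ Rs → ∀ i j → Resources._∈ᵣ_ cls adj (φ i j) r → i ∈ Q) →
      length Q < length Rs → length Rs ≤ B → ⊥)
    (adj-antisym : ∀ u v → 𝟙 (adj u v) + 𝟙 (adj v u) ≤ 1)
    (g : ℕ)
    (indegree : ∀ v → n ≤ 2 * sum (λ u → 𝟙 (adj u v)) + 2 * g)
    (outdegree : ∀ v → n ≤ 2 * sum (λ u → 𝟙 (adj v u)) + 2 * g)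
    (1≤g : 1 ≤ g) (d≤g : d ≤ g) (nd≤gg : n * d ≤ g * g) (n<Md : n < M * d)
    (other≤2g : card (isOther ∘ cls) ≤ 2 * g)
    (minus-large : n ≤ 2 * (card (isMinus ∘ cls) + card (isGood ∘ cls)) + 8 * g)
    (plus-large : n ≤ 2 * (card (isPlus ∘ cls) + card (isGood ∘ cls)) + 8 * g)
    where

    open Resources cls adj
    open Closure φ φ-injective cls adj d M B d-large B-large augmentation-free

    -- First half: few vertices are exposed

    exposed : ℕ → Fin n → Bool
    exposed m y = ⌊ exposed? (rich m) y ⌋

    rich-mono : ∀ m {v} → rich 0 v ≡ true → rich m v ≡ true
    rich-mono zero e = e
    rich-mono (suc m) {v} e = cong (_∨ ⌊ d ≤? exposedNbrs (rich m) v ⌋) (rich-mono m e)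

    exposed-mono : ∀ m → card (exposed 0) ≤ card (exposed m)
    exposed-mono m = sum-mono λ y → 𝟙-⌊⌋ (exposed? (rich 0) y) λ (s , r) →
      ≤-reflexive (sym (cong 𝟙 (⌊⌋-yes (exposed? (rich m) y)
        (s , map₂ (map₂ λ (i , j , j′ , e , j≢ , ρ) → i , j , j′ , e , j≢ , rich-mono m ρ) r))))

    exposed-sided : ∀ m y → 𝟙 (exposed m y) ≤ 𝟙 (isMinus (cls y) ∧ exposed m y) + 𝟙 (isPlus (cls y) ∧ exposed m y)
    exposed-sided m y = go (exposed? (rich m) y)
      where
      go : (e? : Dec (Exposed (rich m) y)) → 𝟙 ⌊ e? ⌋ ≤ 𝟙 (isMinus (cls y) ∧ ⌊ e? ⌋) + 𝟙 (isPlus (cls y) ∧ ⌊ e? ⌋)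
      go (no _) = z≤n
      go (yes (s , _)) = sided s
        where
        sided : ∀ {c} → Sided c → 1 ≤ 𝟙 (isMinus c ∧ true) + 𝟙 (isPlus c ∧ true)
        sided plus = s≤s z≤n
        sided minus = s≤s z≤n

    -- A round with at most `d` newcomers is nearly closed: a vertex that is still not rich
    -- afterwards has fewer than `d` back edges to exposed vertices. This is the sparsity that both
    -- uses of `OneSide` need.
    module Level (m : ℕ) (m≤M : m ≤ M) (new≤d : card (λ v → rich (suc m) v ∧ not (rich m v)) ≤ d) where

      private
        good⇒ρ : ∀ v → 𝟙 (isGood (cls v)) ≤ 𝟙 (rich m v)
        good⇒ρ v = go (isGood (cls v)) refl
          where
          go : ∀ b → isGood (cls v) ≡ b → 𝟙 b ≤ 𝟙 (rich m v)
          go false _ = z≤n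
          go true e = ≤-reflexive (sym (cong 𝟙 (good⇒rich m (isGood⇒≡ e))))

        good-or-side : (s : Fin n → Bool) → (∀ v → 𝟙 (s v) + 𝟙 (isGood (cls v)) ≤ 1) →
          card s + card (isGood ∘ cls) ≤
          card (λ v → s v ∧ exposed m v) + card (λ v → s v ∧ not (exposed m v) ∧ not (rich m v)) + card (rich m)
        good-or-side s excl = subst₂ _≤_ (∑-distrib-+ (𝟙 ∘ s) (𝟙 ∘ isGood ∘ cls))
          (∑-+₃ (λ v → 𝟙 (s v ∧ exposed m v)) (λ v → 𝟙 (s v ∧ not (exposed m v) ∧ not (rich m v))) (𝟙 ∘ rich m))
          (sum-mono λ v → pt (s v) (isGood (cls v)) (exposed m v) (rich m v) (excl v) (good⇒ρ v))
          where
          pt : ∀ s γ ε ρ → 𝟙 s + 𝟙 γ ≤ 1 → 𝟙 γ ≤ 𝟙 ρ → 𝟙 s + 𝟙 γ ≤ 𝟙 (s ∧ ε) + 𝟙 (s ∧ not ε ∧ not ρ) + 𝟙 ρ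
          pt true true _ _ (s≤s ()) _
          pt true false true _ _ _ = s≤s z≤n
          pt true false false true _ _ = s≤s z≤n
          pt true false false false _ _ = s≤s z≤n
          pt false γ _ _ _ h = h

        classified : ∀ c ρ → 𝟙 (isGood c) ≤ 𝟙 ρ → 1 ≤ 𝟙 (isMinus c) + 𝟙 (isPlus c) + 𝟙 (isOther c) + 𝟙 ρ
        classified plus _ _ = s≤s z≤n
        classified minus _ _ = s≤s z≤n
        classified good _ h = h
        classified other _ _ = s≤s z≤n

        swap-classes : ∀ a b c → a + b + c ≡ b + a + c
        swap-classes = solve-∀

        few-exposed : ∀ u → rich (suc m) u ≡ false → exposedNbrs (rich m) u ≤ d
        few-exposed u e = <⇒≤ (≰⇒> (⌊⌋-false (d ≤? exposedNbrs (rich m) u) (second (rich m u) e)))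
          where
          second : ∀ b {c} → b ∨ c ≡ false → c ≡ false
          second false e = e

        sub : ∀ {s t r ε} → (s ≡ true → t ≡ true → r ≡ true) → 𝟙 (s ∧ t ∧ ε) ≤ 𝟙 (r ∧ ε)
        sub {false} h = z≤n
        sub {true} {false} h = z≤n
        sub {true} {true} {r} {ε} h rewrite h refl refl = ≤-refl

        minus-few : ∀ u → rich (suc m) u ≡ false → isPlus (cls u) ≡ true →
                    card (λ v → isMinus (cls v) ∧ adj u v ∧ exposed m v) ≤ d
        minus-few u e pu = ≤-trans (sum-mono λ v → sub (back-pm (cls u) (cls v) pu)) (few-exposed u e)
          where
          back-pm : ∀ c c′ {s t} → isPlus c ≡ true → isMinus c′ ≡ true → s ≡ true → back c c′ s t ≡ true
          back-pm plus minus _ _ h = h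

        plus-few : ∀ u → rich (suc m) u ≡ false → isMinus (cls u) ≡ true →
                   card (λ v → isPlus (cls v) ∧ adj v u ∧ exposed m v) ≤ d
        plus-few u e mu = ≤-trans (sum-mono λ v → sub (back-mp (cls u) (cls v) mu)) (few-exposed u e)
          where
          back-mp : ∀ c c′ {s t} → isMinus c ≡ true → isPlus c′ ≡ true → t ≡ true → back c c′ s t ≡ true
          back-mp minus plus _ _ h = h

        minus-excl : ∀ v → 𝟙 (isMinus (cls v)) + 𝟙 (isGood (cls v)) ≤ 1
        minus-excl v = go (cls v)
          where
          go : ∀ c → 𝟙 (isMinus c) + 𝟙 (isGood c) ≤ 1
          go plus = z≤n
          go minus = ≤-refl
          go good = ≤-refl
          go other = z≤n

        plus-excl : ∀ v → 𝟙 (isPlus (cls v)) + 𝟙 (isGood (cls v)) ≤ 1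
        plus-excl v = go (cls v)
          where
          go : ∀ c → 𝟙 (isPlus c) + 𝟙 (isGood c) ≤ 1
          go plus = ≤-refl
          go minus = z≤n
          go good = ≤-refl
          go other = z≤n

        module MinusSide = DegreeCount.OneSide adj adj-antisym g indegree
          (isMinus ∘ cls) (isPlus ∘ cls) (isOther ∘ cls) (rich m) (rich (suc m)) (exposed m) (card (isGood ∘ cls)) d
          (λ v → classified (cls v) (rich m v) (good⇒ρ v))
          minus-few (good-or-side (isMinus ∘ cls) minus-excl) 1≤g d≤g nd≤gg other≤2g new≤d minus-large

        module PlusSide = DegreeCount.OneSide (λ u v → adj v u) (λ u v → adj-antisym v u) g outdegree
          (isPlus ∘ cls) (isMinus ∘ cls) (isOther ∘ cls) (rich m) (rich (suc m)) (exposed m) (card (isGood ∘ cls)) d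
          (λ v → subst (1 ≤_) (cong (_+ 𝟙 (rich m v)) (swap-classes (𝟙 (isMinus (cls v))) (𝟙 (isPlus (cls v))) (𝟙 (isOther (cls v)))))
            (classified (cls v) (rich m v) (good⇒ρ v)))
          plus-few (good-or-side (isPlus ∘ cls) plus-excl) 1≤g d≤g nd≤gg other≤2g new≤d plus-large

        exclusive : ∀ v → ¬ (rich m v ≡ true × exposed m v ≡ true)
        exclusive v (ρ , ε) = rich-not-exposed m≤M ρ (⌊⌋-true (exposed? (rich m) v) ε)

        E₁ E₂ U₁ U₂ : Fin n → Bool
        E₁ v = isMinus (cls v) ∧ exposed m v
        E₂ v = isPlus (cls v) ∧ exposed m v
        U₁ v = isMinus (cls v) ∧ not (exposed m v) ∧ not (rich m v)
        U₂ v = isPlus (cls v) ∧ not (exposed m v) ∧ not (rich m v)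

        total≤n : card E₁ + card E₂ + (card U₁ + card U₂) + card (rich m) ≤ n
        total≤n = subst₂ _≤_ split (trans (sum-const n 1) (*-identityʳ n))
          (sum-mono λ v → pt (cls v) (exposed m v) (rich m v) (exclusive v))
          where
          split : sum (λ v → 𝟙 (E₁ v) + 𝟙 (E₂ v) + (𝟙 (U₁ v) + 𝟙 (U₂ v)) + 𝟙 (rich m v)) ≡
                  card E₁ + card E₂ + (card U₁ + card U₂) + card (rich m)
          split = trans (∑-+₃ (λ v → 𝟙 (E₁ v) + 𝟙 (E₂ v)) (λ v → 𝟙 (U₁ v) + 𝟙 (U₂ v)) (𝟙 ∘ rich m))
            (cong (_+ card (rich m)) (cong₂ _+_ (∑-distrib-+ (𝟙 ∘ E₁) (𝟙 ∘ E₂)) (∑-distrib-+ (𝟙 ∘ U₁) (𝟙 ∘ U₂))))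
          pt : ∀ c ε ρ → ¬ (ρ ≡ true × ε ≡ true) →
               𝟙 (isMinus c ∧ ε) + 𝟙 (isPlus c ∧ ε) + (𝟙 (isMinus c ∧ not ε ∧ not ρ) + 𝟙 (isPlus c ∧ not ε ∧ not ρ)) + 𝟙 ρ ≤ 1
          pt c true true h = ⊥-elim (h (refl , refl))
          pt plus true false h = ≤-refl
          pt plus false true h = ≤-refl
          pt plus false false h = ≤-refl
          pt minus true false h = ≤-refl
          pt minus false true h = ≤-refl
          pt minus false false h = ≤-refl
          pt good true false h = z≤n
          pt good false true h = ≤-refl
          pt good false false h = z≤n
          pt other true false h = z≤n
          pt other false true h = ≤-refl
          pt other false false h = z≤n

        exposed≤ : card (exposed m) ≤ card E₁ + card E₂
        exposed≤ = ≤-trans (sum-mono (exposed-sided m)) (≤-reflexive (∑-distrib-+ (𝟙 ∘ E₁) (𝟙 ∘ E₂)))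

      exposed≤64g : card (exposed m) ≤ 64 * g
      exposed≤64g = ≤-trans exposed≤ (two-sides {n} {card E₁} {card E₂} {card U₁} {card U₂} {card (rich m)} {card (isOther ∘ cls)} {g} MinusSide.side-bound PlusSide.side-bound total≤n
        (≤-trans (3rich≤exposed m≤M) (+-monoˡ-≤ _ exposed≤)) other≤2g)

    -- Exposure only grows from round 0, so an excess there persists at every level. Then each round
    -- adds at least `d` rich vertices, and `M` rounds give more than `n`.
    initially-exposed≤64g : card (exposed 0) ≤ 64 * g
    initially-exposed≤64g = decide (card (exposed 0) ≤? 64 * g)
      where
      decide : Dec (card (exposed 0) ≤ 64 * g) → card (exposed 0) ≤ 64 * g
      decide (yes h) = h
      decide (no h) = ⊥-elim (<⇒≱ n<Md (≤-trans (grow M ≤-refl) (card≤n (rich M))))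
        where
        new-many : ∀ m → m ≤ M → d ≤ card (λ v → rich (suc m) v ∧ not (rich m v))
        new-many m m≤M = ≮⇒≥ λ lt → h (≤-trans (exposed-mono m) (Level.exposed≤64g m m≤M (<⇒≤ lt)))
        grow : ∀ m → m ≤ M → m * d ≤ card (rich m)
        grow zero _ = z≤n
        grow (suc m) m<M = ≤-trans (+-mono-≤ (new-many m (<⇒≤ m<M)) (grow m (<⇒≤ m<M)))
          (≤-trans (≤-reflexive (sym (∑-distrib-+ (λ v → 𝟙 (rich (suc m) v ∧ not (rich m v))) (𝟙 ∘ rich m))))
            (sum-mono λ v → pt (rich m v) ⌊ d ≤? exposedNbrs (rich m) v ⌋))
          where
          pt : ∀ b c → 𝟙 ((b ∨ c) ∧ not b) + 𝟙 b ≤ 𝟙 (b ∨ c)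
          pt true _ = ≤-refl
          pt false true = ≤-refl
          pt false false = ≤-refl

    -- Second half: back edges between tiles

    isTiled : Fin n → Bool
    isTiled v = ⌊ tiled? v ⌋

    good≤22g : card (isGood ∘ cls) ≤ 22 * g
    good≤22g = *-cancelˡ-≤ 3 (begin
      3 * card (isGood ∘ cls)
        ≤⟨ 3rich≤exposed z≤n ⟩
      card (exposed 0) + card (isOther ∘ cls)
        ≤⟨ +-mono-≤ initially-exposed≤64g other≤2g ⟩
      64 * g + 2 * g
        ≡⟨ regroup g ⟩
      3 * (22 * g) ∎)
      where
      open ≤-Reasoning
      regroup : ∀ g → 64 * g + 2 * g ≡ 3 * (22 * g)
      regroup = solve-∀

    exposed+other≤66g : card (exposed 0) + card (isOther ∘ cls) ≤ 66 * g
    exposed+other≤66g = ≤-trans (+-mono-≤ initially-exposed≤64g other≤2g) (≤-reflexive (sym (*-distribʳ-+ g 64 2)))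

    released⇒counted : ∀ v → Released (rich 0) v → cls v ≢ good → 1 ≤ 𝟙 (exposed 0 v) + 𝟙 (isOther (cls v))
    released⇒counted v r ¬good = go (cls v) refl
      where
      sided : Sided (cls v) → 1 ≤ 𝟙 (exposed 0 v) + 𝟙 (isOther (cls v))
      sided s = ≤-trans (≤-reflexive (sym (cong 𝟙 (⌊⌋-yes (exposed? (rich 0) v) (s , r))))) (m≤m+n _ _)
      go : ∀ c → cls v ≡ c → 1 ≤ 𝟙 (exposed 0 v) + 𝟙 (isOther (cls v))
      go plus e = sided (subst Sided (sym e) plus)
      go minus e = sided (subst Sided (sym e) minus)
      go good e = ⊥-elim (¬good e)
      go other e = ≤-trans (≤-reflexive (sym (cong (𝟙 ∘ isOther) e))) (m≤n+m _ _)

    card-exposed+other : sum (λ v → 𝟙 (exposed 0 v) + 𝟙 (isOther (cls v))) ≤ 66 * g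
    card-exposed+other = ≤-trans (≤-reflexive (∑-distrib-+ (𝟙 ∘ exposed 0) (𝟙 ∘ isOther ∘ cls))) exposed+other≤66g

    untiled≤66g : card (not ∘ isTiled) ≤ 66 * g
    untiled≤66g = ≤-trans (sum-mono λ v → pt v (tiled? v)) card-exposed+other
      where
      pt : ∀ v → (t : Dec (Tiled v)) → 𝟙 (not ⌊ t ⌋) ≤ 𝟙 (exposed 0 v) + 𝟙 (isOther (cls v))
      pt v (yes _) = z≤n
      pt v (no ¬t) = released⇒counted v (inj₁ ¬t) (λ e → ¬t (rich⇒tiled {0} z≤n (cong isGood e)))

    isSeed : Fin k → Fin 4 → Bool
    isSeed i j = ⌊ d ≤? card (λ i′ → ⌊ twoEdges? i j i′ ⌋) ⌋

    seeds≤66g : sum (λ i → card (isSeed i)) ≤ 66 * g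
    seeds≤66g = ≤-trans (sum₂-mono pt) (≤-trans
        (DoubleFamily.sum₂-≤ φ φ-injective (λ v → 𝟙 (exposed 0 v) + 𝟙 (isOther (cls v)))) card-exposed+other)
      where
      pt : ∀ i j → 𝟙 (isSeed i j) ≤ 𝟙 (exposed 0 (φ i j)) + 𝟙 (isOther (cls (φ i j)))
      pt i j = 𝟙-⌊⌋ (d ≤? card (λ i′ → ⌊ twoEdges? i j i′ ⌋)) λ s →
        released⇒counted (φ i j) (inj₂ (inj₁ (i , j , refl , s))) (λ e → rich-not-seed {0} z≤n (cong isGood e) s)

    tileEdges : Fin k → Fin k → ℕ
    tileEdges i i′ = sum (λ j → card (λ j′ → R (φ i j) (φ i′ j′)))

    agree : Fin k → Fin k → Bool
    agree i i′ = tileType (cls ∘ φ i′) == tileType (cls ∘ φ i)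

    -- Without two disjoint edges the star bound applies. Otherwise the trivial bound `16 + 1 = 17`
    -- is charged to an index `j` witnessing `TwoEdges`.
    tileEdges≤ : ∀ i i′ → tileEdges i i′ + 𝟙 (agree i i′) ≤ 4 + 17 * card (λ j → ⌊ twoEdges? i j i′ ⌋)
    tileEdges≤ i i′ = decide (Fin.any? λ j → ⌊ twoEdges? i j i′ ⌋ Bool.≟ true)
      where
      decide : Dec (∃ λ j → ⌊ twoEdges? i j i′ ⌋ ≡ true) →
               tileEdges i i′ + 𝟙 (agree i i′) ≤ 4 + 17 * card (λ j → ⌊ twoEdges? i j i′ ⌋)
      decide (yes (j , e)) = ≤-trans
        (+-mono-≤ {tileEdges i i′} {16} (sum-bound {n = 4} 4 (λ p → card≤n (λ b → R (φ i p) (φ i′ b)))) (𝟙≤1 (agree i i′)))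
        (≤-trans (*-monoʳ-≤ 17 (≤-trans (≤-reflexive (sym (cong 𝟙 e))) (term≤sum (λ j → 𝟙 ⌊ twoEdges? i j i′ ⌋) j))) (m≤n+m _ 4))
      decide (no ¬e) = ≤-trans
        (star-bound (cls ∘ φ i) (cls ∘ φ i′) (λ p b → R (φ i p) (φ i′ b))
          (λ p b → back⇒opposite (cls (φ i p)) (cls (φ i′ b)))
          (λ p p′ b b′ p≢ b≢ e e′ → let j , p≢j , p′≢j = third-index p p′ in
            ¬e (j , ⌊⌋-yes (twoEdges? i j i′) (p , p′ , b , b′ , p≢ , b≢ , p≢j , p′≢j , e , e′))))
        (m≤m+n 4 _)

    -- A vertex that is no seed has fewer than `d ≤ g` partner tiles, a seed at most `k`. With `4k`
    -- tiled vertices and at most `66g` seeds the total is `4kg + 66kg`.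
    twoEdges-count : sum (λ i → sum (λ i′ → card (λ j → ⌊ twoEdges? i j i′ ⌋))) ≤ 70 * (k * g)
    twoEdges-count = begin
      sum (λ i → sum (λ i′ → card (λ j → ⌊ twoEdges? i j i′ ⌋)))
        ≡⟨ sum-cong-≗ (λ i → ∑-comm (λ i′ j → 𝟙 ⌊ twoEdges? i j i′ ⌋)) ⟩
      sum (λ i → sum (λ j → card (λ i′ → ⌊ twoEdges? i j i′ ⌋)))
        ≤⟨ sum₂-mono (λ i j → pt i j (d ≤? card (λ i′ → ⌊ twoEdges? i j i′ ⌋))) ⟩
      sum (λ i → sum (λ j → g + k * 𝟙 (isSeed i j)))
        ≡⟨ sum₂-+ (λ i j → g) (λ i j → k * 𝟙 (isSeed i j)) ⟩
      sum {k} (λ i → sum {4} (λ j → g)) + sum (λ i → sum (λ j → k * 𝟙 (isSeed i j)))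
        ≡⟨ cong₂ _+_ (trans (sum-cong-≗ {k} (λ i → sum-const 4 g)) (sum-const k (4 * g)))
             (trans (sum-cong-≗ (λ i → sym (*-distribˡ-sum k (𝟙 ∘ isSeed i)))) (sym (*-distribˡ-sum k (λ i → card (isSeed i))))) ⟩
      k * (4 * g) + k * sum (λ i → card (isSeed i))
        ≤⟨ +-monoʳ-≤ (k * (4 * g)) (*-monoʳ-≤ k seeds≤66g) ⟩
      k * (4 * g) + k * (66 * g)
        ≡⟨ regroup k g ⟩
      70 * (k * g) ∎
      where
      open ≤-Reasoning
      regroup : ∀ k g → k * (4 * g) + k * (66 * g) ≡ 70 * (k * g)
      regroup = solve-∀
      pt : ∀ i j → (s : Dec (Seed i j)) → card (λ i′ → ⌊ twoEdges? i j i′ ⌋) ≤ g + k * 𝟙 ⌊ s ⌋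
      pt i j (yes _) = ≤-trans (card≤n (λ i′ → ⌊ twoEdges? i j i′ ⌋)) (≤-trans (≤-reflexive (sym (*-identityʳ k))) (m≤n+m _ g))
      pt i j (no ¬s) = ≤-trans (≤-trans (<⇒≤ (≰⇒> ¬s)) d≤g) (m≤m+n g _)

    all-tileEdges≤ : sum (λ i → sum (tileEdges i)) + sum (λ i → card (agree i)) ≤ 4 * (k * k) + 1190 * (k * g)
    all-tileEdges≤ = begin
      sum (λ i → sum (tileEdges i)) + sum (λ i → card (agree i))
        ≡⟨ sum₂-+ tileEdges (λ i i′ → 𝟙 (agree i i′)) ⟨
      sum (λ i → sum (λ i′ → tileEdges i i′ + 𝟙 (agree i i′)))
        ≤⟨ sum₂-mono tileEdges≤ ⟩
      sum (λ i → sum (λ i′ → 4 + 17 * two i i′))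
        ≡⟨ sum₂-+ (λ i i′ → 4) (λ i i′ → 17 * two i i′) ⟩
      sum {k} (λ i → sum {k} (λ i′ → 4)) + sum (λ i → sum (λ i′ → 17 * two i i′))
        ≡⟨ cong₂ _+_ (trans (sum-cong-≗ {k} (λ i → sum-const k 4)) (sum-const k (k * 4)))
             (trans (sum-cong-≗ (λ i → sym (*-distribˡ-sum 17 (two i)))) (sym (*-distribˡ-sum 17 (λ i → sum (two i))))) ⟩
      k * (k * 4) + 17 * sum (λ i → sum (two i))
        ≤⟨ +-monoʳ-≤ (k * (k * 4)) (*-monoʳ-≤ 17 twoEdges-count) ⟩
      k * (k * 4) + 17 * (70 * (k * g))
        ≡⟨ regroup k (k * g) ⟩
      4 * (k * k) + 1190 * (k * g) ∎
      where
      open ≤-Reasoning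
      two : Fin k → Fin k → ℕ
      two i i′ = card (λ j → ⌊ twoEdges? i j i′ ⌋)
      regroup : ∀ k p → k * (k * 4) + 17 * (70 * p) ≡ 4 * (k * k) + 1190 * p
      regroup = solve-∀

    backEdge : Fin n → Fin n → ℕ
    backEdge u v = 𝟙 (isPlus (cls u) ∧ isMinus (cls v) ∧ adj u v)

    backEdges : ℕ
    backEdges = sum (λ u → sum (backEdge u))

    R-size : ℕ
    R-size = sum (λ u → card (R u))

    2backEdges≤R : 2 * backEdges ≤ R-size
    2backEdges≤R = begin
      2 * backEdges
        ≡⟨ cong (backEdges +_) (trans (+-identityʳ _) (∑-comm backEdge)) ⟩
      backEdges + sum (λ u → sum (λ v → backEdge v u))
        ≡⟨ sum₂-+ backEdge (λ u v → backEdge v u) ⟨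
      sum (λ u → sum (λ v → backEdge u v + backEdge v u))
        ≤⟨ sum₂-mono (λ u v → pt (cls u) (cls v) (adj u v) (adj v u)) ⟩
      R-size ∎
      where
      open ≤-Reasoning
      pt : ∀ c c′ s t → 𝟙 (isPlus c ∧ isMinus c′ ∧ s) + 𝟙 (isPlus c′ ∧ isMinus c ∧ t) ≤ 𝟙 (back c c′ s t)
      pt plus plus _ _ = z≤n
      pt plus minus s t = ≤-reflexive (+-identityʳ (𝟙 s))
      pt plus good _ _ = z≤n
      pt plus other _ _ = z≤n
      pt minus plus _ _ = ≤-refl
      pt minus minus _ _ = z≤n
      pt minus good _ _ = z≤n
      pt minus other _ _ = z≤n
      pt good plus _ _ = z≤n
      pt good minus _ _ = z≤n
      pt good good _ _ = z≤n
      pt good other _ _ = z≤n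
      pt other plus _ _ = z≤n
      pt other minus _ _ = z≤n
      pt other good _ _ = z≤n
      pt other other _ _ = z≤n

    tiledEdges : ℕ
    tiledEdges = sum (λ u → sum (λ v → 𝟙 (isTiled u) * (𝟙 (isTiled v) * 𝟙 (R u v))))

    tiledEdges≤ : tiledEdges ≤ sum (λ i → sum (tileEdges i))
    tiledEdges≤ = begin
      tiledEdges
        ≡⟨ sum-cong-≗ (λ u → *-distribˡ-sum (𝟙 (isTiled u)) (λ v → 𝟙 (isTiled v) * 𝟙 (R u v))) ⟨
      sum (λ u → 𝟙 (isTiled u) * row u)
        ≤⟨ DoubleFamily.sum≤sum₂ φ (λ u → 𝟙 (isTiled u) * row u) (λ u h → cover u (row u) (tiled? u) h) ⟩
      sum (λ i → sum (λ j → 𝟙 (isTiled (φ i j)) * row (φ i j)))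
        ≤⟨ sum₂-mono (λ i j → ≤-trans (*-monoˡ-≤ (row (φ i j)) (𝟙≤1 (isTiled (φ i j)))) (≤-reflexive (*-identityˡ _))) ⟩
      sum (λ i → sum (λ j → row (φ i j)))
        ≤⟨ sum₂-mono {f = λ i j → row (φ i j)} {g = λ i j → sum (λ i′ → card (λ j′ → R (φ i j) (φ i′ j′)))} (λ i j → ≤-trans (DoubleFamily.sum≤sum₂ φ (λ v → 𝟙 (isTiled v) * 𝟙 (R (φ i j) v))
               (λ v h → cover v (𝟙 (R (φ i j) v)) (tiled? v) h))
             (sum₂-mono {f = λ i′ j′ → 𝟙 (isTiled (φ i′ j′)) * 𝟙 (R (φ i j) (φ i′ j′))} {g = λ i′ j′ → 𝟙 (R (φ i j) (φ i′ j′))}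
               (λ i′ j′ → ≤-trans (*-monoˡ-≤ (𝟙 (R (φ i j) (φ i′ j′))) (𝟙≤1 (isTiled (φ i′ j′)))) (≤-reflexive (*-identityˡ _))))) ⟩
      sum (λ i → sum (λ j → sum (λ i′ → sum (λ j′ → 𝟙 (R (φ i j) (φ i′ j′))))))
        ≡⟨ sum-cong-≗ (λ i → ∑-comm (λ j i′ → card (λ j′ → R (φ i j) (φ i′ j′)))) ⟩
      sum (λ i → sum (tileEdges i)) ∎
      where
      open ≤-Reasoning
      row : Fin n → ℕ
      row u = sum (λ v → 𝟙 (isTiled v) * 𝟙 (R u v))
      cover : ∀ v m (t : Dec (Tiled v)) → 𝟙 ⌊ t ⌋ * m ≢ 0 → Tiled v
      cover v m (yes t) _ = t
      cover v m (no _) h = ⊥-elim (h refl)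

    -- A pair with an uncovered end is charged to that end: `n` pairs for each of at most `66g`
    -- vertices, in either position.
    R-size≤ : R-size ≤ sum (λ i → sum (tileEdges i)) + 132 * (g * n)
    R-size≤ = begin
      R-size
        ≤⟨ sum₂-mono (λ u v → pt (isTiled u) (isTiled v) (R u v)) ⟩
      sum (λ u → sum (λ v → 𝟙 (isTiled u) * (𝟙 (isTiled v) * 𝟙 (R u v)) + (𝟙 (not (isTiled u)) * 1 + 1 * 𝟙 (not (isTiled v)))))
        ≡⟨ trans (sum₂-+ (λ u v → 𝟙 (isTiled u) * (𝟙 (isTiled v) * 𝟙 (R u v))) (λ u v → 𝟙 (not (isTiled u)) * 1 + 1 * 𝟙 (not (isTiled v))))
             (cong (tiledEdges +_) (trans (sum₂-+ (λ u v → 𝟙 (not (isTiled u)) * 1) (λ u v → 1 * 𝟙 (not (isTiled v))))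
               (cong₂ _+_ (sum-product (𝟙 ∘ not ∘ isTiled) (λ (v : Fin n) → 1)) (sum-product (λ (u : Fin n) → 1) (𝟙 ∘ not ∘ isTiled))))) ⟩
      tiledEdges + (card (not ∘ isTiled) * sum {n} (λ _ → 1) + sum {n} (λ _ → 1) * card (not ∘ isTiled))
        ≤⟨ +-mono-≤ tiledEdges≤ (+-mono-≤ (*-mono-≤ untiled≤66g (≤-reflexive ones)) (*-mono-≤ (≤-reflexive ones) untiled≤66g)) ⟩
      sum (λ i → sum (tileEdges i)) + (66 * g * n + n * (66 * g))
        ≡⟨ cong (sum (λ i → sum (tileEdges i)) +_) (regroup g n) ⟩
      sum (λ i → sum (tileEdges i)) + 132 * (g * n) ∎
      where
      open ≤-Reasoning
      ones : sum {n} (λ _ → 1) ≡ n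
      ones = trans (sum-const n 1) (*-identityʳ n)
      regroup : ∀ g n → 66 * g * n + n * (66 * g) ≡ 132 * (g * n)
      regroup = solve-∀
      pt : ∀ s t r → 𝟙 r ≤ 𝟙 s * (𝟙 t * 𝟙 r) + (𝟙 (not s) * 1 + 1 * 𝟙 (not t))
      pt true true true = s≤s z≤n
      pt true false true = s≤s z≤n
      pt false _ true = s≤s z≤n
      pt _ _ false = z≤n

    minus-degree : card (isMinus ∘ cls) * n ≤ card (isMinus ∘ cls) * card (isMinus ∘ cls) +
      2 * (card (isMinus ∘ cls) * (card (isGood ∘ cls) + card (isOther ∘ cls)) + backEdges) + 2 * g * card (isMinus ∘ cls)
    minus-degree = subst
      (λ z → card (isMinus ∘ cls) * n ≤ card (isMinus ∘ cls) * card (isMinus ∘ cls) +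
        2 * (card (isMinus ∘ cls) * z + backEdges) + 2 * g * card (isMinus ∘ cls))
      (∑-distrib-+ (𝟙 ∘ isGood ∘ cls) (𝟙 ∘ isOther ∘ cls))
      (DegreeCount.degree-bound adj adj-antisym g indegree (isMinus ∘ cls)
        (λ u → 𝟙 (isGood (cls u)) + 𝟙 (isOther (cls u))) backEdge (λ v u → pt (cls v) (cls u) (adj u v)))
      where
      pt : ∀ c c′ t → 𝟙 (isMinus c) * 𝟙 t ≤
           𝟙 (isMinus c) * 𝟙 (isMinus c′) * 𝟙 t + 𝟙 (isMinus c) * (𝟙 (isGood c′) + 𝟙 (isOther c′)) + 𝟙 (isPlus c′ ∧ isMinus c ∧ t)
      pt plus _ _ = z≤n
      pt good _ _ = z≤n
      pt other _ _ = z≤n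
      pt minus _ false = z≤n
      pt minus plus true = s≤s z≤n
      pt minus minus true = s≤s z≤n
      pt minus good true = s≤s z≤n
      pt minus other true = s≤s z≤n

    minus+plus≤n : card (isMinus ∘ cls) + card (isPlus ∘ cls) ≤ n
    minus+plus≤n = subst₂ _≤_ (∑-distrib-+ (𝟙 ∘ isMinus ∘ cls) (𝟙 ∘ isPlus ∘ cls)) (trans (sum-const n 1) (*-identityʳ n))
      (sum-mono λ v → pt (cls v))
      where
      pt : ∀ c → 𝟙 (isMinus c) + 𝟙 (isPlus c) ≤ 1
      pt plus = ≤-refl
      pt minus = ≤-refl
      pt good = z≤n
      pt other = z≤n

    n≤23640g : k * 4 ≤ n → .{{NonZero n}} → n ≤ 23640 * g
    n≤23640g 4k≤n = few-vertices {n} {backEdges} {sum (λ i → sum (tileEdges i))} {R-size} {g}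
      (many-back-edges {n} {card (isMinus ∘ cls)} {card (isPlus ∘ cls)} {card (isGood ∘ cls)} {card (isOther ∘ cls)} {backEdges} {g}
        minus-large plus-large minus+plus≤n good≤22g other≤2g minus-degree)
      2backEdges≤R R-size≤
      (few-edges-between-tiles {n} {k} {sum (λ i → sum (tileEdges i))} {sum (λ i → card (agree i))} {g} 4k≤n
        all-tileEdges≤ (agreeing-pairs (λ i → tileType (cls ∘ φ i))))

  -- Transitive sequences and the choice of a block

  allPairs-lookup-< : ∀ {a r} {A : Set a} {R : A → A → Set r} {xs} → AllPairs R xs →
                      ∀ {i j} → i <F j → R (lookup xs i) (lookup xs j)
  allPairs-lookup-< (r ∷ _) {zero} {suc j} _ = All.lookup r (∈-lookup j)
  allPairs-lookup-< (_ ∷ rs) {suc i} {suc j} (s≤s i<j) = allPairs-lookup-< rs i<j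

  module _ {n : ℕ} (G : Tournament n) where

    -- One of the two neighbourhoods of a vertex keeps about half of the set. The vertex goes in
    -- front of a sequence found among its out-neighbours, or behind one found among its
    -- in-neighbours.
    transitive-list : ∀ K (p : Fin n → Bool) → 2 ^ K ≤ card p →
      ∃ λ xs → length xs ≡ K × All (λ x → p x ≡ true) xs × AllPairs (Edge G) xs
    transitive-list zero p h = [] , refl , [] , []
    transitive-list (suc K) p h = choose (sum-Fin⁻ (≤-trans (m^n>0 2 (suc K)) h))
      where
      Result : Set
      Result = ∃ λ xs → length xs ≡ suc K × All (λ x → p x ≡ true) xs × AllPairs (Edge G) xs
      choose : (∃ λ v → 0 < 𝟙 (p v)) → Result
      choose (v , pos) = split (2 ^ K ≤? card out)
        where
        pv : p v ≡ true
        pv = go (p v) pos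
          where
          go : ∀ b → 0 < 𝟙 b → b ≡ true
          go true _ = refl
        out into : Fin n → Bool
        out x = p x ∧ adj G v x
        into x = p x ∧ adj G x v
        pt : ∀ x → 𝟙 (p x) ≤ 𝟙 (x == v) + 𝟙 (out x) + 𝟙 (into x)
        pt x = go (p x) (x Fin.≟ v)
          where
          go : ∀ b (e : Dec (x ≡ v)) → 𝟙 b ≤ 𝟙 ⌊ e ⌋ + 𝟙 (b ∧ adj G v x) + 𝟙 (b ∧ adj G x v)
          go false _ = z≤n
          go true (yes _) = s≤s z≤n
          go true (no x≢v) = [ (λ e → subst (λ b → 1 ≤ 𝟙 b + 𝟙 (adj G x v)) (sym e) (s≤s z≤n)) ,
                               (λ e → subst (λ b → 1 ≤ 𝟙 (adj G v x) + 𝟙 b) (sym e) (m≤n+m 1 (𝟙 (adj G v x)))) ]′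
                             (total G v x (x≢v ∘ sym))
        card≤ : card p ≤ 1 + card out + card into
        card≤ = ≤-trans (sum-mono pt) (≤-reflexive (trans (∑-+₃ (λ x → 𝟙 (x == v)) (𝟙 ∘ out) (𝟙 ∘ into))
          (cong (λ z → z + card out + card into)
            (trans (sum-single {f = λ x → 𝟙 (x == v)} v (λ x x≢ → cong 𝟙 (==-≢ x≢))) (cong 𝟙 (==-refl v))))))
        split : Dec (2 ^ K ≤ card out) → Result
        split (yes many) =
          let xs , len , ps , es = transitive-list K out many
          in v ∷ xs , cong suc len , pv ∷ All.map (proj₁ ∘ ∧-true) ps , All.map (proj₂ ∘ ∧-true) ps ∷ es
        split (no few) =
          let xs , len , ps , es = transitive-list K into many
          in xs ++ v ∷ [] , trans (length-++ xs) (trans (+-comm (length xs) 1) (cong suc len)) ,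
             All.++⁺ (All.map (proj₁ ∘ ∧-true) ps) (pv ∷ []) ,
             AllPairs.++⁺ es ([] ∷ []) (All.map (λ e → proj₂ (∧-true e) ∷ []) ps)
          where
          many : 2 ^ K ≤ card into
          many = +-cancelˡ-≤ (2 ^ K) _ _ (≤-trans (≤-reflexive (sym (cong (2 ^ K +_) (+-identityʳ _))))
            (≤-trans h (≤-trans card≤ (+-monoˡ-≤ (card into) (≰⇒> few)))))

    -- `combine` orders pairs lexicographically, so the blocks are consecutive intervals of a single
    -- transitive sequence.
    transitive-blocks : ∀ q w (p : Fin n → Bool) → 2 ^ (q * w) ≤ card p →
      ∃ λ (L : Fin q → Fin w → Fin n) → (∀ i a → p (L i a) ≡ true) ×
        (∀ i a b → L i a ≡ L i b → a ≡ b) × (∀ i j a b → i <F j → Edge G (L i a) (L j b))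
    transitive-blocks q w p h = build (sequence (transitive-list (q * w) p h))
      where
      Seq : ℕ → Set
      Seq K = ∃ λ (s : Fin K → Fin n) → (∀ i → p (s i) ≡ true) × (∀ {i j} → i <F j → Edge G (s i) (s j))
      sequence : (∃ λ xs → length xs ≡ q * w × All (λ x → p x ≡ true) xs × AllPairs (Edge G) xs) → Seq (q * w)
      sequence (xs , len , ps , es) = subst Seq len
        (lookup xs , (λ i → All.lookup ps (∈-lookup i)) , allPairs-lookup-< es)
      build : Seq (q * w) → _
      build (s , ps , es) = (λ i a → s (combine i a)) , (λ i a → ps (combine i a)) ,
        (λ i a b e → proj₂ (Fin.combine-injective i a i b (injective (combine i a) (combine i b) e))) ,
        (λ i j a b i<j → es (Fin.combine-monoˡ-< a b i<j))
        where
        injective : ∀ x y → s x ≡ s y → x ≡ y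
        injective x y e = go (Fin.<-cmp x y)
          where
          go : Tri (x <F y) (x ≡ y) (y <F x) → x ≡ y
          go (tri< lt _ _) = ⊥-elim (edge⇒≢ G (es lt) e)
          go (tri≈ _ eq _) = eq
          go (tri> _ _ gt) = ⊥-elim (edge⇒≢ G (es gt) (sym e))

  module ChooseBlock {n : ℕ} (G : Tournament n) (q w h : ℕ) (3h≤w : h + h + h ≤ w)
    (L : Fin q → Fin w → Fin n)
    (L-injective : ∀ i a b → L i a ≡ L i b → a ≡ b)
    (L-edge : ∀ i j a b → i <F j → Edge G (L i a) (L j b))
    (g : ℕ) (1≤n : 1 ≤ n) (n≤qg : n ≤ q * g) (qw≤g : q * w ≤ g) (w≡qh : w ≡ q * h) (1≤h : 1 ≤ h)
    (indegree : ∀ v → n ≤ 2 * sum (λ u → 𝟙 (adj G u v)) + 2 * g)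
    (outdegree : ∀ v → n ≤ 2 * sum (λ u → 𝟙 (adj G v u)) + 2 * g)
    where

    open Blocks G q w h 3h≤w L L-injective L-edge

    mixed : Fin n → Fin q → Bool
    mixed x i = ⌊ ¬? (good? x) ×-dec (h ≤? outN x i) ×-dec (h ≤? inN x i) ⌋

    mixed⇒Mixed : ∀ {x i} → mixed x i ≡ true → Mixed x i
    mixed⇒Mixed {x} {i} = ⌊⌋-true (¬? (good? x) ×-dec (h ≤? outN x i) ×-dec (h ≤? inN x i))

    mixed-total : sum (λ i → card (λ x → mixed x i)) ≤ n
    mixed-total = ≤-trans (≤-reflexive (∑-comm (λ i x → 𝟙 (mixed x i))))
      (≤-trans (sum-bound 1 (λ x → at-most-one x (Fin.any? λ i → mixed x i Bool.≟ true))) (≤-reflexive (*-identityʳ n)))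
      where
      at-most-one : ∀ x → Dec (∃ λ i → mixed x i ≡ true) → card (mixed x) ≤ 1
      at-most-one x (no ¬m) = ≤-trans (≤-reflexive (sum-0 {f = 𝟙 ∘ mixed x} (λ i → cong 𝟙 (Bool.¬-not (λ e → ¬m (i , e)))))) z≤n
      at-most-one x (yes (i , e)) = ≤-trans (≤-reflexive (sum-single {f = 𝟙 ∘ mixed x} i
        (λ j j≢ → cong 𝟙 (Bool.¬-not (λ e′ → j≢ (mixed-unique x j i (mixed⇒Mixed e′) (mixed⇒Mixed e))))))) (𝟙≤1 _)

    -- A vertex is mixed for at most one block, so by averaging over `q` blocks with `n ≤ q * g`
    -- some block has at most `g` mixed vertices.
    unmixed-block : ∃ λ i → card (λ x → mixed x i) ≤ g
    unmixed-block = decide (Fin.any? λ i → card (λ x → mixed x i) ≤? g)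
      where
      -- The strict inequality needs at least one block; `1 ≤ n` rules out `q = 0`.
      nonempty : ∀ q → n ≤ q * g → n < q * suc g
      nonempty zero h = ⊥-elim (<⇒≱ 1≤n h)
      nonempty (suc q) h = ≤-<-trans h (*-monoʳ-< (suc q) (n<1+n g))
      decide : Dec (∃ λ i → card (λ x → mixed x i) ≤ g) → ∃ λ i → card (λ x → mixed x i) ≤ g
      decide (yes i) = i
      decide (no ¬i) = ⊥-elim (<⇒≱ (nonempty q n≤qg) (≤-trans
        (subst (_≤ sum (λ i → card (λ x → mixed x i))) (sum-const q (suc g)) (sum-mono (λ i → ≰⇒> (λ c → ¬i (i , c)))))
        mixed-total))

    i₀ : Fin q
    i₀ = proj₁ unmixed-block

    open Classify i₀ public

    onL-size : card (λ x → ⌊ onL? x ⌋) ≤ g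
    onL-size = ≤-trans (≤-trans (sum-mono pt) (≤-reflexive (trans
        (sum-cong-≗ {x = fibre₂} (λ v → sym (*-identityʳ (fibre₂ v))))
        (trans (sym (sum-fibre₂ (λ _ → 1))) (trans (sum-cong-≗ {q} (λ i → trans (sum-const w 1) (*-identityʳ w))) (sum-const q w))))))
      qw≤g
      where
      open DoubleFamily L
      pt : ∀ x → 𝟙 ⌊ onL? x ⌋ ≤ fibre₂ x
      pt x = 𝟙-⌊⌋ (onL? x) λ (i , a , e) → subst (λ z → 1 ≤ fibre₂ z) e (fibre₂-image i a)

    other≤2g : card (isOther ∘ cls) ≤ 2 * g
    other≤2g = ≤-trans (sum-mono pt) (≤-trans (≤-reflexive (∑-distrib-+ (λ x → 𝟙 ⌊ onL? x ⌋) (λ x → 𝟙 (mixed x i₀))))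
      (≤-trans (+-mono-≤ onL-size (proj₂ unmixed-block)) (≤-reflexive (cong (g +_) (sym (+-identityʳ g))))))
      where
      pt : ∀ x → 𝟙 (isOther (cls x)) ≤ 𝟙 ⌊ onL? x ⌋ + 𝟙 (mixed x i₀)
      pt x = go (cls x) refl
        where
        go : ∀ c → cls x ≡ c → 𝟙 (isOther c) ≤ 𝟙 ⌊ onL? x ⌋ + 𝟙 (mixed x i₀)
        go plus _ = z≤n
        go minus _ = z≤n
        go good _ = z≤n
        go other e = [ (λ l → ≤-trans (≤-reflexive (sym (cong 𝟙 (⌊⌋-yes (onL? x) l)))) (m≤m+n _ _)) ,
                       (λ m → ≤-trans (≤-reflexive (sym (cong 𝟙 (⌊⌋-yes (¬? (good? x) ×-dec (h ≤? outN x i₀) ×-dec (h ≤? inN x i₀)) m)))) (m≤n+m _ _)) ]′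
                     (cls-other x e)

    w>0 : NonZero w
    w>0 = >-nonZero (≤-trans (≤-trans 1≤h (≤-trans (m≤m+n h h) (m≤m+n (h + h) h))) 3h≤w)

    -- Averaging the degrees of the vertices of the chosen block, almost all of whose edges are dictated by the classes.
    side-large : (A : Fin n → Fin n → Bool) (s : Fin n → Bool) →
      (∀ v → n ≤ 2 * sum (λ u → 𝟙 (A u v)) + 2 * g) →
      (∀ u → s u ≡ false → isGood (cls u) ≡ false → isOther (cls u) ≡ false → card (λ a → A u (L i₀ a)) < h) →
      n ≤ 2 * (card s + card (isGood ∘ cls)) + 8 * g
    side-large A s degree sparse = *-cancelˡ-≤ w ⦃ w>0 ⦄ (begin
      w * n
        ≡⟨ sum-const w n ⟨
      sum {w} (λ a → n)
        ≤⟨ sum-mono (λ a → degree (L i₀ a)) ⟩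
      sum (λ a → 2 * column a + 2 * g)
        ≡⟨ trans (∑-distrib-+ (λ a → 2 * column a) (λ a → 2 * g)) (cong₂ _+_ (sym (*-distribˡ-sum 2 column)) (sum-const w (2 * g))) ⟩
      2 * sum column + w * (2 * g)
        ≡⟨ cong (λ z → 2 * z + w * (2 * g)) (∑-comm (λ a u → 𝟙 (A u (L i₀ a)))) ⟩
      2 * sum (λ u → card (λ a → A u (L i₀ a))) + w * (2 * g)
        ≤⟨ +-monoˡ-≤ (w * (2 * g)) (*-monoʳ-≤ 2 (sum-mono pt)) ⟩
      2 * sum (λ u → w * (𝟙 (s u) + 𝟙 (isGood (cls u)) + 𝟙 (isOther (cls u))) + h) + w * (2 * g)
        ≡⟨ cong (λ z → 2 * z + w * (2 * g)) (trans (∑-distrib-+ (λ u → w * (𝟙 (s u) + 𝟙 (isGood (cls u)) + 𝟙 (isOther (cls u)))) (λ u → h))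
             (cong₂ _+_ (trans (sym (*-distribˡ-sum w (λ u → 𝟙 (s u) + 𝟙 (isGood (cls u)) + 𝟙 (isOther (cls u)))))
               (cong (w *_) (∑-+₃ (𝟙 ∘ s) (𝟙 ∘ isGood ∘ cls) (𝟙 ∘ isOther ∘ cls)))) (sum-const n h))) ⟩
      2 * (w * (card s + card (isGood ∘ cls) + card (isOther ∘ cls)) + n * h) + w * (2 * g)
        ≤⟨ +-monoˡ-≤ (w * (2 * g)) (*-monoʳ-≤ 2 (+-mono-≤ (*-monoʳ-≤ w (+-monoʳ-≤ (card s + card (isGood ∘ cls)) other≤2g)) nh≤wg)) ⟩
      2 * (w * (card s + card (isGood ∘ cls) + 2 * g) + w * g) + w * (2 * g)
        ≡⟨ regroup w (card s + card (isGood ∘ cls)) g ⟩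
      w * (2 * (card s + card (isGood ∘ cls)) + 8 * g) ∎)
      where
      open ≤-Reasoning
      column : Fin w → ℕ
      column a = sum (λ u → 𝟙 (A u (L i₀ a)))
      regroup : ∀ w x g → 2 * (w * (x + 2 * g) + w * g) + w * (2 * g) ≡ w * (2 * x + 8 * g)
      regroup = solve-∀
      swap : ∀ q g h → q * g * h ≡ q * h * g
      swap = solve-∀
      -- A vertex classified to the opposite side adds fewer than `h` edges; in total this stays
      -- below `w * g`, because a block is `q` times as long as `h`.
      nh≤wg : n * h ≤ w * g
      nh≤wg = ≤-trans (*-monoˡ-≤ h n≤qg) (≤-reflexive (trans (swap q g h) (cong (_* g) (sym w≡qh))))
      pt : ∀ u → card (λ a → A u (L i₀ a)) ≤ w * (𝟙 (s u) + 𝟙 (isGood (cls u)) + 𝟙 (isOther (cls u))) + h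
      pt u = go (s u) (isGood (cls u)) (isOther (cls u)) refl refl refl
        where
        full : ∀ m → card (λ a → A u (L i₀ a)) ≤ w * suc m + h
        full m = ≤-trans (card≤n (λ a → A u (L i₀ a))) (≤-trans (m≤m*n w (suc m)) (m≤m+n _ h))
        go : ∀ x y z → s u ≡ x → isGood (cls u) ≡ y → isOther (cls u) ≡ z →
             card (λ a → A u (L i₀ a)) ≤ w * (𝟙 x + 𝟙 y + 𝟙 z) + h
        go true y z _ _ _ = full (𝟙 y + 𝟙 z)
        go false true z _ _ _ = full (𝟙 z)
        go false false true _ _ _ = full 0
        go false false false es eg eo = ≤-trans (<⇒≤ (sparse u es eg eo)) (m≤n+m h _)

    minus-large : n ≤ 2 * (card (isMinus ∘ cls) + card (isGood ∘ cls)) + 8 * g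
    minus-large = side-large (adj G) (isMinus ∘ cls) indegree λ u em eg eo → go u (cls u) refl em eg eo
      where
      go : ∀ u c → cls u ≡ c → isMinus c ≡ false → isGood c ≡ false → isOther c ≡ false → outN u i₀ < h
      go u plus e _ _ _ = proj₂ (cls-plus u e)

    plus-large : n ≤ 2 * (card (isPlus ∘ cls) + card (isGood ∘ cls)) + 8 * g
    plus-large = side-large (λ u v → adj G v u) (isPlus ∘ cls) outdegree λ u em eg eo → go u (cls u) refl em eg eo
      where
      go : ∀ u c → cls u ≡ c → isPlus c ≡ false → isGood c ≡ false → isOther c ≡ false → inN u i₀ < h
      go u minus e _ _ _ = proj₂ (cls-minus u e)

  -- Parameters

  quotient : ∀ H n → .{{NonZero H}} → ∃ λ q → H * q ≤ n × n < H * suc q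
  quotient H n = n / H ,
    subst (H * (n / H) ≤_) (sym n≡) (≤-trans (≤-reflexive (*-comm H (n / H))) (m≤n+m _ (n % H))) ,
    subst₂ _<_ (sym n≡) (trans (cong (H +_) (*-comm (n / H) H)) (sym (*-suc H (n / H)))) (+-monoˡ-< ((n / H) * H) (m%n<n n H))
    where
    n≡ : n ≡ n % H + (n / H) * H
    n≡ = m≡m%n+[m/n]*n n H

  module Parameters (H : ℕ) where

    -- None of these depends on `n`. `levels` exceeds `n / d`, `bound` limits the resources of one
    -- exchange, `h` has room for four vertices for each of them, and `leftover₀` is the Ramsey
    -- bound for a transitive sequence of `H` blocks.
    levels bound h w leftover₀ d₀ : ℕ
    levels = 2 * (H * H)
    bound = 4 + (levels + levels)
    h = 4 + bound * 4
    w = H * h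
    leftover₀ = 2 ^ (H * w)
    d₀ = bound * 4

    size₀ : ℕ
    size₀ = H * (H * suc d₀ + H * w + 1)

    -- The unit g of all error terms is about n / H; the threshold d is about n / H².
    record Scale (n : ℕ) : Set where
      field
        g d   : ℕ
        n≤Hg  : n ≤ H * g
        Hg≤2n : H * g ≤ 2 * n
        Hw≤g  : H * w ≤ g
        Hd≤g  : H * d ≤ g
        d₀<d  : d₀ < d
        g<Hd′ : g < H * suc d

    scale : .{{NonZero H}} → ∀ n → n ≥ size₀ → Scale n
    scale n n≥ =
      let q , Hq≤n , n<Hq′ = quotient H n
          d , Hd≤g , g<Hd′ = quotient H (suc q)
      in build q d Hq≤n n<Hq′ Hd≤g g<Hd′
      where
      build : ∀ q d → H * q ≤ n → n < H * suc q → H * d ≤ suc q → suc q < H * suc d → Scale n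
      build q d Hq≤n n<Hq′ Hd≤g g<Hd′ = record
        -- Taking one more than the quotient ensures `n ≤ H * g`; the additional `H ≤ n` still fits
        -- into `H * g ≤ 2 * n`.
        { g = suc q ; d = d ; n≤Hg = <⇒≤ n<Hq′
        ; Hg≤2n = ≤-trans (≤-reflexive (*-suc H q)) (≤-trans (+-mono-≤ H≤n Hq≤n) (≤-reflexive (cong (n +_) (sym (+-identityʳ n)))))
        ; Hw≤g = ≤-trans (m≤n+m (H * w) (H * suc d₀)) (≤-trans (m≤m+n _ 1) (<⇒≤ large))
        ; Hd≤g = Hd≤g
        ; d₀<d = s≤s⁻¹ (*-cancelˡ-< H (suc d₀) (suc d) (<-trans (≤-<-trans (≤-trans (m≤m+n (H * suc d₀) (H * w)) (m≤m+n _ 1)) large) g<Hd′))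
        ; g<Hd′ = g<Hd′
        }
        where
        large : H * suc d₀ + H * w + 1 < suc q
        large = *-cancelˡ-< H _ _ (≤-<-trans n≥ n<Hq′)
        H≤n : H ≤ n
        H≤n = ≤-trans (≤-trans (≤-reflexive (sym (*-identityʳ H))) (*-monoʳ-≤ H (m≤n+m 1 (H * suc d₀ + H * w)))) n≥

    module _ {n : ℕ} (G : Tournament n) {k : ℕ} (T : DTiling G k) (maximal : ¬ DTiling G (suc k)) where
      open DTiling T using (φ)

      private
        φ-injective = Tilings.φ-injective G T

      tiledBy? : ∀ v → Dec (∃ λ i → ∃ λ j → φ i j ≡ v)
      tiledBy? v = Fin.any? λ i → Fin.any? λ j → φ i j Fin.≟ v

      uncovered : Fin n → Bool
      uncovered v = not ⌊ tiledBy? v ⌋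

      uncovered⇒ : ∀ {v} → uncovered v ≡ true → ¬ (∃ λ i → ∃ λ j → φ i j ≡ v)
      uncovered⇒ {v} e t = go (tiledBy? v) e
        where
        go : (t? : Dec (∃ λ i → ∃ λ j → φ i j ≡ v)) → not ⌊ t? ⌋ ≡ true → ⊥
        go (no ¬t) _ = ¬t t

      n≤4k+uncovered : n ≤ 4 * k + card uncovered
      n≤4k+uncovered = begin
        n
          ≡⟨ trans (sum-const n 1) (*-identityʳ n) ⟨
        sum {n} (λ _ → 1)
          ≤⟨ sum-mono (λ v → pt (tiledBy? v)) ⟩
        sum (λ v → 𝟙 ⌊ tiledBy? v ⌋ + 𝟙 (uncovered v))
          ≡⟨ ∑-distrib-+ (λ v → 𝟙 ⌊ tiledBy? v ⌋) (𝟙 ∘ uncovered) ⟩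
        card (λ v → ⌊ tiledBy? v ⌋) + card uncovered
          ≤⟨ +-monoˡ-≤ (card uncovered) (≤-trans
               (DoubleFamily.sum≤sum₂ φ (λ v → 𝟙 ⌊ tiledBy? v ⌋) (λ v → cover (tiledBy? v)))
               (sum-bound 4 (λ i → card≤n (λ j → ⌊ tiledBy? (φ i j) ⌋)))) ⟩
        k * 4 + card uncovered
          ≡⟨ cong (_+ card uncovered) (*-comm k 4) ⟩
        4 * k + card uncovered ∎
        where
        open ≤-Reasoning
        pt : ∀ {v} (t : Dec (∃ λ i → ∃ λ j → φ i j ≡ v)) → 1 ≤ 𝟙 ⌊ t ⌋ + 𝟙 (not ⌊ t ⌋)
        pt (yes _) = ≤-refl
        pt (no _) = ≤-refl
        cover : ∀ {v} (t : Dec (∃ λ i → ∃ λ j → φ i j ≡ v)) → 𝟙 ⌊ t ⌋ ≢ 0 → ∃ λ i → ∃ λ j → φ i j ≡ v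
        cover (yes t) _ = t
        cover (no _) h = ⊥-elim (h refl)

      module _ (3≤H : 3 ≤ H) (1≤n : 1 ≤ n) (S : Scale n)
        (indegree : ∀ v → n ≤ 2 * sum (λ u → 𝟙 (adj G u v)) + 2 * Scale.g S)
        (outdegree : ∀ v → n ≤ 2 * sum (λ u → 𝟙 (adj G v u)) + 2 * Scale.g S)
        where
        open Scale S

        many-uncovered⇒small : leftover₀ ≤ card uncovered → n ≤ 23640 * g
        many-uncovered⇒small many = from-blocks (transitive-blocks G H w uncovered many)
          where
          1≤H : 1 ≤ H
          1≤H = ≤-trans (s≤s z≤n) 3≤H
          d≤g : d ≤ g
          d≤g = ≤-trans (m≤n*m d H ⦃ >-nonZero 1≤H ⦄) Hd≤g
          1≤d : 1 ≤ d
          1≤d = ≤-trans (s≤s z≤n) d₀<d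
          swap : ∀ H g d → H * g * d ≡ g * (H * d)
          swap = solve-∀
          nd≤gg : n * d ≤ g * g
          nd≤gg = ≤-trans (*-monoˡ-≤ d n≤Hg) (≤-trans (≤-reflexive (swap H g d)) (*-monoʳ-≤ g Hd≤g))
          double : ∀ H d → H * (H * (d + d)) ≡ 2 * (H * H) * d
          double = solve-∀
          n<Md : n < levels * d
          n<Md = ≤-<-trans n≤Hg (<-≤-trans (*-monoʳ-< H ⦃ >-nonZero 1≤H ⦄ g<Hd′)
            (≤-trans (*-monoʳ-≤ H (*-monoʳ-≤ H (+-monoˡ-≤ d 1≤d))) (≤-reflexive (double H d))))
          3h≤w : h + h + h ≤ w
          3h≤w = ≤-trans (≤-reflexive (triple h)) (*-monoˡ-≤ h 3≤H)
            where
            triple : ∀ h → h + h + h ≡ 3 * h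
            triple = solve-∀
          adj-antisym : ∀ u v → 𝟙 (adj G u v) + 𝟙 (adj G v u) ≤ 1
          adj-antisym u v = go (adj G u v) refl
            where
            go : ∀ b → adj G u v ≡ b → 𝟙 b + 𝟙 (adj G v u) ≤ 1
            go true e = ≤-reflexive (cong (λ b → suc (𝟙 b)) (antisym G u v e))
            go false _ = 𝟙≤1 _
          from-blocks : (∃ λ (L : Fin H → Fin w → Fin n) → (∀ i a → uncovered (L i a) ≡ true) ×
            (∀ i a b → L i a ≡ L i b → a ≡ b) × (∀ i j a b → i <F j → Edge G (L i a) (L j b))) → n ≤ 23640 * g
          from-blocks (L , L-uncovered , L-injective , L-edge) =
            Endgame.n≤23640g φ φ-injective cls (adj G) d levels bound d₀<d ≤-refl
              (λ Q Rs Rs# cells lt short → maximal (augment T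
                (λ { i j (b , a , e) → uncovered⇒ (L-uncovered b a) (i , j , sym e) }) Q Rs Rs# cells lt
                (s≤s (s≤s (≤-trans (*-monoˡ-≤ 4 short) (m≤n+m _ 2))))))
              adj-antisym g indegree outdegree (≤-trans 1≤d d≤g) d≤g nd≤gg n<Md other≤2g minus-large plus-large
              (Tilings.tiling-size G T) ⦃ >-nonZero 1≤n ⦄
            where
            open ChooseBlock G H w h 3h≤w L L-injective L-edge g 1≤n n≤Hg Hw≤g refl (s≤s z≤n) indegree outdegree

    -- The degree hypotheses are `deg ≥ (1/2 - 1/H) n` with denominators cleared.
    almost-perfect : 47280 < H → ∀ {n} (G : Tournament n) → n ≥ size₀ → 1 ≤ n →
      (∀ v → H * n ≤ 2 * (H * indeg G v) + 2 * n) → (∀ v → H * n ≤ 2 * (H * outdeg G v) + 2 * n) →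
      ∃ λ k → DTiling G k × n ≤ 4 * k + leftover₀
    almost-perfect H-large {n} G n≥ 1≤n ins outs = from-maximal (Tilings.maximal-tiling G)
      where
      1≤H : 1 ≤ H
      1≤H = ≤-trans (s≤s z≤n) H-large
      instance
        H≢0 : NonZero H
        H≢0 = >-nonZero 1≤H
      S : Scale n
      S = scale n n≥
      from-maximal : (∃ λ k → DTiling G k × ¬ DTiling G (suc k)) → ∃ λ k → DTiling G k × n ≤ 4 * k + leftover₀
      from-maximal (k , T , ¬T) = k , T , ≤-trans (n≤4k+uncovered G T ¬T) (+-monoʳ-≤ (4 * k) (<⇒≤ few))
        where
        open Scale S using (g; n≤Hg; Hg≤2n)
        regroup : ∀ H x g → 2 * (H * x) + 2 * (H * g) ≡ H * (2 * x + 2 * g)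
        regroup = solve-∀
        degree : ∀ {x} → H * n ≤ 2 * (H * x) + 2 * n → n ≤ 2 * x + 2 * g
        degree {x} h = *-cancelˡ-≤ H (≤-trans h (≤-trans (+-monoʳ-≤ (2 * (H * x)) (*-monoʳ-≤ 2 n≤Hg)) (≤-reflexive (regroup H x g))))
        g>0 : 0 < g
        g>0 = ≰⇒> λ g≤0 → <⇒≱ 1≤n (≤-trans n≤Hg (≤-trans (*-monoʳ-≤ H g≤0) (≤-reflexive (*-zeroʳ H))))
        few : card (uncovered G T ¬T) < leftover₀
        -- Otherwise `H * g ≤ 2n ≤ 2 * 23640 * g = 47280 * g`, contradicting `47280 < H`.
        few = ≰⇒> λ many → <⇒≱ (*-monoˡ-< g ⦃ >-nonZero g>0 ⦄ H-large) (≤-trans Hg≤2n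
          (≤-trans (*-monoʳ-≤ 2 (many-uncovered⇒small G T ¬T (≤-trans (s≤s (s≤s (s≤s z≤n))) H-large) 1≤n S
            (λ v → degree (subst (λ z → H * n ≤ 2 * (H * z) + 2 * n) (count-sum (λ u → adj G u v)) (ins v)))
            (λ v → degree (subst (λ z → H * n ≤ 2 * (H * z) + 2 * n) (count-sum (λ u → adj G v u)) (outs v))) many))
            (≤-reflexive (sym (*-assoc 2 23640 g)))))

-- Passage from natural numbers to rationals

open import Defs
open import Data.Nat using (ℕ; _≥_; _*_)
open import Data.Fin using (Fin)
open import Data.Product using (Σ; _×_; ∃; _,_; proj₁; proj₂)
open import Data.Rational using (ℚ; 0ℚ; 1ℚ; ½; _<_; _≤_; _-_; _+_) renaming (_*_ to _*ℚ_)
open import Data.Rational using (mkℚ; _/_; toℚᵘ; positive; -_)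
import Data.Nat as ℕ
import Data.Nat.Properties as ℕ
open import Data.Integer using (+_)
import Data.Integer as ℤ
import Data.Integer.Properties as ℤ
import Data.Rational as ℚ
import Data.Rational.Properties as ℚ
open import Data.Rational.Unnormalised as ℚᵘ using (mkℚᵘ; *≤*)
import Data.Rational.Unnormalised.Properties as ℚᵘ
open import Data.Nat.Tactic.RingSolver using (solve-∀)
open import Relation.Binary.PropositionalEquality using (_≡_; refl; sym; trans; cong; cong₂; subst; subst₂)
open import Data.Unit using (tt)
open import Relation.Nullary.Decidable using (toWitness)

toℚᵘ-ℕ : ∀ m → toℚᵘ (ℕ→ℚ m) ℚᵘ.≃ mkℚᵘ (+ m) 0
toℚᵘ-ℕ m = ℚ.toℚᵘ-fromℚᵘ (mkℚᵘ (+ m) 0)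

ℕ→ℚ-+ : ∀ m n → ℕ→ℚ (m ℕ.+ n) ≡ ℕ→ℚ m + ℕ→ℚ n
ℕ→ℚ-+ m n = ℚ.toℚᵘ-injective (ℚᵘ.≃-trans (toℚᵘ-ℕ (m ℕ.+ n)) (ℚᵘ.≃-trans
    (ℚᵘ.*≡* (cong (ℤ._* + 1) (trans (ℤ.pos-+ m n) (sym (cong₂ ℤ._+_ (ℤ.*-identityʳ (+ m)) (ℤ.*-identityʳ (+ n)))))))
    (ℚᵘ.≃-sym (ℚᵘ.≃-trans (ℚ.toℚᵘ-homo-+ (ℕ→ℚ m) (ℕ→ℚ n)) (ℚᵘ.+-cong (toℚᵘ-ℕ m) (toℚᵘ-ℕ n))))))

ℕ→ℚ-mono : ∀ {m n} → m ℕ.≤ n → ℕ→ℚ m ≤ ℕ→ℚ n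
ℕ→ℚ-mono {m} {n} m≤n = ℚ.toℚᵘ-cancel-≤ (ℚᵘ.≤-respˡ-≃ (ℚᵘ.≃-sym (toℚᵘ-ℕ m)) (ℚᵘ.≤-respʳ-≃ (ℚᵘ.≃-sym (toℚᵘ-ℕ n))
  (*≤* (ℤ.*-monoʳ-≤-nonNeg (+ 1) (ℤ.+≤+ m≤n)))))

fraction-≤⇒ : ∀ a b n D → (+ a / ℕ.suc b) *ℚ ℕ→ℚ n ≤ ℕ→ℚ D → a * n ℕ.≤ D * ℕ.suc b
fraction-≤⇒ a b n D h = subst₂ ℕ._≤_ (ℕ.*-identityʳ _) (cong (D *_) (ℕ.*-identityʳ (ℕ.suc b)))
  (ℤ.drop‿+≤+ (subst₂ ℤ._≤_ (trans (cong (ℤ._* + 1) (sym (ℤ.pos-* a n))) (sym (ℤ.pos-* (a * n) 1)))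
    (sym (ℤ.pos-* D (ℕ.suc b * 1))) (ℚᵘ.drop-*≤* unnormalised)))
  where
  unnormalised : mkℚᵘ (+ a) b ℚᵘ.* mkℚᵘ (+ n) 0 ℚᵘ.≤ mkℚᵘ (+ D) 0
  unnormalised = ℚᵘ.≤-respʳ-≃ (toℚᵘ-ℕ D) (ℚᵘ.≤-respˡ-≃
    (ℚᵘ.≃-trans (ℚ.toℚᵘ-homo-* (+ a / ℕ.suc b) (ℕ→ℚ n)) (ℚᵘ.*-cong (ℚ.toℚᵘ-fromℚᵘ (mkℚᵘ (+ a) b)) (toℚᵘ-ℕ n)))
    (ℚ.toℚᵘ-mono-≤ h))

-- A positive rational is at least the inverse of its denominator, so `n` need only reach `C` times
-- the denominator.
archimedean : ∀ ε → .{{ℚ.Positive ε}} → ∀ C n → n ≥ C * ℚ.denominatorℕ ε → ℕ→ℚ C ≤ ε *ℚ ℕ→ℚ n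
archimedean ε@(mkℚ (ℤ.+[1+ p ]) q _) C n n≥ = ℚ.toℚᵘ-cancel-≤ (ℚᵘ.≤-respˡ-≃ (ℚᵘ.≃-sym (toℚᵘ-ℕ C)) (ℚᵘ.≤-respʳ-≃
    (ℚᵘ.≃-sym (ℚᵘ.≃-trans (ℚ.toℚᵘ-homo-* ε (ℕ→ℚ n)) (ℚᵘ.*-congˡ {toℚᵘ ε} (toℚᵘ-ℕ n)))) (*≤* unnormalised)))
  where
  open ℕ.≤-Reasoning
  naturals : C * (ℕ.suc q * 1) ℕ.≤ ℕ.suc p * n * 1
  naturals = begin
    C * (ℕ.suc q * 1)
      ≡⟨ cong (C *_) (ℕ.*-identityʳ (ℕ.suc q)) ⟩
    C * ℕ.suc q
      ≤⟨ n≥ ⟩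
    n
      ≤⟨ ℕ.m≤m+n n (p * n) ⟩
    ℕ.suc p * n
      ≡⟨ ℕ.*-identityʳ (ℕ.suc p * n) ⟨
    ℕ.suc p * n * 1 ∎
  unnormalised : (+ C) ℤ.* (+ (ℕ.suc q * 1)) ℤ.≤ (+ ℕ.suc p ℤ.* + n) ℤ.* + 1
  unnormalised = subst₂ ℤ._≤_ (ℤ.pos-* C (ℕ.suc q * 1))
    (trans (ℤ.pos-* (ℕ.suc p * n) 1) (cong (ℤ._* + 1) (ℤ.pos-* (ℕ.suc p) n))) (ℤ.+≤+ naturals)

deficit : ∀ m C n {x} → n ℕ.≤ m ℕ.+ C → ℕ→ℚ C ≤ x → ℕ→ℚ n - ℕ→ℚ m ≤ x
deficit m C n {x} n≤ C≤x = begin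
  ℕ→ℚ n - ℕ→ℚ m
    ≤⟨ ℚ.+-monoˡ-≤ (- ℕ→ℚ m) (ℕ→ℚ-mono n≤) ⟩
  ℕ→ℚ (m ℕ.+ C) - ℕ→ℚ m
    ≡⟨ cong (_- ℕ→ℚ m) (trans (ℕ→ℚ-+ m C) (ℚ.+-comm (ℕ→ℚ m) (ℕ→ℚ C))) ⟩
  ℕ→ℚ C + ℕ→ℚ m - ℕ→ℚ m
    ≡⟨ trans (ℚ.+-assoc (ℕ→ℚ C) (ℕ→ℚ m) (- ℕ→ℚ m)) (trans (cong (_+_ (ℕ→ℚ C)) (ℚ.+-inverseʳ (ℕ→ℚ m))) (ℚ.+-identityʳ (ℕ→ℚ C))) ⟩
  ℕ→ℚ C
    ≤⟨ C≤x ⟩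
  x ∎
  where open ℚ.≤-Reasoning

almost-perfect-tiling : ∀ H a c → 47280 ℕ.< ℕ.suc H → a ℕ.+ a ℕ.+ 2 ≡ ℕ.suc H → ½ - c ≡ + a / ℕ.suc H →
  (ε : ℚ) → 0ℚ < ε → Σ ℕ λ n₀ → (n : ℕ) → n ≥ n₀ → (G : Tournament n) →
  (∀ v → ((½ - c) *ℚ ℕ→ℚ n ≤ ℕ→ℚ (outdeg G v)) × ((½ - c) *ℚ ℕ→ℚ n ≤ ℕ→ℚ (indeg G v))) →
  Σ ℕ λ k → DTiling G k × (ℕ→ℚ n - ℕ→ℚ (4 * k) ≤ ε *ℚ ℕ→ℚ n)
almost-perfect-tiling H a c H-large 2a+2≡H ½-c≡ ε 0<ε = n₀ , λ n n≥n₀ G degrees →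
  let k , T , n≤ = almost-perfect H-large G
        (ℕ.≤-trans (ℕ.≤-trans (ℕ.m≤m+n size₀ (leftover₀ * ℚ.denominatorℕ ε)) (ℕ.m≤m+n _ 1)) n≥n₀)
        (ℕ.≤-trans (ℕ.m≤n+m 1 (size₀ ℕ.+ leftover₀ * ℚ.denominatorℕ ε)) n≥n₀)
        (λ v → degree n {indeg G v} (proj₂ (degrees v))) (λ v → degree n {outdeg G v} (proj₁ (degrees v)))
  in k , T , deficit (4 * k) leftover₀ n n≤
       (archimedean ε ⦃ positive 0<ε ⦄ leftover₀ n
         (ℕ.≤-trans (ℕ.≤-trans (ℕ.m≤n+m _ size₀) (ℕ.m≤m+n _ 1)) n≥n₀))
  where
  open Combinatorics.Parameters (ℕ.suc H) using (size₀; leftover₀; almost-perfect)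
  n₀ : ℕ
  n₀ = size₀ ℕ.+ leftover₀ * ℚ.denominatorℕ ε ℕ.+ 1
  split : ∀ a n → (a ℕ.+ a ℕ.+ 2) * n ≡ 2 * (a * n) ℕ.+ 2 * n
  split = solve-∀
  degree : ∀ n {D} → (½ - c) *ℚ ℕ→ℚ n ≤ ℕ→ℚ D → ℕ.suc H * n ℕ.≤ 2 * (ℕ.suc H * D) ℕ.+ 2 * n
  degree n {D} h = ℕ.≤-trans (ℕ.≤-reflexive (trans (cong (_* n) (sym 2a+2≡H)) (split a n)))
    (ℕ.+-monoˡ-≤ (2 * n) (ℕ.*-monoʳ-≤ 2 (ℕ.≤-trans
      (fraction-≤⇒ a H n D (subst (λ x → x *ℚ ℕ→ℚ n ≤ ℕ→ℚ D) ½-c≡ h))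
      (ℕ.≤-reflexive (ℕ.*-comm D (ℕ.suc H))))))

theorem5p5 : Σ ℚ λ c → (0ℚ < c) × ((ε : ℚ) → 0ℚ < ε → ε < 1ℚ → Σ ℕ λ n₀ → (n : ℕ) → n ≥ n₀ → (G : Tournament n) → (∀ v → ((½ - c) *ℚ ℕ→ℚ n ≤ ℕ→ℚ (outdeg G v)) × ((½ - c) *ℚ ℕ→ℚ n ≤ ℕ→ℚ (indeg G v))) → Σ ℕ λ k → DTiling G k × (ℕ→ℚ n - ℕ→ℚ (4 * k) ≤ ε *ℚ ℕ→ℚ n))
-- 50000 is a round number above 47280, and even, so that `½ - c = 24999 / 50000` has the parameter
-- itself as denominator. The argument 49999 is its predecessor.
theorem5p5 = + 1 / 50000 , toWitness {a? = 0ℚ ℚ.<? (+ 1 / 50000)} tt ,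
  λ ε 0<ε _ → almost-perfect-tiling 49999 24999 (+ 1 / 50000) (toWitness {a? = 47280 ℕ.<? 50000} tt) refl refl ε 0<ε
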